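{- Let $d$ and $n$ be integers with $d\geq 4$ and $n\geq 11$, and let $m$ be an integer with $20\leq m\leq 3n-9$ or with $3n-5\leq m\leq \binom{n}{2}-2$. Then there is no $d$-uniformly most reliable two-terminal graph ($d$-UMRTTG) in $T_{n,m}$.
   Context: All graphs are finite, simple and undirected. A two-terminal graph is a graph $G$ together with two distinguished vertices $s,t$ (the terminals). Two two-terminal graphs are isomorphic if there is a graph isomorphism between them mapping the set of terminals onto the set of terminals. $T_{n,m}$ denotes the set of all pairwise nonisomorphic two-terminal graphs with $n$ vertices and $m$ edges. For a positive integer $d$, a $d$-pathset of a two-terminal graph $G$ is a spanning subgraph of $G$ containing a path of length (number of edges) at most $d$ joining $s$ and $t$. For $\rho\in[0,1]$, the $d$-constrained two-terminal reliability $R_G^d(\rho)$ is the probability that the random spanning subgraph obtained from $G$ by deleting each edge independently with probability $\rho$ is a $d$-pathset. A graph $G\in T_{n,m}$ is a $d$-UMRTTG if $R_G^d(\rho)\geq R_H^d(\rho)$ for every $H\in T_{n,m}$ and every $\rho\in[0,1]$. -}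

module Defs where

open import Algebra.Bundles using (CommutativeMonoid)
import Algebra.Properties.CommutativeSemigroup as CommutativeSemigroupProperties
import Algebra.Properties.Group as GroupProperties
import Algebra.Properties.Ring as RingProperties
open import Data.Bool.Base using (Bool; true; false; T; if_then_else_)
open import Data.Bool.Properties using (T?)
open import Data.Fin.Base using (Fin)
import Data.Fin.Base as Fin
import Data.Fin.Properties as Fin
open import Data.Fin.Subset using (Subset; inside; outside; _∈_; ∣_∣; ∁)
open import Data.Fin.Subset.Properties using (_∈?_)
open import Data.List.Base
  using (List; []; _∷_; length; lookup; filter; allFin; cartesianProduct)
open import Data.List.Relation.Unary.All using (All; []; _∷_)
import Data.List.Relation.Unary.All as All
open import Data.List.Relation.Unary.AllPairs using ([]; _∷_)
open import Data.List.Relation.Unary.Any using (here; there)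
open import Data.List.Relation.Unary.Unique.Propositional using (Unique)
import Data.List.Membership.Propositional as L
import Data.List.Membership.DecPropositional as DecL
open import Data.Nat.Base using (ℕ; zero; suc)
import Data.Nat.Base as ℕ
import Data.Nat.Properties as ℕ
open import Data.Product.Base using (Σ; ∃; ∃-syntax; Σ-syntax; _×_; _,_; proj₁; proj₂)
open import Data.Product.Properties using (≡-dec)
open import Data.Rational.Base using (ℚ; 0ℚ; 1ℚ)
import Data.Rational.Base as ℚ
import Data.Rational.Properties as ℚ
open import Data.Sum.Base using (_⊎_)
import Data.Vec.Base as Vec
open import Function.Base using (_∘_)
open import Level using (0ℓ)
open import Relation.Binary.Core using (Rel)
open import Relation.Binary.Definitions using (Decidable)
open import Relation.Binary.PropositionalEquality
  using (_≡_; _≢_; refl; sym; cong; cong₂; subst; subst₂)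
open import Relation.Nullary.Decidable
  using (Dec; yes; no; ⌊_⌋; map′; _×-dec_; _⊎-dec_; ¬?)
open import Relation.Nullary.Negation using (¬_)

------------------------------------------------------------------------
-- Real numbers, as Cauchy sequences of rationals with pointwise operations

IsCauchy : (ℕ → ℚ) → Set
IsCauchy x = ∀ ε → 0ℚ ℚ.< ε →
  ∃[ N ] ∀ i j → N ℕ.≤ i → N ℕ.≤ j → ℚ.∣ x i ℚ.- x j ∣ ℚ.≤ ε

record ℝ : Set where
  constructor mkℝ
  field
    seq      : ℕ → ℚ
    isCauchy : IsCauchy seq

open ℝ public

infix 4 _≤ᴿ_

-- The order on limits: pointwise inequality, eventually, up to every ε > 0.
_≤ᴿ_ : ℝ → ℝ → Set
x ≤ᴿ y = ∀ ε → 0ℚ ℚ.< ε → ∃[ N ] ∀ i → N ℕ.≤ i → seq x i ℚ.≤ seq y i ℚ.+ ε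

private
  open ℚ.≤-Reasoning

  module +-Group = GroupProperties ℚ.+-0-group
  module +-Semigroup = CommutativeSemigroupProperties
    (CommutativeMonoid.commutativeSemigroup ℚ.+-0-commutativeMonoid)
  module ℚ-Ring = RingProperties ℚ.+-*-ring

  telescope : ∀ p q r → p ℚ.- r ≡ (p ℚ.- q) ℚ.+ (q ℚ.- r)
  telescope p q r = begin-equality
    p ℚ.- r                      ≡⟨ cong (ℚ._- r) (+-Group.//-rightDividesˡ q p) ⟨
    ((p ℚ.- q) ℚ.+ q) ℚ.- r      ≡⟨ ℚ.+-assoc (p ℚ.- q) q (ℚ.- r) ⟩
    (p ℚ.- q) ℚ.+ (q ℚ.- r)      ∎

  -‿+-interchange : ∀ p q r s →
    (p ℚ.+ q) ℚ.- (r ℚ.+ s) ≡ (p ℚ.- r) ℚ.+ (q ℚ.- s)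
  -‿+-interchange p q r s = begin-equality
    (p ℚ.+ q) ℚ.- (r ℚ.+ s)              ≡⟨ cong ((p ℚ.+ q) ℚ.+_) (ℚ.neg-distrib-+ r s) ⟩
    (p ℚ.+ q) ℚ.+ (ℚ.- r ℚ.+ ℚ.- s)      ≡⟨ +-Semigroup.interchange p q (ℚ.- r) (ℚ.- s) ⟩
    (p ℚ.- r) ℚ.+ (q ℚ.- s)              ∎

  *-difference : ∀ p q r s →
    p ℚ.* q ℚ.- r ℚ.* s ≡ p ℚ.* (q ℚ.- s) ℚ.+ (p ℚ.- r) ℚ.* s
  *-difference p q r s = begin-equality
    p ℚ.* q ℚ.- r ℚ.* s
      ≡⟨ telescope (p ℚ.* q) (p ℚ.* s) (r ℚ.* s) ⟩
    (p ℚ.* q ℚ.- p ℚ.* s) ℚ.+ (p ℚ.* s ℚ.- r ℚ.* s)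
      ≡⟨ cong₂ ℚ._+_ (ℚ-Ring.x[y-z]≈xy-xz p q s) (ℚ-Ring.[y-z]x≈yx-zx s p r) ⟨
    p ℚ.* (q ℚ.- s) ℚ.+ (p ℚ.- r) ℚ.* s ∎

  split : ∀ ε b → 0ℚ ℚ.< ε → 0ℚ ℚ.< b → ∃[ δ ] (0ℚ ℚ.< δ × b ℚ.* δ ≡ ε)
  split ε b 0<ε 0<b = 1/b ℚ.* ε , 0<δ , eq
    where
    instance
      b>0 : ℚ.Positive b
      b>0 = ℚ.positive 0<b
      b≢0 : ℚ.NonZero b
      b≢0 = ℚ.pos⇒nonZero b
    1/b = ℚ.1/ b
    0<δ : 0ℚ ℚ.< 1/b ℚ.* ε
    0<δ = subst (ℚ._< 1/b ℚ.* ε) (ℚ.*-zeroʳ 1/b)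
            (ℚ.*-monoʳ-<-pos 1/b {{ℚ.1/pos⇒pos b}} 0<ε)
    eq : b ℚ.* (1/b ℚ.* ε) ≡ ε
    eq = begin-equality
      b ℚ.* (1/b ℚ.* ε)  ≡⟨ ℚ.*-assoc b 1/b ε ⟨
      (b ℚ.* 1/b) ℚ.* ε  ≡⟨ cong (ℚ._* ε) (ℚ.*-inverseʳ b) ⟩
      1ℚ ℚ.* ε           ≡⟨ ℚ.*-identityˡ ε ⟩
      ε                  ∎

  bounded : ∀ x → IsCauchy x →
            ∃[ b ] (0ℚ ℚ.< b × ∃[ N ] ∀ i → N ℕ.≤ i → ℚ.∣ x i ∣ ℚ.≤ b)
  bounded x c with c 1ℚ (ℚ.positive⁻¹ 1ℚ)
  ... | N , close = 1ℚ ℚ.+ ℚ.∣ x N ∣ , 0<b , N , le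
    where
    0<b : 0ℚ ℚ.< 1ℚ ℚ.+ ℚ.∣ x N ∣
    0<b = ℚ.+-mono-<-≤ (ℚ.positive⁻¹ 1ℚ) (ℚ.0≤∣p∣ (x N))
    le : ∀ i → N ℕ.≤ i → ℚ.∣ x i ∣ ℚ.≤ 1ℚ ℚ.+ ℚ.∣ x N ∣
    le i N≤i = begin
      ℚ.∣ x i ∣                         ≡⟨ cong ℚ.∣_∣ (+-Group.//-rightDividesˡ (x N) (x i)) ⟨
      ℚ.∣ (x i ℚ.- x N) ℚ.+ x N ∣       ≤⟨ ℚ.∣p+q∣≤∣p∣+∣q∣ (x i ℚ.- x N) (x N) ⟩
      ℚ.∣ x i ℚ.- x N ∣ ℚ.+ ℚ.∣ x N ∣   ≤⟨ ℚ.+-monoˡ-≤ ℚ.∣ x N ∣ (close i N N≤i ℕ.≤-refl) ⟩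
      1ℚ ℚ.+ ℚ.∣ x N ∣                  ∎

  const-cauchy : ∀ q → IsCauchy (λ _ → q)
  const-cauchy q ε 0<ε = 0 , λ _ _ _ _ →
    subst (λ z → ℚ.∣ z ∣ ℚ.≤ ε) (sym (ℚ.+-inverseʳ q)) (ℚ.<⇒≤ 0<ε)

  neg-cauchy : ∀ {x} → IsCauchy x → IsCauchy (λ i → ℚ.- x i)
  neg-cauchy {x} c ε 0<ε with c ε 0<ε
  ... | N , close = N , λ i j N≤i N≤j → begin
    ℚ.∣ ℚ.- x i ℚ.- ℚ.- x j ∣   ≡⟨ cong ℚ.∣_∣ (ℚ.neg-distrib-+ (x i) (ℚ.- x j)) ⟨
    ℚ.∣ ℚ.- (x i ℚ.- x j) ∣     ≡⟨ ℚ.∣-p∣≡∣p∣ (x i ℚ.- x j) ⟩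
    ℚ.∣ x i ℚ.- x j ∣           ≤⟨ close i j N≤i N≤j ⟩
    ε                           ∎

  +-cauchy : ∀ {x y} → IsCauchy x → IsCauchy y → IsCauchy (λ i → x i ℚ.+ y i)
  +-cauchy {x} {y} cx cy ε 0<ε with split ε (1ℚ ℚ.+ 1ℚ) 0<ε (ℚ.positive⁻¹ (1ℚ ℚ.+ 1ℚ))
  ... | δ , 0<δ , eq with cx δ 0<δ | cy δ 0<δ
  ... | M , close-x | N , close-y = M ℕ.⊔ N , λ i j ≤i ≤j → begin
    ℚ.∣ (x i ℚ.+ y i) ℚ.- (x j ℚ.+ y j) ∣
      ≡⟨ cong ℚ.∣_∣ (-‿+-interchange (x i) (y i) (x j) (y j)) ⟩
    ℚ.∣ (x i ℚ.- x j) ℚ.+ (y i ℚ.- y j) ∣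
      ≤⟨ ℚ.∣p+q∣≤∣p∣+∣q∣ (x i ℚ.- x j) (y i ℚ.- y j) ⟩
    ℚ.∣ x i ℚ.- x j ∣ ℚ.+ ℚ.∣ y i ℚ.- y j ∣
      ≤⟨ ℚ.+-mono-≤
           (close-x i j (ℕ.m⊔n≤o⇒m≤o M N ≤i) (ℕ.m⊔n≤o⇒m≤o M N ≤j))
           (close-y i j (ℕ.m⊔n≤o⇒n≤o M N ≤i) (ℕ.m⊔n≤o⇒n≤o M N ≤j)) ⟩
    δ ℚ.+ δ
      ≡⟨ cong₂ ℚ._+_ (ℚ.*-identityˡ δ) (ℚ.*-identityˡ δ) ⟨
    1ℚ ℚ.* δ ℚ.+ 1ℚ ℚ.* δ
      ≡⟨ ℚ.*-distribʳ-+ δ 1ℚ 1ℚ ⟨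
    (1ℚ ℚ.+ 1ℚ) ℚ.* δ
      ≡⟨ eq ⟩
    ε ∎

  ∣*∣≤ : ∀ p q {b c} → 0ℚ ℚ.< b → ℚ.∣ p ∣ ℚ.≤ b → ℚ.∣ q ∣ ℚ.≤ c →
         ℚ.∣ p ℚ.* q ∣ ℚ.≤ b ℚ.* c
  ∣*∣≤ p q {b} {c} 0<b p≤b q≤c = begin
    ℚ.∣ p ℚ.* q ∣          ≡⟨ ℚ.∣p*q∣≡∣p∣*∣q∣ p q ⟩
    ℚ.∣ p ∣ ℚ.* ℚ.∣ q ∣    ≤⟨ ℚ.*-monoʳ-≤-nonNeg ℚ.∣ q ∣ {{ℚ.∣-∣-nonNeg q}} p≤b ⟩
    b ℚ.* ℚ.∣ q ∣          ≤⟨ ℚ.*-monoˡ-≤-nonNeg b {{ℚ.nonNegative (ℚ.<⇒≤ 0<b)}} q≤c ⟩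
    b ℚ.* c                ∎

  *-cauchy : ∀ {x y} → IsCauchy x → IsCauchy y → IsCauchy (λ i → x i ℚ.* y i)
  *-cauchy {x} {y} cx cy ε 0<ε with bounded x cx | bounded y cy
  ... | a , 0<a , K , x≤a | b , 0<b , L , y≤b
    with split ε (a ℚ.+ b) 0<ε (ℚ.+-mono-< 0<a 0<b)
  ... | δ , 0<δ , eq with cx δ 0<δ | cy δ 0<δ
  ... | M , close-x | N , close-y = (K ℕ.⊔ L) ℕ.⊔ (M ℕ.⊔ N) , close
    where
    close : ∀ i j → (K ℕ.⊔ L) ℕ.⊔ (M ℕ.⊔ N) ℕ.≤ i → (K ℕ.⊔ L) ℕ.⊔ (M ℕ.⊔ N) ℕ.≤ j →
            ℚ.∣ x i ℚ.* y i ℚ.- x j ℚ.* y j ∣ ℚ.≤ ε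
    close i j ≤i ≤j = begin
      ℚ.∣ x i ℚ.* y i ℚ.- x j ℚ.* y j ∣
        ≡⟨ cong ℚ.∣_∣ (*-difference (x i) (y i) (x j) (y j)) ⟩
      ℚ.∣ x i ℚ.* Δy ℚ.+ Δx ℚ.* y j ∣
        ≤⟨ ℚ.∣p+q∣≤∣p∣+∣q∣ (x i ℚ.* Δy) (Δx ℚ.* y j) ⟩
      ℚ.∣ x i ℚ.* Δy ∣ ℚ.+ ℚ.∣ Δx ℚ.* y j ∣
        ≡⟨ cong (λ z → ℚ.∣ x i ℚ.* Δy ∣ ℚ.+ ℚ.∣ z ∣) (ℚ.*-comm Δx (y j)) ⟩
      ℚ.∣ x i ℚ.* Δy ∣ ℚ.+ ℚ.∣ y j ℚ.* Δx ∣
        ≤⟨ ℚ.+-mono-≤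
             (∣*∣≤ (x i) Δy 0<a (x≤a i (ℕ.m⊔n≤o⇒m≤o K L KL≤i))
               (close-y i j (ℕ.m⊔n≤o⇒n≤o M N MN≤i) (ℕ.m⊔n≤o⇒n≤o M N MN≤j)))
             (∣*∣≤ (y j) Δx 0<b (y≤b j (ℕ.m⊔n≤o⇒n≤o K L KL≤j))
               (close-x i j (ℕ.m⊔n≤o⇒m≤o M N MN≤i) (ℕ.m⊔n≤o⇒m≤o M N MN≤j))) ⟩
      a ℚ.* δ ℚ.+ b ℚ.* δ
        ≡⟨ ℚ.*-distribʳ-+ δ a b ⟨
      (a ℚ.+ b) ℚ.* δ
        ≡⟨ eq ⟩
      ε ∎
      where
      Δx = x i ℚ.- x j
      Δy = y i ℚ.- y j
      KL≤i = ℕ.m⊔n≤o⇒m≤o (K ℕ.⊔ L) (M ℕ.⊔ N) ≤i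
      KL≤j = ℕ.m⊔n≤o⇒m≤o (K ℕ.⊔ L) (M ℕ.⊔ N) ≤j
      MN≤i = ℕ.m⊔n≤o⇒n≤o (K ℕ.⊔ L) (M ℕ.⊔ N) ≤i
      MN≤j = ℕ.m⊔n≤o⇒n≤o (K ℕ.⊔ L) (M ℕ.⊔ N) ≤j

infixl 6 _+ᴿ_ _-ᴿ_
infixl 7 _*ᴿ_
infixr 8 _^ᴿ_

fromℚ : ℚ → ℝ
fromℚ q = mkℝ (λ _ → q) (const-cauchy q)

0ᴿ 1ᴿ : ℝ
0ᴿ = fromℚ 0ℚ
1ᴿ = fromℚ 1ℚ

-ᴿ_ : ℝ → ℝ
-ᴿ x = mkℝ (λ i → ℚ.- seq x i) (neg-cauchy {seq x} (isCauchy x))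

_+ᴿ_ _-ᴿ_ _*ᴿ_ : ℝ → ℝ → ℝ
x +ᴿ y = mkℝ (λ i → seq x i ℚ.+ seq y i) (+-cauchy {seq x} {seq y} (isCauchy x) (isCauchy y))
x -ᴿ y = x +ᴿ (-ᴿ y)
x *ᴿ y = mkℝ (λ i → seq x i ℚ.* seq y i) (*-cauchy {seq x} {seq y} (isCauchy x) (isCauchy y))

_^ᴿ_ : ℝ → ℕ → ℝ
x ^ᴿ zero  = 1ᴿ
x ^ᴿ suc k = x *ᴿ x ^ᴿ k

∑ᴿ : ∀ {k} → (Subset k → ℝ) → ℝ
∑ᴿ {zero}  f = f Vec.[]
∑ᴿ {suc k} f = ∑ᴿ (f ∘ (inside Vec.∷_)) +ᴿ ∑ᴿ (f ∘ (outside Vec.∷_))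

------------------------------------------------------------------------
-- Paths

data Walk {n} (_~_ : Rel (Fin n) 0ℓ) : Fin n → Fin n → ℕ → Set where
  nil : ∀ {u} → Walk _~_ u u 0
  cons : ∀ {u v w k} → u ~ v → Walk _~_ v w k → Walk _~_ u w (suc k)

vertices : ∀ {n} {_~_ : Rel (Fin n) 0ℓ} {u w k} → Walk _~_ u w k → List (Fin n)
vertices (nil {u})     = u ∷ []
vertices (cons {u} _ p) = u ∷ vertices p

Path : ∀ {n} → Rel (Fin n) 0ℓ → Fin n → Fin n → ℕ → Set
Path _~_ u w k = Σ[ p ∈ Walk _~_ u w k ] Unique (vertices p)

private
  module _ {n} {_~_ : Rel (Fin n) 0ℓ} (_~?_ : Decidable _~_) where

    PathAvoiding : List (Fin n) → Fin n → Fin n → ℕ → Set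
    PathAvoiding xs u w k =
      Σ[ p ∈ Walk _~_ u w k ] Unique (vertices p) × All (L._∉ xs) (vertices p)

    pathAvoiding? : ∀ xs u w k → Dec (PathAvoiding xs u w k)
    pathAvoiding? xs u w zero =
      map′ (λ { (refl , u∉xs) → nil , ([] ∷ []) , (u∉xs ∷ []) })
           (λ { (nil , _ , (u∉xs ∷ [])) → refl , u∉xs })
           ((u Fin.≟ w) ×-dec ¬? (DecL._∈?_ Fin._≟_ u xs))
    pathAvoiding? xs u w (suc k) =
      map′ (λ { (u∉xs , v , u~v , p , uniq , avoid) →
                cons u~v p ,
                (All.map (λ x∉ u≡x → x∉ (here (sym u≡x))) avoid ∷ uniq) ,
                (u∉xs ∷ All.map (λ x∉ x∈ → x∉ (there x∈)) avoid) })
           (λ { (cons {v = v} u~v p , (u≢ ∷ uniq) , (u∉xs ∷ avoid)) →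
                u∉xs , v , u~v , p , uniq ,
                All.zipWith (λ { (u≢x , x∉) (here x≡u)  → u≢x (sym x≡u)
                               ; (u≢x , x∉) (there x∈) → x∉ x∈ }) (u≢ , avoid) })
           (¬? (DecL._∈?_ Fin._≟_ u xs) ×-dec
            Fin.any? (λ v → (u ~? v) ×-dec pathAvoiding? (u ∷ xs) v w k))

    path? : ∀ u w k → Dec (Path _~_ u w k)
    path? u w k =
      map′ (λ { (p , uniq , _) → p , uniq })
           (λ { (p , uniq) → p , uniq , All.tabulate (λ _ ()) })
           (pathAvoiding? [] u w k)

    boundedPath? : ∀ u w d → Dec (∃[ k ] (k ℕ.≤ d × Path _~_ u w k))
    boundedPath? u w d =
      map′ (λ { (k , k<1+d , p) → k , ℕ.s≤s⁻¹ k<1+d , p })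
           (λ { (k , k≤d , p) → k , ℕ.s≤s k≤d , p })
           (ℕ.anyUpTo? (path? u w) (suc d))

------------------------------------------------------------------------
-- Two-terminal graphs

record Graph (n : ℕ) : Set where
  field
    adj         : Fin n → Fin n → Bool
    symmetric   : ∀ u v → adj u v ≡ adj v u
    irreflexive : ∀ v → adj v v ≡ false

  -- Each edge {u , v} is listed once, as (u , v) with u < v.
  edges : List (Fin n × Fin n)
  edges = filter (λ (u , v) → (u Fin.<? v) ×-dec T? (adj u v))
                 (cartesianProduct (allFin n) (allFin n))

  size : ℕ
  size = length edges

  -- A set S of (indices of) edges stands for the spanning subgraph with
  -- edge set S; this is adjacency in that subgraph.
  AdjIn : Subset size → Rel (Fin n) 0ℓ
  AdjIn S u v =
    ∃[ e ] (e ∈ S × (lookup edges e ≡ (u , v) ⊎ lookup edges e ≡ (v , u)))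

  adjIn? : ∀ S → Decidable (AdjIn S)
  adjIn? S u v = Fin.any? λ e →
    (e ∈? S) ×-dec ((lookup edges e ≟ₑ (u , v)) ⊎-dec (lookup edges e ≟ₑ (v , u)))
    where _≟ₑ_ = ≡-dec Fin._≟_ Fin._≟_

record TwoTerminalGraph (n : ℕ) : Set where
  field
    graph : Graph n
    s t   : Fin n
    s≢t   : s ≢ t

  open Graph graph public

  IsPathset : ℕ → Subset size → Set
  IsPathset d S = ∃[ k ] (k ℕ.≤ d × Path (AdjIn S) s t k)

  isPathset? : ∀ d S → Dec (IsPathset d S)
  isPathset? d S = boundedPath? (adjIn? S) s t d

  -- S is the set of surviving edges; each edge is deleted with probability ρ.
  reliability : ℕ → ℝ → ℝ
  reliability d ρ = ∑ᴿ λ S →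
    if ⌊ isPathset? d S ⌋ then (1ᴿ -ᴿ ρ) ^ᴿ ∣ S ∣ *ᴿ ρ ^ᴿ ∣ ∁ S ∣ else 0ᴿ

-- Labelled representatives: isomorphic graphs are not identified.  Reliability
-- is an isomorphism invariant, so comparing with every labelled graph is the
-- same as comparing with one representative of each isomorphism class.
TTG : ℕ → ℕ → Set
TTG n m = Σ[ G ∈ TwoTerminalGraph n ] TwoTerminalGraph.size G ≡ m

IsUMRTTG : ∀ {n m} → ℕ → TTG n m → Set
IsUMRTTG {n} {m} d (G , _) = ((H , _) : TTG n m) (ρ : ℝ) → 0ᴿ ≤ᴿ ρ → ρ ≤ᴿ 1ᴿ →
  TwoTerminalGraph.reliability H d ρ ≤ᴿ TwoTerminalGraph.reliability G d ρ

{-# OPTIONS --safe #-}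

-- As ρ → 1, an optimal graph must contain the edge st and as many common
-- neighbours of s and t as possible.
--
-- Let m ≤ 3n - 9, and consider ρ = 1/2, where only the numbers of failing
-- states matter.  Terminal edges at a component of x common neighbours fail to
-- connect s and t in 2^(x+1) - 1 states, and
-- (2^(x+1) - 1) (2^(y+1) - 1) ≥ 3 (2^(x+y) - 1), so that among all graphs with k
-- further edges the star has the fewest failing states.  But then trading three
-- detached common neighbours for two more leaves of the star is an improvement.
--
-- Let m ≥ 3n - 5.  Then all other vertices are common neighbours; let H be the
-- graph they span, and v a vertex of minimal degree δ in H.  As ρ → 1, moving an
-- edge uv to ux would increase the number of paths with four edges, so all
-- neighbours of v are adjacent to all of H.  Hence H has enough edges to be
-- replaced by a (δ + 1)-connected graph: a cycle, a split wheel or a bipyramid,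
-- joined to a complete graph.  This is better as ρ → 0, since the cut around s
-- and v disappears.

module Submission where

-- A state is shown to work only by paths with at most four edges and to fail only by cuts, so all
-- `d ≥ 4` are treated alike. Comparisons are made at rational `ρ = b / (a + b)` with denominators
-- cleared; a limit ρ → 0 or ρ → 1 becomes one explicit weight, large enough for the leading term to
-- exceed everything else.
--
-- Let `N = n - 2`, and suppose that all N other vertices are common neighbours with k edges between
-- them, so m = k + 2N + 1. Then m ≤ 3n - 9 means k + 4 ≤ N: a star with k edges leaves three
-- vertices detached, as many as a trade consumes. The trade gains only if 11 · 4^k < 8 · 5^k, that
-- is, for k ≥ 2; with k = 1 or k = 0 two or three trades have to be made at once, and m ≥ 20
-- provides the vertices for them. On the other side, m ≥ 3n - 5 means k ≥ N, enough edges for a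
-- cycle through all of H, and m ≤ C(n,2) - 2 means that H lacks two edges, so that at least three
-- vertices, v included, are not neighbours of v.

open import Defs
open import Data.Nat.Base using (ℕ; _≤_; _*_; _∸_)
open import Data.Nat.Combinatorics using (_C_)
open import Data.Product.Base using (Σ-syntax; _×_)
open import Data.Sum.Base using (_⊎_)
open import Relation.Nullary.Negation using (¬_)

open import Data.Bool.Base using (Bool; true; false; not; _∨_; _xor_; if_then_else_)
open import Data.Bool.Properties using (T?)
import Data.Bool.Base as Bool
import Data.Bool.Properties as Bool
open import Data.Empty using (⊥; ⊥-elim)
open import Data.Fin.Base using (Fin)
import Data.Fin.Base as Fin
import Data.Fin.Properties as Fin
open import Data.Fin.Subset using (Subset; inside; outside; ∣_∣; ∁)
import Data.Fin.Subset as Subset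
import Data.Fin.Subset.Properties as Subset
open import Data.List.Base
  using (List; []; _∷_; _++_; [_]; length; lookup; map; filter; take; drop; concat; allFin; cartesianProduct)
import Data.List.Membership.DecPropositional as DecMembership
open import Data.List.Membership.Propositional using (_∈_; _∉_)
open import Data.List.Membership.Propositional.Properties
  using ( ∈-∃++; ∈-++⁺ˡ; ∈-++⁺ʳ; ∈-++⁻; ∈-filter⁺; ∈-filter⁻; ∈-map⁺; ∈-map⁻; ∈-lookup
        ; ∈-cartesianProduct⁺; ∈-allFin; ∈-concat⁻′)
open import Data.List.Properties
  using (++-assoc; ++-identityʳ; length-++; length-map; length-tabulate; length-take; take++drop≡id)
open import Data.List.Relation.Binary.Permutation.Propositional
open import Data.List.Relation.Binary.Permutation.Propositional.Properties
  using (shift; shifts; ∈-resp-↭; All-resp-↭; ↭-length; ++⁺ˡ; ++⁺ʳ; ++-comm)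
open import Data.List.Relation.Binary.Subset.Propositional using (_⊆_)
open import Data.List.Relation.Unary.All using (All; []; _∷_)
import Data.List.Relation.Unary.All as All
import Data.List.Relation.Unary.All.Properties as All
open import Data.List.Relation.Unary.All.Properties using (All¬⇒¬Any; ¬Any⇒All¬)
open import Data.List.Relation.Unary.AllPairs using ([]; _∷_)
import Data.List.Relation.Unary.AllPairs as AllPairs
open import Data.List.Relation.Unary.Any using (here; there; index)
open import Data.List.Relation.Unary.Any.Properties using (lookup-index)
open import Data.List.Relation.Unary.Unique.Propositional using (Unique)
import Data.List.Relation.Unary.Unique.Propositional.Properties as Unique
open import Data.Nat.Base hiding (_⊔_)
import Data.Nat.Base as ℕ
open import Data.Nat.Combinatorics using (nCk+nC[k+1]≡[n+1]C[k+1]; nC1≡n)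
open import Data.Nat.ListAction using (sum; product)
open import Data.Nat.Properties
import Data.Nat.Properties as ℕ
open import Data.Nat.Tactic.RingSolver using (solve-∀)
open import Data.Product.Base using (∃-syntax; _,_; proj₁; proj₂)
open import Data.Product.Properties using (≡-dec)
open import Data.Rational.Base using (ℚ; 0ℚ; 1ℚ)
import Data.Rational.Base as ℚ
import Data.Rational.Properties as ℚ
open import Data.Rational.Solver using (module +-*-Solver)
open import Data.Sum.Base using (inj₁; inj₂)
open import Data.Unit.Base using (⊤; tt)
open import Data.Vec.Base using ([]; _∷_)
import Data.Vec.Base as Vec
open import Function.Base using (_∘_; id)
open import Level using (0ℓ)
open import Relation.Binary.Core using (Rel)
open import Relation.Binary.Definitions using (tri<; tri≈; tri>)
open import Relation.Binary.PropositionalEquality as ≡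
  using (_≡_; _≢_; refl; sym; cong; cong₂; subst; subst₂)
open import Relation.Nullary.Decidable
  using (Dec; yes; no; ⌊_⌋; map′; _×-dec_; ¬?; toWitness; fromWitness)
open import Relation.Nullary.Negation using (contradiction)

-- Lists and random sublists

∈⇒↭ : ∀ {A : Set} {x : A} {ys} → x ∈ ys → ∃[ zs ] ys ↭ x ∷ zs
∈⇒↭ x∈ with ∈-∃++ x∈
... | as , bs , refl = as ++ bs , shift _ as bs

⊆⇒↭ : ∀ {A : Set} {xs ys : List A} → Unique xs → xs ⊆ ys → ∃[ zs ] ys ↭ xs ++ zs
⊆⇒↭ {xs = []} {ys} _ _ = ys , ↭-refl
⊆⇒↭ {xs = x ∷ xs} (x∉ ∷ uniq) xs⊆ with ∈⇒↭ (xs⊆ (here refl))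
... | ys′ , ys↭ with ⊆⇒↭ uniq inner
  where
  inner : xs ⊆ ys′
  inner z∈ with ∈-resp-↭ ys↭ (xs⊆ (there z∈))
  ... | here refl = ⊥-elim (All¬⇒¬Any x∉ z∈)
  ... | there z∈′ = z∈′
... | zs , ys′↭ = zs , ↭-trans ys↭ (prep x ys′↭)

Unique-⊆-length : ∀ {A : Set} {xs ys : List A} → Unique xs → xs ⊆ ys → length xs ≤ length ys
Unique-⊆-length {xs = xs} uniq xs⊆ with ⊆⇒↭ uniq xs⊆
... | zs , ys↭ = ≤-trans (m≤m+n (length xs) (length zs))
                   (≤-reflexive (≡.trans (sym (length-++ xs)) (sym (↭-length ys↭))))

Unique-resp-↭ : ∀ {A : Set} {xs ys : List A} → xs ↭ ys → Unique xs → Unique ys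
Unique-resp-↭ refl uniq = uniq
Unique-resp-↭ (prep x p) (x∉ ∷ uniq) = All-resp-↭ p x∉ ∷ Unique-resp-↭ p uniq
Unique-resp-↭ (swap x y p) ((x≢y ∷ x∉) ∷ (y∉ ∷ uniq)) =
  ((x≢y ∘ sym) ∷ All-resp-↭ p y∉) ∷ All-resp-↭ p x∉ ∷ Unique-resp-↭ p uniq
Unique-resp-↭ (trans p q) uniq = Unique-resp-↭ q (Unique-resp-↭ p uniq)

Unique-++⁻ʳ : ∀ {A : Set} (xs : List A) {ys} → Unique (xs ++ ys) → Unique ys
Unique-++⁻ʳ [] uniq = uniq
Unique-++⁻ʳ (_ ∷ xs) (_ ∷ uniq) = Unique-++⁻ʳ xs uniq

Unique-++⁻ˡ : ∀ {A : Set} (xs : List A) {ys} → Unique (xs ++ ys) → Unique xs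
Unique-++⁻ˡ [] _ = []
Unique-++⁻ˡ (x ∷ xs) (x∉ ∷ uniq) =
  All.tabulate (λ z∈ → All.lookup x∉ (∈-++⁺ˡ z∈)) ∷ Unique-++⁻ˡ xs uniq

Unique-++-disjoint : ∀ {A : Set} (xs : List A) {ys z} → Unique (xs ++ ys) → z ∈ xs → z ∉ ys
Unique-++-disjoint (x ∷ xs) (x∉ ∷ _) (here refl) z∈ys = All.lookup x∉ (∈-++⁺ʳ xs z∈ys) refl
Unique-++-disjoint (_ ∷ xs) (_ ∷ uniq) (there z∈) = Unique-++-disjoint xs uniq z∈

Unique-set⇒↭ : ∀ {A : Set} {xs ys : List A} → Unique xs → Unique ys → xs ⊆ ys → ys ⊆ xs → ys ↭ xs
Unique-set⇒↭ {xs = xs} ux uy xs⊆ ys⊆ with ⊆⇒↭ ux xs⊆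
... | [] , ys↭ = ↭-trans ys↭ (↭-reflexive (++-identityʳ xs))
... | z ∷ zs , ys↭ = ⊥-elim (Unique-++-disjoint xs (Unique-resp-↭ ys↭ uy)
                       (ys⊆ (∈-resp-↭ (↭-sym ys↭) (∈-++⁺ʳ xs (here refl)))) (here refl))

count : {A : Set} → (A → Bool) → List A → ℕ
count φ [] = 0
count φ (x ∷ xs) = (if φ x then 1 else 0) + count φ xs

count-++ : ∀ {A : Set} (φ : A → Bool) xs ys → count φ (xs ++ ys) ≡ count φ xs + count φ ys
count-++ φ [] ys = refl
count-++ φ (x ∷ xs) ys = ≡.trans (cong (_ +_) (count-++ φ xs ys)) (sym (+-assoc (if φ x then 1 else 0) _ _))

count-≤-length : ∀ {A : Set} (φ : A → Bool) xs → count φ xs ≤ length xs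
count-≤-length φ [] = z≤n
count-≤-length φ (x ∷ xs) with φ x
... | true = s≤s (count-≤-length φ xs)
... | false = m≤n⇒m≤1+n (count-≤-length φ xs)

count-↭ : ∀ {A : Set} (φ : A → Bool) {xs ys} → xs ↭ ys → count φ xs ≡ count φ ys
count-↭ φ refl = refl
count-↭ φ (prep x p) = cong ((if φ x then 1 else 0) +_) (count-↭ φ p)
count-↭ φ {x ∷ y ∷ xs} {_ ∷ _ ∷ ys} (swap _ _ p) = begin-equality
  #x + (#y + count φ xs)  ≡⟨ +-assoc #x #y _ ⟨
  #x + #y + count φ xs    ≡⟨ cong₂ _+_ (+-comm #x #y) (count-↭ φ p) ⟩
  #y + #x + count φ ys    ≡⟨ +-assoc #y #x _ ⟩
  #y + (#x + count φ ys)  ∎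
  where
  open ≤-Reasoning
  #x = if φ x then 1 else 0
  #y = if φ y then 1 else 0
count-↭ φ (trans p q) = ≡.trans (count-↭ φ p) (count-↭ φ q)

-- A random sublist S of es, in which an element is kept with weight a and
-- dropped with weight b; 𝔼 es f S₀ is the weighted sum of f (S ++ S₀).
module Expectation {A : Set} (a b : ℕ) where

  𝔼 : List A → (List A → ℕ) → List A → ℕ
  𝔼 [] f S₀ = f S₀
  𝔼 (e ∷ es) f S₀ = a * 𝔼 es f (e ∷ S₀) + b * 𝔼 es f S₀

  𝔼-++ : ∀ xs ys f S₀ → 𝔼 (xs ++ ys) f S₀ ≡ 𝔼 xs (𝔼 ys f) S₀
  𝔼-++ [] ys f S₀ = refl
  𝔼-++ (x ∷ xs) ys f S₀ =
    cong₂ (λ p q → a * p + b * q) (𝔼-++ xs ys f (x ∷ S₀)) (𝔼-++ xs ys f S₀)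

  𝔼-context : ∀ es f S₀ X → 𝔼 es f (S₀ ++ X) ≡ 𝔼 es (λ S → f (S ++ X)) S₀
  𝔼-context [] f S₀ X = refl
  𝔼-context (e ∷ es) f S₀ X =
    cong₂ (λ p q → a * p + b * q) (𝔼-context es f (e ∷ S₀) X) (𝔼-context es f S₀ X)

  -- The pointwise comparison may be restricted to actual states: `S` is drawn from `es`, so it is
  -- duplicate-free if `es` is. Allowing different contexts `X` and `Y` makes monotonicity in the
  -- context a special case (`𝔼-fails-anti`).
  𝔼-mono : ∀ es f g X Y →
           (∀ S → (Unique es → Unique S) → S ⊆ es → f (S ++ X) ≤ g (S ++ Y)) →
           𝔼 es f X ≤ 𝔼 es g Y
  𝔼-mono [] f g X Y f≤g = f≤g [] (λ _ → []) (λ ())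
  𝔼-mono (e ∷ es) f g X Y f≤g =
    +-mono-≤ (*-monoʳ-≤ a (𝔼-mono es f g (e ∷ X) (e ∷ Y) kept))
             (*-monoʳ-≤ b (𝔼-mono es f g X Y λ S uniq S⊆ →
               f≤g S (λ { (_ ∷ u) → uniq u }) (there ∘ S⊆)))
    where
    kept : ∀ S → (Unique es → Unique S) → S ⊆ es → f (S ++ e ∷ X) ≤ g (S ++ e ∷ Y)
    kept S uniq S⊆ = ≡.subst₂ _≤_ (cong f (++-assoc S [ e ] X)) (cong g (++-assoc S [ e ] Y))
      (f≤g (S ++ [ e ]) uniq′ sub)
      where
      uniq′ : Unique (e ∷ es) → Unique (S ++ [ e ])
      uniq′ (e∉ ∷ u) = Unique-resp-↭ (++-comm [ e ] S)
        (All.tabulate (λ z∈ → All.lookup e∉ (S⊆ z∈)) ∷ uniq u)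
      sub : S ++ [ e ] ⊆ e ∷ es
      sub z∈ with ∈-++⁻ S z∈
      ... | inj₁ z∈S = there (S⊆ z∈S)
      ... | inj₂ (here refl) = here refl

  𝔼-mono-all : ∀ es {f g} X → (∀ S → f S ≤ g S) → 𝔼 es f X ≤ 𝔼 es g X
  𝔼-mono-all es X f≤g = 𝔼-mono es _ _ X X λ S _ _ → f≤g (S ++ X)

  𝔼-+ : ∀ es f g X → 𝔼 es (λ S → f S + g S) X ≡ 𝔼 es f X + 𝔼 es g X
  𝔼-+ [] f g X = refl
  𝔼-+ (e ∷ es) f g X =
    ≡.trans (cong₂ (λ p q → a * p + b * q) (𝔼-+ es f g (e ∷ X)) (𝔼-+ es f g X))
            (regroup a b (𝔼 es f (e ∷ X)) (𝔼 es g (e ∷ X)) (𝔼 es f X) (𝔼 es g X))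
    where
    regroup : ∀ a b p q r s → a * (p + q) + b * (r + s) ≡ (a * p + b * r) + (a * q + b * s)
    regroup = solve-∀

  𝔼-const : ∀ es c X → 𝔼 es (λ _ → c) X ≡ (a + b) ^ length es * c
  𝔼-const [] c X = sym (+-identityʳ c)
  𝔼-const (e ∷ es) c X =
    ≡.trans (cong₂ (λ p q → a * p + b * q) (𝔼-const es c (e ∷ X)) (𝔼-const es c X))
            (regroup a b c ((a + b) ^ length es))
    where
    regroup : ∀ a b c k → a * (k * c) + b * (k * c) ≡ (a + b) * k * c
    regroup = solve-∀

  𝔼-sum : ∀ {B : Set} es (f : B → List A → ℕ) xs X →
          𝔼 es (λ S → sum (map (λ x → f x S) xs)) X ≡ sum (map (λ x → 𝔼 es (f x) X) xs)
  𝔼-sum es f [] X = ≡.trans (𝔼-const es 0 X) (*-zeroʳ ((a + b) ^ length es))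
  𝔼-sum es f (x ∷ xs) X =
    ≡.trans (𝔼-+ es (f x) (λ S → sum (map (λ y → f y S) xs)) X)
            (cong (𝔼 es (f x) X +_) (𝔼-sum es f xs X))

  module _ (f : List A → ℕ) (f-↭ : ∀ {S S′} → S ↭ S′ → f S ≡ f S′) where

    𝔼-resp-↭ : ∀ es {X Y} → X ↭ Y → 𝔼 es f X ≡ 𝔼 es f Y
    𝔼-resp-↭ [] p = f-↭ p
    𝔼-resp-↭ (e ∷ es) p =
      cong₂ (λ p q → a * p + b * q) (𝔼-resp-↭ es (prep e p)) (𝔼-resp-↭ es p)

    𝔼-↭ : ∀ {es es′} → es ↭ es′ → ∀ X → 𝔼 es f X ≡ 𝔼 es′ f X
    𝔼-↭ refl X = refl
    𝔼-↭ (prep e p) X = cong₂ (λ p q → a * p + b * q) (𝔼-↭ p (e ∷ X)) (𝔼-↭ p X)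
    𝔼-↭ {_ ∷ _ ∷ es} {_ ∷ _ ∷ es′} (swap x y p) X
      rewrite 𝔼-resp-↭ es (swap y x (↭-refl {x = X}))
            | 𝔼-↭ p (x ∷ y ∷ X) | 𝔼-↭ p (x ∷ X) | 𝔼-↭ p (y ∷ X) | 𝔼-↭ p X
      = regroup a b (𝔼 es′ f (x ∷ y ∷ X)) (𝔼 es′ f (x ∷ X)) (𝔼 es′ f (y ∷ X)) (𝔼 es′ f X)
      where
      regroup : ∀ a b p q r s → a * (a * p + b * q) + b * (a * r + b * s)
                              ≡ a * (a * p + b * r) + b * (a * q + b * s)
      regroup = solve-∀
    𝔼-↭ (trans p q) X = ≡.trans (𝔼-↭ p X) (𝔼-↭ q X)

  -- Only the state that drops all of `es` is counted.
  𝔼-≥-drop : ∀ es f X → b ^ length es * f X ≤ 𝔼 es f X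
  𝔼-≥-drop [] f X = ≤-reflexive (+-identityʳ (f X))
  𝔼-≥-drop (e ∷ es) f X = begin
    b * b ^ length es * f X    ≡⟨ *-assoc b (b ^ length es) (f X) ⟩
    b * (b ^ length es * f X)  ≤⟨ *-monoʳ-≤ b (𝔼-≥-drop es f X) ⟩
    b * 𝔼 es f X               ≤⟨ m≤n+m (b * 𝔼 es f X) (a * 𝔼 es f (e ∷ X)) ⟩
    𝔼 (e ∷ es) f X             ∎
    where open ≤-Reasoning

avoid : {A : Set} → (A → Bool) → List A → ℕ
avoid φ [] = 1
avoid φ (e ∷ S) = if φ e then 0 else avoid φ S

module _ {A : Set} (a : ℕ) where
  open Expectation {A} a 1

  -- Elements satisfying `φ` have to be dropped and contribute `1` instead of `a + 1`; the others
  -- are free. The power on the left replaces a division.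
  𝔼-avoid : ∀ (φ : A → Bool) es X →
            𝔼 es (avoid φ) X * suc a ^ count φ es ≡ suc a ^ length es * avoid φ X
  𝔼-avoid φ [] X = ≡.trans (*-identityʳ _) (sym (*-identityˡ _))
  𝔼-avoid φ (e ∷ es) X with φ e in eq
  ... | true = begin-equality
    (a * 𝔼 es (avoid φ) (e ∷ X) + (E + 0)) * (suc a * K)
      ≡⟨ regroup a E K (𝔼 es (avoid φ) (e ∷ X)) ⟩
    a * suc a * (𝔼 es (avoid φ) (e ∷ X) * K) + suc a * (E * K)
      ≡⟨ cong₂ (λ x y → a * suc a * x + suc a * y) (𝔼-avoid φ es (e ∷ X)) (𝔼-avoid φ es X) ⟩
    a * suc a * (L * avoid φ (e ∷ X)) + suc a * (L * avoid φ X)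
      ≡⟨ cong (λ z → a * suc a * (L * (if z then 0 else avoid φ X)) + suc a * (L * avoid φ X)) eq ⟩
    a * suc a * (L * 0) + suc a * (L * avoid φ X)
      ≡⟨ regroup′ a L (avoid φ X) ⟩
    suc a * L * avoid φ X ∎
    where
    open ≤-Reasoning
    E = 𝔼 es (avoid φ) X
    K = suc a ^ count φ es
    L = suc a ^ length es
    regroup : ∀ a E K F → (a * F + (E + 0)) * ((1 + a) * K) ≡ a * (1 + a) * (F * K) + (1 + a) * (E * K)
    regroup = solve-∀
    regroup′ : ∀ a L v → a * (1 + a) * (L * 0) + (1 + a) * (L * v) ≡ (1 + a) * L * v
    regroup′ = solve-∀
  ... | false = begin-equality
    (a * 𝔼 es (avoid φ) (e ∷ X) + (E + 0)) * K
      ≡⟨ regroup a E K (𝔼 es (avoid φ) (e ∷ X)) ⟩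
    a * (𝔼 es (avoid φ) (e ∷ X) * K) + E * K
      ≡⟨ cong₂ (λ x y → a * x + y) (𝔼-avoid φ es (e ∷ X)) (𝔼-avoid φ es X) ⟩
    a * (L * avoid φ (e ∷ X)) + L * avoid φ X
      ≡⟨ cong (λ z → a * (L * (if z then 0 else avoid φ X)) + L * avoid φ X) eq ⟩
    a * (L * avoid φ X) + L * avoid φ X
      ≡⟨ regroup′ a L (avoid φ X) ⟩
    suc a * L * avoid φ X ∎
    where
    open ≤-Reasoning
    E = 𝔼 es (avoid φ) X
    K = suc a ^ count φ es
    L = suc a ^ length es
    regroup : ∀ a E K F → (a * F + (E + 0)) * K ≡ a * (F * K) + E * K
    regroup = solve-∀
    regroup′ : ∀ a L v → a * (L * v) + L * v ≡ (1 + a) * L * v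
    regroup′ = solve-∀

  -- For large `a` sparse states are light: each of the `2 ^ length es` states has weight at most
  -- `c`. The factor `a ^ length X` accounts for the context, which grows by the kept elements.
  𝔼-few : ∀ es f X c → (∀ S → f S * a ^ length S ≤ c) →
          𝔼 es f X * a ^ length X ≤ 2 ^ length es * c
  𝔼-few [] f X c f≤ = ≤-trans (f≤ X) (≤-reflexive (sym (+-identityʳ c)))
  𝔼-few (e ∷ es) f X c f≤ = begin
    (a * 𝔼 es f (e ∷ X) + (𝔼 es f X + 0)) * a ^ length X
      ≡⟨ regroup a (𝔼 es f (e ∷ X)) (𝔼 es f X) (a ^ length X) ⟩
    𝔼 es f (e ∷ X) * (a * a ^ length X) + 𝔼 es f X * a ^ length X
      ≤⟨ +-mono-≤ (𝔼-few es f (e ∷ X) c f≤) (𝔼-few es f X c f≤) ⟩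
    2 ^ length es * c + 2 ^ length es * c
      ≡⟨ regroup′ (2 ^ length es) c ⟩
    2 * 2 ^ length es * c ∎
    where
    open ≤-Reasoning
    regroup : ∀ a p q l → (a * p + (q + 0)) * l ≡ p * (a * l) + q * l
    regroup = solve-∀
    regroup′ : ∀ p c → p * c + p * c ≡ 2 * p * c
    regroup′ = solve-∀

module _ {A : Set} (b : ℕ) where
  open Expectation {A} 1 b

  -- The counterpart of `𝔼-few` for large `b`. The hypothesis holds for an indicator that vanishes
  -- on lists with fewer than `j` elements (`large-≤`): such states have kept at least `j` elements
  -- and lose that many factors `b`.
  𝔼-many : ∀ es f X j → (∀ S → f S * b ^ j ≤ b ^ length S) →
           𝔼 es f X * b ^ j ≤ 2 ^ length es * b ^ (length es + length X)
  𝔼-many [] f X j f≤ = ≤-trans (f≤ X) (≤-reflexive (sym (+-identityʳ _)))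
  𝔼-many (e ∷ es) f X j f≤ = begin
    (𝔼 es f (e ∷ X) + 0 + b * 𝔼 es f X) * b ^ j
      ≡⟨ regroup b (𝔼 es f (e ∷ X)) (𝔼 es f X) (b ^ j) ⟩
    𝔼 es f (e ∷ X) * b ^ j + b * (𝔼 es f X * b ^ j)
      ≤⟨ +-mono-≤ (𝔼-many es f (e ∷ X) j f≤) (*-monoʳ-≤ b (𝔼-many es f X j f≤)) ⟩
    2 ^ length es * b ^ (length es + suc (length X)) + b * (2 ^ length es * b ^ (length es + length X))
      ≡⟨ cong (λ z → 2 ^ length es * b ^ z + b * (2 ^ length es * b ^ (length es + length X)))
              (+-suc (length es) (length X)) ⟩
    2 ^ length es * (b * b ^ (length es + length X)) + b * (2 ^ length es * b ^ (length es + length X))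
      ≡⟨ regroup′ b (2 ^ length es) (b ^ (length es + length X)) ⟩
    2 * 2 ^ length es * (b * b ^ (length es + length X)) ∎
    where
    open ≤-Reasoning
    regroup : ∀ b p q l → (p + 0 + b * q) * l ≡ p * l + b * (q * l)
    regroup = solve-∀
    regroup′ : ∀ b p q → p * (b * q) + b * (p * q) ≡ 2 * p * (b * q)
    regroup′ = solve-∀

-- Edges and short paths

Edge : ℕ → Set
Edge n = Fin n × Fin n

module _ {n : ℕ} where

  infix 6 _─_

  -- The normal form, smaller end first, in which `edges` lists an edge.
  _─_ : Fin n → Fin n → Edge n
  u ─ v with u Fin.<? v
  ... | yes _ = u , v
  ... | no  _ = v , u

  Proper : Edge n → Set
  Proper (u , v) = u Fin.< v

  Simple : List (Edge n) → Set
  Simple L = Unique L × All Proper L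

  ─-proper-≡ : ∀ {u v} → u Fin.< v → u ─ v ≡ (u , v)
  ─-proper-≡ {u} {v} u<v with u Fin.<? v
  ... | yes _ = refl
  ... | no u≮v = contradiction u<v u≮v

  ─-comm : ∀ u v → u ─ v ≡ v ─ u
  ─-comm u v with u Fin.<? v | v Fin.<? u
  ... | yes u<v | yes v<u = ⊥-elim (<-asym u<v v<u)
  ... | yes _   | no _    = refl
  ... | no _    | yes _   = refl
  ... | no u≮v  | no v≮u  with Fin.<-cmp u v
  ... | tri< u<v _ _ = contradiction u<v u≮v
  ... | tri≈ _ u≡v _ = cong₂ _,_ (sym u≡v) u≡v
  ... | tri> _ _ v<u = contradiction v<u v≮u

  ─-either : ∀ u v → u ─ v ≡ (u , v) ⊎ u ─ v ≡ (v , u)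
  ─-either u v with u Fin.<? v
  ... | yes _ = inj₁ refl
  ... | no  _ = inj₂ refl

  ─-injective : ∀ {u v x y} → u ─ v ≡ x ─ y → (u ≡ x × v ≡ y) ⊎ (u ≡ y × v ≡ x)
  ─-injective {u} {v} {x} {y} eq with ─-either u v | ─-either x y
  ... | inj₁ p | inj₁ q with refl ← ≡.trans (sym p) (≡.trans eq q) = inj₁ (refl , refl)
  ... | inj₁ p | inj₂ q with refl ← ≡.trans (sym p) (≡.trans eq q) = inj₂ (refl , refl)
  ... | inj₂ p | inj₁ q with refl ← ≡.trans (sym p) (≡.trans eq q) = inj₂ (refl , refl)
  ... | inj₂ p | inj₂ q with refl ← ≡.trans (sym p) (≡.trans eq q) = inj₁ (refl , refl)

  ─-proper : ∀ {u v} → u ≢ v → Proper (u ─ v)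
  ─-proper {u} {v} u≢v with u Fin.<? v
  ... | yes u<v = u<v
  ... | no u≮v = ≤∧≢⇒< (≮⇒≥ u≮v) (u≢v ∘ Fin.toℕ-injective ∘ sym)

  proper⇒─ : ∀ {e : Edge n} → Proper e → e ≡ proj₁ e ─ proj₂ e
  proper⇒─ p = sym (─-proper-≡ p)

  _≟ᵉ_ : (e f : Edge n) → Dec (e ≡ f)
  _≟ᵉ_ = ≡-dec Fin._≟_ Fin._≟_

  open DecMembership _≟ᵉ_ public using () renaming (_∈?_ to _∈ᵉ?_)

  module _ (G : Graph n) where
    open Graph G

    ∈-edges⁺ : ∀ {e} → Proper e → Bool.T (adj (proj₁ e) (proj₂ e)) → e ∈ edges
    ∈-edges⁺ {u , v} u<v a =
      ∈-filter⁺ (λ (u , v) → (u Fin.<? v) ×-dec T? (adj u v))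
        (∈-cartesianProduct⁺ (∈-allFin u) (∈-allFin v)) (u<v , a)

    ∈-edges⁻ : ∀ {e} → e ∈ edges → Proper e × Bool.T (adj (proj₁ e) (proj₂ e))
    ∈-edges⁻ e∈ = proj₂ (∈-filter⁻ (λ (u , v) → (u Fin.<? v) ×-dec T? (adj u v))
      {xs = cartesianProduct (allFin n) (allFin n)} e∈)

    edges-simple : Simple edges
    edges-simple = Unique.filter⁺ (λ (u , v) → (u Fin.<? v) ×-dec T? (adj u v))
                     (Unique.cartesianProduct⁺ (Unique.allFin⁺ n) (Unique.allFin⁺ n))
                 , All.tabulate (proj₁ ∘ ∈-edges⁻)

  graphOf : List (Edge n) → Graph n
  graphOf L = record
    { adj = adj
    ; symmetric = λ u v → adj-comm u v
    ; irreflexive = irr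
    }
    where
    adj : Fin n → Fin n → Bool
    adj u v = ⌊ ¬? (u Fin.≟ v) ×-dec (u ─ v ∈ᵉ? L) ⌋
    distinct-comm : ∀ u v e → ⌊ ¬? (u Fin.≟ v) ×-dec (e ∈ᵉ? L) ⌋ ≡ ⌊ ¬? (v Fin.≟ u) ×-dec (e ∈ᵉ? L) ⌋
    distinct-comm u v e with u Fin.≟ v | v Fin.≟ u | e ∈ᵉ? L
    ... | yes _ | yes _ | _ = refl
    ... | yes refl | no v≢u | _ = contradiction refl v≢u
    ... | no u≢v | yes refl | _ = contradiction refl u≢v
    ... | no _ | no _ | yes _ = refl
    ... | no _ | no _ | no _ = refl
    adj-comm : ∀ u v → adj u v ≡ adj v u
    adj-comm u v = ≡.trans (cong (λ e → ⌊ ¬? (u Fin.≟ v) ×-dec (e ∈ᵉ? L) ⌋) (─-comm u v))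
                           (distinct-comm u v (v ─ u))
    irr : ∀ v → adj v v ≡ false
    irr v with v Fin.≟ v
    ... | yes _ = refl
    ... | no v≢v = contradiction refl v≢v

  ∈-graphOf⁺ : ∀ {L e} → Proper e → e ∈ L → e ∈ Graph.edges (graphOf L)
  ∈-graphOf⁺ {L} {u , v} p e∈ = ∈-edges⁺ (graphOf L) p
    (fromWitness {a? = ¬? (u Fin.≟ v) ×-dec (u ─ v ∈ᵉ? L)}
      (Fin.<⇒≢ p , subst (_∈ L) (proper⇒─ p) e∈))

  ∈-graphOf⁻ : ∀ {L e} → e ∈ Graph.edges (graphOf L) → e ∈ L
  ∈-graphOf⁻ {L} {u , v} e∈ with ∈-edges⁻ (graphOf L) e∈
  ... | p , a = subst (_∈ L) (sym (proper⇒─ p))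
                  (proj₂ (toWitness {a? = ¬? (u Fin.≟ v) ×-dec (u ─ v ∈ᵉ? L)} a))

  graphOf-edges : ∀ {L} → Simple L → Graph.edges (graphOf L) ↭ L
  graphOf-edges {L} (uniq , proper) = Unique-set⇒↭ uniq (proj₁ (edges-simple (graphOf L)))
    (λ e∈ → ∈-graphOf⁺ (All.lookup proper e∈) e∈) ∈-graphOf⁻

  Joins : List (Edge n) → Rel (Fin n) 0ℓ
  Joins S u v = u ─ v ∈ S

  -- Consecutive vertices of a path differ, so the relations need to be compared at distinct
  -- vertices only. This matters since a list `S` may contain loops, which `graphOf S` discards.
  map-walk : ∀ {R R′ : Rel (Fin n) 0ℓ} → (∀ {u v} → u ≢ v → R u v → R′ u v) →
             ∀ {u w k} → Path R u w k → Path R′ u w k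
  map-walk {R} {R′} R⇒R′ (p , uniq) = proj₁ (go p uniq) , subst Unique (sym (proj₂ (go p uniq))) uniq
    where
    head∈ : ∀ {u w k} (p : Walk R u w k) → u ∈ vertices p
    head∈ nil = here refl
    head∈ (cons _ _) = here refl
    go : ∀ {u w k} (p : Walk R u w k) → Unique (vertices p) →
         ∃[ q ] vertices {_~_ = R′} {u} {w} {k} q ≡ vertices p
    go nil _ = nil , refl
    go (cons r p) (u∉ ∷ uniq) with go p uniq
    ... | q , eq = cons (R⇒R′ (All.lookup u∉ (head∈ p)) r) q , cong (_ ∷_) eq

  -- Accumulates the kept edges in the same order as `𝔼`, so that the two recursions match step by
  -- step in `∑-select`.
  select : (es : List (Edge n)) → Subset (length es) → List (Edge n) → List (Edge n)
  select [] [] X = X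
  select (e ∷ es) (inside ∷ S) X = select es S (e ∷ X)
  select (e ∷ es) (outside ∷ S) X = select es S X

  ∈-select⁺ : ∀ es S {X e} → e ∈ X ⊎ (∃[ i ] (i Subset.∈ S × lookup es i ≡ e)) → e ∈ select es S X
  ∈-select⁺ [] [] (inj₁ e∈) = e∈
  ∈-select⁺ (x ∷ es) (inside ∷ S) (inj₁ e∈) = ∈-select⁺ es S (inj₁ (there e∈))
  ∈-select⁺ (x ∷ es) (outside ∷ S) (inj₁ e∈) = ∈-select⁺ es S (inj₁ e∈)
  ∈-select⁺ (x ∷ es) (_ ∷ S) (inj₂ (Fin.zero , Vec.here , refl)) = ∈-select⁺ es S (inj₁ (here refl))
  ∈-select⁺ (x ∷ es) (inside ∷ S) (inj₂ (Fin.suc i , Vec.there i∈ , eq)) = ∈-select⁺ es S (inj₂ (i , i∈ , eq))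
  ∈-select⁺ (x ∷ es) (outside ∷ S) (inj₂ (Fin.suc i , Vec.there i∈ , eq)) = ∈-select⁺ es S (inj₂ (i , i∈ , eq))

  ∈-select⁻ : ∀ es S {X e} → e ∈ select es S X → e ∈ X ⊎ (∃[ i ] (i Subset.∈ S × lookup es i ≡ e))
  ∈-select⁻ [] [] e∈ = inj₁ e∈
  ∈-select⁻ (x ∷ es) (inside ∷ S) e∈ with ∈-select⁻ es S e∈
  ... | inj₁ (here refl) = inj₂ (Fin.zero , Vec.here , refl)
  ... | inj₁ (there e∈X) = inj₁ e∈X
  ... | inj₂ (i , i∈ , eq) = inj₂ (Fin.suc i , Vec.there i∈ , eq)
  ∈-select⁻ (x ∷ es) (outside ∷ S) e∈ with ∈-select⁻ es S e∈
  ... | inj₁ e∈X = inj₁ e∈X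
  ... | inj₂ (i , i∈ , eq) = inj₂ (Fin.suc i , Vec.there i∈ , eq)

  module _ (G : Graph n) (S : Subset (Graph.size G)) where
    open Graph G

    AdjIn⇒Joins : ∀ {u v} → AdjIn S u v → Joins (select edges S []) u v
    AdjIn⇒Joins {u} {v} (i , i∈ , inj₁ eq) = ∈-select⁺ edges S (inj₂ (i , i∈ ,
      ≡.trans eq (sym (─-proper-≡ (subst Proper eq (proj₁ (∈-edges⁻ G (∈-lookup i))))))))
    AdjIn⇒Joins {u} {v} (i , i∈ , inj₂ eq) = ∈-select⁺ edges S (inj₂ (i , i∈ ,
      ≡.trans eq (≡.trans (sym (─-proper-≡ (subst Proper eq (proj₁ (∈-edges⁻ G (∈-lookup i))))))
                          (─-comm v u))))

    Joins⇒AdjIn : ∀ {u v} → Joins (select edges S []) u v → AdjIn S u v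
    Joins⇒AdjIn {u} {v} j with ∈-select⁻ edges S j
    ... | inj₂ (i , i∈ , eq) with ─-either u v
    ... | inj₁ p = i , i∈ , inj₁ (≡.trans eq p)
    ... | inj₂ p = i , i∈ , inj₂ (≡.trans eq p)

∑ : ∀ {k} → (Subset k → ℕ) → ℕ
∑ {zero} f = f []
∑ {suc k} f = ∑ (f ∘ (inside ∷_)) + ∑ (f ∘ (outside ∷_))

∑-cong : ∀ {k} {f g : Subset k → ℕ} → (∀ S → f S ≡ g S) → ∑ f ≡ ∑ g
∑-cong {zero} eq = eq []
∑-cong {suc k} eq = cong₂ _+_ (∑-cong (eq ∘ (inside ∷_))) (∑-cong (eq ∘ (outside ∷_)))

∑-scale : ∀ {k} c (f : Subset k → ℕ) → ∑ (λ S → c * f S) ≡ c * ∑ f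
∑-scale {zero} c f = refl
∑-scale {suc k} c f = ≡.trans (cong₂ _+_ (∑-scale c (f ∘ (inside ∷_))) (∑-scale c (f ∘ (outside ∷_))))
                              (sym (*-distribˡ-+ c _ _))

module _ {n : ℕ} (a b : ℕ) where
  open Expectation {Edge n} a b

  ∑-select : ∀ es (f : List (Edge n) → ℕ) X →
             ∑ (λ S → f (select es S X) * (a ^ ∣ S ∣ * b ^ ∣ ∁ S ∣)) ≡ 𝔼 es f X
  ∑-select [] f X = *-identityʳ (f X)
  ∑-select (e ∷ es) f X = cong₂ _+_
    (≡.trans (∑-cong {length es} (λ S → pull (f (select es S (e ∷ X))) a (a ^ ∣ S ∣) (b ^ ∣ ∁ S ∣)))
      (≡.trans (∑-scale a (λ S → f (select es S (e ∷ X)) * (a ^ ∣ S ∣ * b ^ ∣ ∁ S ∣)))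
               (cong (a *_) (∑-select es f (e ∷ X)))))
    (≡.trans (∑-cong {length es} (λ S → pull′ (f (select es S X)) b (a ^ ∣ S ∣) (b ^ ∣ ∁ S ∣)))
      (≡.trans (∑-scale b (λ S → f (select es S X) * (a ^ ∣ S ∣ * b ^ ∣ ∁ S ∣)))
               (cong (b *_) (∑-select es f X))))
    where
    pull : ∀ f a x y → f * (a * x * y) ≡ a * (f * (x * y))
    pull = solve-∀
    pull′ : ∀ f b x y → f * (x * (b * y)) ≡ b * (f * (x * y))
    pull′ = solve-∀

-- Working and failing edge lists

module Terminals {n : ℕ} (s t : Fin n) (s≢t : s ≢ t) (d : ℕ) where

  ShortPath : List (Edge n) → Set
  ShortPath S = ∃[ k ] (k ≤ d × Path (Joins S) s t k)

  twoTerminal : List (Edge n) → TwoTerminalGraph n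
  twoTerminal S = record { graph = graphOf S ; s = s ; t = t ; s≢t = s≢t }

  opaque
    -- Decided in `graphOf S` with all its edges retained.
    shortPath? : ∀ S → Dec (ShortPath S)
    shortPath? S = map′
      (λ (k , k≤d , p) → k , k≤d , map-walk (λ _ a → keep a) p)
      (λ (k , k≤d , p) → k , k≤d , map-walk (λ u≢v j → all u≢v j) p)
      (TwoTerminalGraph.isPathset? (twoTerminal S) d Subset.⊤)
      where
      open Graph (graphOf S)
      keep : ∀ {u v} → AdjIn Subset.⊤ u v → Joins S u v
      keep a with ∈-select⁻ edges Subset.⊤ (AdjIn⇒Joins (graphOf S) Subset.⊤ a)
      ... | inj₂ (i , _ , eq) = subst (_∈ S) eq (∈-graphOf⁻ {L = S} (∈-lookup i))
      all : ∀ {u v} → u ≢ v → Joins S u v → AdjIn Subset.⊤ u v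
      all {u} {v} u≢v j = Joins⇒AdjIn (graphOf S) Subset.⊤ (∈-select⁺ edges Subset.⊤
        (inj₂ (index e∈ , Subset.∈⊤ , sym (lookup-index e∈))))
        where
        e∈ : u ─ v ∈ edges
        e∈ = ∈-graphOf⁺ {L = S} (─-proper u≢v) j

  works fails : List (Edge n) → ℕ
  works S = if ⌊ shortPath? S ⌋ then 1 else 0
  fails S = if ⌊ shortPath? S ⌋ then 0 else 1

  works+fails : ∀ S → works S + fails S ≡ 1
  works+fails S with shortPath? S
  ... | yes _ = refl
  ... | no _ = refl

  works-yes : ∀ {S} → ShortPath S → works S ≡ 1
  works-yes {S} p with shortPath? S
  ... | yes _ = refl
  ... | no ¬p = contradiction p ¬p

  works-≤ : ∀ {S c} → (ShortPath S → 1 ≤ c) → works S ≤ c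
  works-≤ {S} le with shortPath? S
  ... | yes p = le p
  ... | no _ = z≤n

  fails-no : ∀ {S} → ¬ ShortPath S → fails S ≡ 1
  fails-no {S} ¬p with shortPath? S
  ... | yes p = contradiction p ¬p
  ... | no _ = refl

  fails-yes : ∀ {S} → ShortPath S → fails S ≡ 0
  fails-yes {S} p with shortPath? S
  ... | yes _ = refl
  ... | no ¬p = contradiction p ¬p

  fails-≤ : ∀ {S c} → (¬ ShortPath S → 1 ≤ c) → fails S ≤ c
  fails-≤ {S} le with shortPath? S
  ... | yes _ = z≤n
  ... | no ¬p = le ¬p

  ShortPath-⊆ : ∀ {S S′} → S ⊆ S′ → ShortPath S → ShortPath S′
  ShortPath-⊆ S⊆ (k , k≤d , p) = k , k≤d , map-walk (λ _ → S⊆) p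

  fails-anti : ∀ {S S′} → S ⊆ S′ → fails S′ ≤ fails S
  fails-anti {S} {S′} S⊆ = fails-≤ λ ¬p → ≤-reflexive (sym (fails-no (¬p ∘ ShortPath-⊆ S⊆)))

  works-mono : ∀ {S S′} → S ⊆ S′ → works S ≤ works S′
  works-mono {S} {S′} S⊆ = works-≤ λ p → ≤-reflexive (sym (works-yes (ShortPath-⊆ S⊆ p)))

  fails-↭ : ∀ {S S′} → S ↭ S′ → fails S ≡ fails S′
  fails-↭ p = ≤-antisym (fails-anti (∈-resp-↭ (↭-sym p))) (fails-anti (∈-resp-↭ p))

  works-↭ : ∀ {S S′} → S ↭ S′ → works S ≡ works S′
  works-↭ p = ≤-antisym (works-mono (∈-resp-↭ p)) (works-mono (∈-resp-↭ (↭-sym p)))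

-- From reliability to weighted counts

module Reliability where

  private
    open ℚ.≤-Reasoning
    open +-*-Solver using (solve; _:+_; _:*_; :-_; _:=_; con)

    cast : ℕ → ℚ
    cast zero = 0ℚ
    cast (suc k) = 1ℚ ℚ.+ cast k

    cast-+ : ∀ k l → cast (k ℕ.+ l) ≡ cast k ℚ.+ cast l
    cast-+ zero l = sym (ℚ.+-identityˡ _)
    cast-+ (suc k) l = ≡.trans (cong (1ℚ ℚ.+_) (cast-+ k l)) (sym (ℚ.+-assoc 1ℚ (cast k) (cast l)))

    cast-* : ∀ k l → cast (k ℕ.* l) ≡ cast k ℚ.* cast l
    cast-* zero l = sym (ℚ.*-zeroˡ (cast l))
    cast-* (suc k) l = begin-equality
      cast (l ℕ.+ k ℕ.* l)                   ≡⟨ cast-+ l (k ℕ.* l) ⟩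
      cast l ℚ.+ cast (k ℕ.* l)              ≡⟨ cong₂ ℚ._+_ (sym (ℚ.*-identityˡ (cast l))) (cast-* k l) ⟩
      1ℚ ℚ.* cast l ℚ.+ cast k ℚ.* cast l    ≡⟨ ℚ.*-distribʳ-+ (cast l) 1ℚ (cast k) ⟨
      (1ℚ ℚ.+ cast k) ℚ.* cast l             ∎

    0≤cast : ∀ k → 0ℚ ℚ.≤ cast k
    0≤cast zero = ℚ.≤-refl
    0≤cast (suc k) = ℚ.+-mono-≤ (ℚ.<⇒≤ (ℚ.positive⁻¹ 1ℚ)) (0≤cast k)

    0<cast : ∀ {k} → 0 ℕ.< k → 0ℚ ℚ.< cast k
    0<cast {suc k} _ = ℚ.+-mono-<-≤ (ℚ.positive⁻¹ 1ℚ) (0≤cast k)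

    cast-< : ∀ {k l} → k ℕ.< l → cast k ℚ.< cast l
    cast-< {k} {l} k<l = subst (λ z → cast k ℚ.< cast z) (ℕ.m+[n∸m]≡n (ℕ.<⇒≤ k<l))
      (subst₂ ℚ._<_ (ℚ.+-identityʳ (cast k)) (sym (cast-+ k (l ℕ.∸ k)))
        (ℚ.+-monoʳ-< (cast k) (0<cast (ℕ.m<n⇒0<n∸m k<l))))

    cast-≤⁻ : ∀ {k l} → cast k ℚ.≤ cast l → k ℕ.≤ l
    cast-≤⁻ {k} {l} le with k ℕ.≤? l
    ... | yes k≤l = k≤l
    ... | no k≰l = contradiction (ℚ.<-≤-trans (cast-< (ℕ.≰⇒> k≰l)) le) (ℚ.<-irrefl refl)

    ≤-approx : ∀ {p q} → (∀ ε → 0ℚ ℚ.< ε → p ℚ.≤ q ℚ.+ ε) → p ℚ.≤ q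
    ≤-approx {p} {q} h with p ℚ.≤? q
    ... | yes p≤q = p≤q
    ... | no p≰q with ℚ.<-dense (ℚ.≰⇒> p≰q)
    ... | r , q<r , r<p = contradiction (ℚ.≤-<-trans (subst (p ℚ.≤_) eq (h (r ℚ.- q) pos)) r<p) (ℚ.<-irrefl refl)
      where
      eq : q ℚ.+ (r ℚ.- q) ≡ r
      eq = solve 2 (λ q r → q :+ (r :+ (:- q)) := r) refl q r
      pos : 0ℚ ℚ.< r ℚ.- q
      pos = subst (ℚ._< r ℚ.- q) (ℚ.+-inverseʳ q) (ℚ.+-monoˡ-< (ℚ.- q) q<r)

    -- Index `0` suffices: at a rational ρ every sequence involved is constant. `E` clears the
    -- denominators.
    seq-∑ : ∀ {k} (E : ℚ) (x : Subset k → ℝ) (y : Subset k → ℕ) →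
            (∀ S → E ℚ.* seq (x S) 0 ≡ cast (y S)) → E ℚ.* seq (∑ᴿ x) 0 ≡ cast (∑ y)
    seq-∑ {zero} E x y eq = eq []
    seq-∑ {suc k} E x y eq = begin-equality
      E ℚ.* (seq (∑ᴿ (x ∘ (inside ∷_))) 0 ℚ.+ seq (∑ᴿ (x ∘ (outside ∷_))) 0)
        ≡⟨ ℚ.*-distribˡ-+ E _ _ ⟩
      E ℚ.* seq (∑ᴿ (x ∘ (inside ∷_))) 0 ℚ.+ E ℚ.* seq (∑ᴿ (x ∘ (outside ∷_))) 0
        ≡⟨ cong₂ ℚ._+_ (seq-∑ E _ _ (eq ∘ (inside ∷_))) (seq-∑ E _ _ (eq ∘ (outside ∷_))) ⟩
      cast (∑ (y ∘ (inside ∷_))) ℚ.+ cast (∑ (y ∘ (outside ∷_)))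
        ≡⟨ cast-+ (∑ (y ∘ (inside ∷_))) _ ⟨
      cast (∑ y) ∎

    seq-^ : ∀ x K c l → cast K ℚ.* seq x 0 ≡ cast c → cast (K ℕ.^ l) ℚ.* seq (x ^ᴿ l) 0 ≡ cast (c ℕ.^ l)
    seq-^ x K c zero eq = refl
    seq-^ x K c (suc l) eq = begin-equality
      cast (K ℕ.* K ℕ.^ l) ℚ.* (seq x 0 ℚ.* seq (x ^ᴿ l) 0)
        ≡⟨ cong (ℚ._* (seq x 0 ℚ.* seq (x ^ᴿ l) 0)) (cast-* K (K ℕ.^ l)) ⟩
      (cast K ℚ.* cast (K ℕ.^ l)) ℚ.* (seq x 0 ℚ.* seq (x ^ᴿ l) 0)
        ≡⟨ solve 4 (λ k l x y → (k :* l) :* (x :* y) := (k :* x) :* (l :* y)) refl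
             (cast K) (cast (K ℕ.^ l)) (seq x 0) (seq (x ^ᴿ l) 0) ⟩
      (cast K ℚ.* seq x 0) ℚ.* (cast (K ℕ.^ l) ℚ.* seq (x ^ᴿ l) 0)
        ≡⟨ cong₂ ℚ._*_ eq (seq-^ x K c l eq) ⟩
      cast c ℚ.* cast (c ℕ.^ l)
        ≡⟨ cast-* c (c ℕ.^ l) ⟨
      cast (c ℕ.^ suc l) ∎

  ∣S∣+∣∁S∣ : ∀ {k} (S : Subset k) → ∣ S ∣ ℕ.+ ∣ ∁ S ∣ ≡ k
  ∣S∣+∣∁S∣ [] = refl
  ∣S∣+∣∁S∣ (inside ∷ S) = cong suc (∣S∣+∣∁S∣ S)
  ∣S∣+∣∁S∣ (outside ∷ S) = ≡.trans (ℕ.+-suc ∣ S ∣ ∣ ∁ S ∣) (cong suc (∣S∣+∣∁S∣ S))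

  private
    module _ (ρ : ℝ) (a b : ℕ) (1-ρ≡ : cast (a ℕ.+ b) ℚ.* seq (1ᴿ -ᴿ ρ) 0 ≡ cast a)
             (ρ≡ : cast (a ℕ.+ b) ℚ.* seq ρ 0 ≡ cast b) where

      private
        K = a ℕ.+ b

      weight : ∀ {k} → Subset k → ℕ
      weight S = a ℕ.^ ∣ S ∣ ℕ.* b ℕ.^ ∣ ∁ S ∣

      seq-weight : ∀ {k} (S : Subset k) →
                   cast (K ℕ.^ k) ℚ.* seq ((1ᴿ -ᴿ ρ) ^ᴿ ∣ S ∣ *ᴿ ρ ^ᴿ ∣ ∁ S ∣) 0 ≡ cast (weight S)
      seq-weight {k} S = begin-equality
        cast (K ℕ.^ k) ℚ.* (x ℚ.* y)
          ≡⟨ cong (λ z → cast (K ℕ.^ z) ℚ.* (x ℚ.* y)) (∣S∣+∣∁S∣ S) ⟨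
        cast (K ℕ.^ (∣ S ∣ ℕ.+ ∣ ∁ S ∣)) ℚ.* (x ℚ.* y)
          ≡⟨ cong (λ z → cast z ℚ.* (x ℚ.* y)) (ℕ.^-distribˡ-+-* K ∣ S ∣ ∣ ∁ S ∣) ⟩
        cast (K ℕ.^ ∣ S ∣ ℕ.* K ℕ.^ ∣ ∁ S ∣) ℚ.* (x ℚ.* y)
          ≡⟨ cong (ℚ._* (x ℚ.* y)) (cast-* (K ℕ.^ ∣ S ∣) _) ⟩
        (cast (K ℕ.^ ∣ S ∣) ℚ.* cast (K ℕ.^ ∣ ∁ S ∣)) ℚ.* (x ℚ.* y)
          ≡⟨ solve 4 (λ k l x y → (k :* l) :* (x :* y) := (k :* x) :* (l :* y)) refl
               (cast (K ℕ.^ ∣ S ∣)) (cast (K ℕ.^ ∣ ∁ S ∣)) x y ⟩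
        (cast (K ℕ.^ ∣ S ∣) ℚ.* x) ℚ.* (cast (K ℕ.^ ∣ ∁ S ∣) ℚ.* y)
          ≡⟨ cong₂ ℚ._*_ (seq-^ (1ᴿ -ᴿ ρ) K a ∣ S ∣ 1-ρ≡) (seq-^ ρ K b ∣ ∁ S ∣ ρ≡) ⟩
        cast (a ℕ.^ ∣ S ∣) ℚ.* cast (b ℕ.^ ∣ ∁ S ∣)
          ≡⟨ cast-* (a ℕ.^ ∣ S ∣) _ ⟨
        cast (weight S) ∎
        where
        x = seq ((1ᴿ -ᴿ ρ) ^ᴿ ∣ S ∣) 0
        y = seq (ρ ^ᴿ ∣ ∁ S ∣) 0

      seq-∑-if : ∀ {k} {P : Subset k → Set} (P? : ∀ S → Dec (P S)) →
        cast (K ℕ.^ k) ℚ.* seq (∑ᴿ λ S → if ⌊ P? S ⌋ then (1ᴿ -ᴿ ρ) ^ᴿ ∣ S ∣ *ᴿ ρ ^ᴿ ∣ ∁ S ∣ else 0ᴿ) 0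
        ≡ cast (∑ λ S → (if ⌊ P? S ⌋ then 1 else 0) ℕ.* weight S)
      seq-∑-if {k} P? = seq-∑ (cast (K ℕ.^ k)) _ _ λ S → by S (P? S)
        where
        by : ∀ S {P : Set} (p : Dec P) →
             cast (K ℕ.^ k) ℚ.* seq (if ⌊ p ⌋ then (1ᴿ -ᴿ ρ) ^ᴿ ∣ S ∣ *ᴿ ρ ^ᴿ ∣ ∁ S ∣ else 0ᴿ) 0
           ≡ cast ((if ⌊ p ⌋ then 1 else 0) ℕ.* weight S)
        by S (yes _) = ≡.trans (seq-weight S) (cong cast (sym (ℕ.*-identityˡ (weight S))))
        by S (no _) = ℚ.*-zeroʳ (cast (K ℕ.^ k))

      module _ {n : ℕ} (G : TwoTerminalGraph n) (d : ℕ) where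
        private
          module G = TwoTerminalGraph G
        open Terminals G.s G.t G.s≢t d
        open Expectation {Edge n} a b

        isPathset?-works : ∀ S → (if ⌊ TwoTerminalGraph.isPathset? G d S ⌋ then 1 else 0) ≡ works (select G.edges S [])
        isPathset?-works S with TwoTerminalGraph.isPathset? G d S
        ... | yes (k , k≤d , p) = sym (works-yes (k , k≤d , map-walk (λ _ → AdjIn⇒Joins G.graph S) p))
        ... | no ¬p = sym (ℕ.n≤0⇒n≡0 (works-≤ λ (k , k≤d , p) →
                        contradiction (k , k≤d , map-walk (λ _ → Joins⇒AdjIn G.graph S) p) ¬p))

        reliability-𝔼 : cast (K ℕ.^ TwoTerminalGraph.size G) ℚ.* seq (TwoTerminalGraph.reliability G d ρ) 0
                      ≡ cast (𝔼 G.edges works [])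
        reliability-𝔼 = ≡.trans (seq-∑-if (TwoTerminalGraph.isPathset? G d))
          (cong cast (≡.trans (∑-cong {TwoTerminalGraph.size G} (λ S → cong (ℕ._* weight S) (isPathset?-works S)))
                              (∑-select a b G.edges works [])))

  -- Uniform optimality of an edge list among the simple ones of its length,
  -- for all rational ρ = b / (a + b) and with denominators cleared.
  Optimal : ∀ {n} (s t : Fin n) → s ≢ t → ℕ → List (Edge n) → Set
  Optimal s t s≢t d es = ∀ L → Simple L → length L ≡ length es → ∀ a b → 0 ℕ.< a ℕ.+ b →
    𝔼 a b L (works d) [] ℕ.≤ 𝔼 a b es (works d) []
    where
    open Expectation
    open Terminals s t s≢t

  -- Up to order, a simple list of the right length is the edge list of a competitor with the same
  -- terminals. At `ρ = b / (a + b)` the factor `(a + b) ^ size` turns its reliability into `𝔼`.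
  UMRTTG⇒Optimal : ∀ {n m} d (G : TTG n m) → IsUMRTTG d G →
    let open TwoTerminalGraph (proj₁ G) in Optimal s t s≢t d edges
  UMRTTG⇒Optimal {n} {m} d (G , refl) umr L simple len a b 0<κ =
    cast-≤⁻ (subst₂ ℚ._≤_ H≡ G≡ (ℚ.*-monoˡ-≤-nonNeg (cast (κ ℕ.^ size)) {{ℚ.nonNegative (0≤cast (κ ℕ.^ size))}} le))
    where
    open TwoTerminalGraph G
    open Terminals s t s≢t d
    open Expectation {Edge n} a b
    κ = a ℕ.+ b
    H = twoTerminal L
    edges↭ = graphOf-edges simple
    instance
      κ>0 : ℚ.Positive (cast κ)
      κ>0 = ℚ.positive (0<cast 0<κ)
      κ≢0 : ℚ.NonZero (cast κ)
      κ≢0 = ℚ.pos⇒nonZero (cast κ)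
    1/κ = ℚ.1/ cast κ
    q = cast b ℚ.* 1/κ
    p = cast a ℚ.* 1/κ
    ρ = fromℚ q
    cancel : ∀ c → cast κ ℚ.* (cast c ℚ.* 1/κ) ≡ cast c
    cancel c = begin-equality
      cast κ ℚ.* (cast c ℚ.* 1/κ)
        ≡⟨ solve 3 (λ k c i → k :* (c :* i) := c :* (k :* i)) refl (cast κ) (cast c) 1/κ ⟩
      cast c ℚ.* (cast κ ℚ.* 1/κ) ≡⟨ cong (cast c ℚ.*_) (ℚ.*-inverseʳ (cast κ)) ⟩
      cast c ℚ.* 1ℚ ≡⟨ ℚ.*-identityʳ (cast c) ⟩
      cast c ∎
    p+q≡1 : p ℚ.+ q ≡ 1ℚ
    p+q≡1 = begin-equality
      cast a ℚ.* 1/κ ℚ.+ cast b ℚ.* 1/κ ≡⟨ ℚ.*-distribʳ-+ 1/κ (cast a) (cast b) ⟨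
      (cast a ℚ.+ cast b) ℚ.* 1/κ       ≡⟨ cong (ℚ._* 1/κ) (cast-+ a b) ⟨
      cast κ ℚ.* 1/κ                    ≡⟨ ℚ.*-inverseʳ (cast κ) ⟩
      1ℚ ∎
    0≤1/κ : 0ℚ ℚ.≤ 1/κ
    0≤1/κ = ℚ.<⇒≤ (ℚ.positive⁻¹ 1/κ {{ℚ.1/pos⇒pos (cast κ)}})
    0≤ : ∀ c → 0ℚ ℚ.≤ cast c ℚ.* 1/κ
    0≤ c = subst (ℚ._≤ cast c ℚ.* 1/κ) (ℚ.*-zeroˡ 1/κ)
      (ℚ.*-monoʳ-≤-nonNeg 1/κ {{ℚ.nonNegative 0≤1/κ}} (0≤cast c))
    q≤1 : q ℚ.≤ 1ℚ
    q≤1 = subst₂ ℚ._≤_ (ℚ.+-identityˡ q) p+q≡1 (ℚ.+-monoˡ-≤ q (0≤ a))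
    1-q : 1ℚ ℚ.- q ≡ p
    1-q = ≡.trans (cong (ℚ._- q) (sym p+q≡1)) (solve 2 (λ p q → (p :+ q) :+ (:- q) := p) refl p q)
    0≤ρ : 0ᴿ ≤ᴿ ρ
    0≤ρ ε 0<ε = 0 , λ _ _ → ℚ.≤-trans (0≤ b) (subst (ℚ._≤ q ℚ.+ ε) (ℚ.+-identityʳ q) (ℚ.+-monoʳ-≤ q (ℚ.<⇒≤ 0<ε)))
    ρ≤1 : ρ ≤ᴿ 1ᴿ
    ρ≤1 ε 0<ε = 0 , λ _ _ → ℚ.≤-trans q≤1 (subst (ℚ._≤ 1ℚ ℚ.+ ε) (ℚ.+-identityʳ 1ℚ) (ℚ.+-monoʳ-≤ 1ℚ (ℚ.<⇒≤ 0<ε)))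
    sizeH : TwoTerminalGraph.size H ≡ size
    sizeH = ≡.trans (↭-length edges↭) len
    constant : ∀ (G : TwoTerminalGraph n) i → seq (TwoTerminalGraph.reliability G d ρ) i
                                            ≡ seq (TwoTerminalGraph.reliability G d ρ) 0
    constant G i = ∑-constant (λ S → TwoTerminalGraph.isPathset? G d S)
      where
      ^-constant : ∀ {x} k → (∀ i → seq x i ≡ seq x 0) → seq (x ^ᴿ k) i ≡ seq (x ^ᴿ k) 0
      ^-constant zero _ = refl
      ^-constant (suc k) h = cong₂ ℚ._*_ (h i) (^-constant k h)
      ∑-seq : ∀ {k} (f : Subset k → ℝ) → (∀ S → seq (f S) i ≡ seq (f S) 0) → seq (∑ᴿ f) i ≡ seq (∑ᴿ f) 0
      ∑-seq {zero} f h = h []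
      ∑-seq {suc k} f h = cong₂ ℚ._+_ (∑-seq (f ∘ (inside ∷_)) (h ∘ (inside ∷_)))
                                      (∑-seq (f ∘ (outside ∷_)) (h ∘ (outside ∷_)))
      ∑-constant : ∀ {k} {P : Subset k → Set} (P? : ∀ S → Dec (P S)) →
        let f = λ S → if ⌊ P? S ⌋ then (1ᴿ -ᴿ ρ) ^ᴿ ∣ S ∣ *ᴿ ρ ^ᴿ ∣ ∁ S ∣ else 0ᴿ in
        seq (∑ᴿ f) i ≡ seq (∑ᴿ f) 0
      ∑-constant P? = ∑-seq _ λ S → by S (P? S)
        where
        by : ∀ S {P : Set} (p : Dec P) → seq (if ⌊ p ⌋ then (1ᴿ -ᴿ ρ) ^ᴿ ∣ S ∣ *ᴿ ρ ^ᴿ ∣ ∁ S ∣ else 0ᴿ) i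
                                 ≡ seq (if ⌊ p ⌋ then (1ᴿ -ᴿ ρ) ^ᴿ ∣ S ∣ *ᴿ ρ ^ᴿ ∣ ∁ S ∣ else 0ᴿ) 0
        by S (yes _) = cong₂ ℚ._*_ (^-constant ∣ S ∣ (λ _ → refl)) (^-constant ∣ ∁ S ∣ (λ _ → refl))
        by S (no _) = refl
    -- The index supplied by `umr` depends on ε, but both reliabilities are constant sequences, so
    -- all these inequalities concern index `0` and ε can be removed.
    le : seq (TwoTerminalGraph.reliability H d ρ) 0 ℚ.≤ seq (reliability d ρ) 0
    le = ≤-approx λ ε 0<ε → let (N , h) = umr (H , sizeH) ρ 0≤ρ ρ≤1 ε 0<ε in
      subst₂ (λ x y → x ℚ.≤ y ℚ.+ ε) (constant H N) (constant G N) (h N ℕ.≤-refl)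
    1-ρ≡ : cast κ ℚ.* seq (1ᴿ -ᴿ ρ) 0 ≡ cast a
    1-ρ≡ = ≡.trans (cong (cast κ ℚ.*_) 1-q) (cancel a)
    G≡ : cast (κ ℕ.^ size) ℚ.* seq (reliability d ρ) 0 ≡ cast (𝔼 edges works [])
    G≡ = reliability-𝔼 ρ a b 1-ρ≡ (cancel b) G d
    H≡ : cast (κ ℕ.^ size) ℚ.* seq (TwoTerminalGraph.reliability H d ρ) 0 ≡ cast (𝔼 L works [])
    H≡ = ≡.trans (cong (λ z → cast (κ ℕ.^ z) ℚ.* seq (TwoTerminalGraph.reliability H d ρ) 0) (sym sizeH))
           (≡.trans (reliability-𝔼 ρ a b 1-ρ≡ (cancel b) H d) (cong cast (𝔼-↭ works works-↭ edges↭ [])))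

open Reliability using (Optimal; UMRTTG⇒Optimal)

-- Two-terminal edge lists

pairs : ∀ n → List (Edge n)
pairs zero = []
pairs (suc n) = map (λ i → Fin.zero , Fin.suc i) (allFin n)
             ++ map (λ (u , v) → Fin.suc u , Fin.suc v) (pairs n)

length-pairs : ∀ n → length (pairs n) ≡ n C 2
length-pairs zero = refl
length-pairs (suc n) = begin-equality
  length (pairs (suc n))
    ≡⟨ length-++ (map (λ i → Fin.zero , Fin.suc i) (allFin n)) ⟩
  length (map (λ i → Fin.zero {n} , Fin.suc i) (allFin n)) + length (map _ (pairs n))
    ≡⟨ cong₂ _+_ (≡.trans (length-map _ (allFin n)) (length-tabulate {n = n} id)) (length-map _ (pairs n)) ⟩
  n + length (pairs n)
    ≡⟨ cong₂ _+_ (sym (nC1≡n n)) (length-pairs n) ⟩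
  n C 1 + n C 2
    ≡⟨ nCk+nC[k+1]≡[n+1]C[k+1] n 1 ⟩
  suc n C 2 ∎
  where open ≤-Reasoning

pairs-unique : ∀ n → Unique (pairs n)
pairs-unique zero = []
pairs-unique (suc n) = Unique.++⁺
  (Unique.map⁺ (λ { refl → refl }) (Unique.allFin⁺ n))
  (Unique.map⁺ (λ { refl → refl }) (pairs-unique n))
  λ (p , q) → case (∈-map⁻ _ p) (∈-map⁻ _ q)
  where
  case : ∀ {e} → (∃[ i ] (i ∈ allFin n × e ≡ (Fin.zero , Fin.suc i))) →
         (∃[ f ] (f ∈ pairs n × e ≡ (Fin.suc (proj₁ f) , Fin.suc (proj₂ f)))) → ⊥
  case (_ , _ , refl) (_ , _ , ())

∈-pairs : ∀ {n} {e : Edge n} → Proper e → e ∈ pairs n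
∈-pairs {suc n} {Fin.zero , Fin.suc v} _ = ∈-++⁺ˡ (∈-map⁺ _ (∈-allFin v))
∈-pairs {suc n} {Fin.suc u , Fin.suc v} (s≤s u<v) =
  ∈-++⁺ʳ (map (λ i → Fin.zero , Fin.suc i) (allFin n)) (∈-map⁺ _ (∈-pairs u<v))

pairs-proper : ∀ n → All Proper (pairs n)
pairs-proper zero = []
pairs-proper (suc n) = All.++⁺ (All.map⁺ (All.universal (λ _ → z<s) (allFin n)))
                               (All.map⁺ (All.map s≤s (pairs-proper n)))

Simple-resp-↭ : ∀ {n} {L L′ : List (Edge n)} → L ↭ L′ → Simple L → Simple L′
Simple-resp-↭ p (uniq , proper) = Unique-resp-↭ p uniq , All-resp-↭ p proper

Simple-length : ∀ {n} {L : List (Edge n)} → Simple L → length L ≤ n C 2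
Simple-length {n} (uniq , proper) = ≤-trans
  (Unique-⊆-length uniq (λ e∈ → ∈-pairs (All.lookup proper e∈)))
  (≤-reflexive (length-pairs n))

-- A competitor is designed through its essential edges; arbitrary further pairs bring it to the
-- required number of edges.
extend : ∀ {n m} {L : List (Edge n)} → Simple L → length L ≤ m → m ≤ n C 2 →
         ∃[ R ] (Simple (L ++ R) × length (L ++ R) ≡ m)
extend {n} {m} {L} (uniq , proper) L≤m m≤ with ⊆⇒↭ uniq (λ e∈ → ∈-pairs (All.lookup proper e∈))
... | Z , pairs↭ = take (m ∸ length L) Z , prefix-simple , len
  where
  all : Simple (L ++ Z)
  all = Simple-resp-↭ pairs↭ (pairs-unique n , pairs-proper n)
  r = m ∸ length L
  all≡ : L ++ Z ≡ (L ++ take r Z) ++ Data.List.Base.drop r Z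
  all≡ = ≡.trans (cong (L ++_) (sym (take++drop≡id r Z))) (sym (++-assoc L (take r Z) _))
  prefix-simple : Simple (L ++ take r Z)
  prefix-simple = Unique-++⁻ˡ (L ++ take r Z) (subst Unique all≡ (proj₁ all))
                , All.++⁻ˡ (L ++ take r Z) (subst (All Proper) all≡ (proj₂ all))
  r≤ : r ≤ length Z
  r≤ = m≤n+o⇒m∸n≤o m (length L) (≤-trans m≤ (≤-reflexive
    (≡.trans (sym (length-pairs n)) (≡.trans (↭-length pairs↭) (length-++ L)))))
  len : length (L ++ take r Z) ≡ m
  len = begin-equality
    length (L ++ take r Z)      ≡⟨ length-++ L ⟩
    length L + length (take r Z) ≡⟨ cong (length L +_) (≡.trans (length-take r Z) (m≤n⇒m⊓n≡m r≤)) ⟩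
    length L + (m ∸ length L)   ≡⟨ m+[n∸m]≡n L≤m ⟩
    m ∎
    where open ≤-Reasoning

module _ {n : ℕ} where

  ─-ends : ∀ {P : Fin n → Set} {u v} → P u → P v → P (proj₁ (u ─ v)) × P (proj₂ (u ─ v))
  ─-ends {P} {u} {v} pu pv with ─-either u v
  ... | inj₁ eq = subst (λ e → P (proj₁ e) × P (proj₂ e)) (sym eq) (pu , pv)
  ... | inj₂ eq = subst (λ e → P (proj₁ e) × P (proj₂ e)) (sym eq) (pv , pu)

  ─-ends⁻ : ∀ {P : Fin n → Set} u v → P (proj₁ (u ─ v)) → P (proj₂ (u ─ v)) → P u × P v
  ─-ends⁻ {P} u v p q with u Fin.<? v
  ... | yes _ = p , q
  ... | no _ = q , p

  walkEdges : ∀ {R : Rel (Fin n) 0ℓ} {u w k} → Walk R u w k → List (Edge n)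
  walkEdges nil = []
  walkEdges (cons {u = u} {v = v} _ p) = u ─ v ∷ walkEdges p

  private
    head∈ : ∀ {R : Rel (Fin n) 0ℓ} {u w k} (p : Walk R u w k) → u ∈ vertices p
    head∈ nil = here refl
    head∈ (cons _ _) = here refl

    ends∈ : ∀ {R : Rel (Fin n) 0ℓ} {u w k} (p : Walk R u w k) {e} → e ∈ walkEdges p →
            proj₁ e ∈ vertices p × proj₂ e ∈ vertices p
    ends∈ (cons {u = u} _ p) (here refl) = ─-ends {_∈ u ∷ vertices p} (here refl) (there (head∈ p))
    ends∈ (cons _ p) (there e∈) = there (proj₁ (ends∈ p e∈)) , there (proj₂ (ends∈ p e∈))

    walkEdges-unique : ∀ {R : Rel (Fin n) 0ℓ} {u w k} (p : Walk R u w k) →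
                       Unique (vertices p) → Unique (walkEdges p)
    walkEdges-unique nil _ = []
    walkEdges-unique (cons {u = u} {v = v} _ p) (u∉ ∷ uniq) =
      ¬Any⇒All¬ _ (λ e∈ → All¬⇒¬Any u∉
        (proj₁ (─-ends⁻ {_∈ vertices p} u v (proj₁ (ends∈ p e∈)) (proj₂ (ends∈ p e∈)))))
      ∷ walkEdges-unique p uniq

    walkEdges-⊆ : ∀ {S u w k} (p : Walk (Joins S) u w k) → walkEdges p ⊆ S
    walkEdges-⊆ (cons j p) (here refl) = j
    walkEdges-⊆ (cons j p) (there e∈) = walkEdges-⊆ p e∈

    walkEdges-length : ∀ {R : Rel (Fin n) 0ℓ} {u w k} (p : Walk R u w k) → length (walkEdges p) ≡ k
    walkEdges-length nil = refl
    walkEdges-length (cons _ p) = cong suc (walkEdges-length p)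

  -- The edges of a path are distinct members of `S`.
  path-length : ∀ {S u w k} → Path (Joins S) u w k → k ≤ length S
  path-length (p , uniq) = subst (_≤ _) (walkEdges-length p)
    (Unique-⊆-length (walkEdges-unique p uniq) (walkEdges-⊆ p))

-- Edges between the terminals and their common neighbours

module Spokes {n : ℕ} (s t : Fin n) (s≢t : s ≢ t) where

  Inner : Fin n → Set
  Inner u = s ≢ u × t ≢ u

  inner? : ∀ u → Dec (Inner u)
  inner? u = ¬? (s Fin.≟ u) ×-dec ¬? (t Fin.≟ u)

  InnerEdge : Edge n → Set
  InnerEdge (u , v) = Inner u × Inner v

  inners : List (Fin n)
  inners = filter inner? (allFin n)

  ∈-inners⁺ : ∀ {u} → Inner u → u ∈ inners
  ∈-inners⁺ i = ∈-filter⁺ inner? (∈-allFin _) i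

  ∈-inners⁻ : ∀ {u} → u ∈ inners → Inner u
  ∈-inners⁻ u∈ = proj₂ (∈-filter⁻ inner? {xs = allFin n} u∈)

  inners-unique : Unique inners
  inners-unique = Unique.filter⁺ inner? (Unique.allFin⁺ n)

  length-inners : 2 + length inners ≡ n
  length-inners = ≡.trans (↭-length (↭-sym all↭)) (length-tabulate {n = n} id)
    where
    all↭ : allFin n ↭ s ∷ t ∷ inners
    all↭ = Unique-set⇒↭
      ((s≢t ∷ All.tabulate (proj₁ ∘ ∈-inners⁻)) ∷ All.tabulate (proj₂ ∘ ∈-inners⁻) ∷ inners-unique)
      (Unique.allFin⁺ n) (λ _ → ∈-allFin _) sub
      where
      sub : allFin n ⊆ s ∷ t ∷ inners
      sub {u} _ with s Fin.≟ u | t Fin.≟ u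
      ... | yes refl | _ = here refl
      ... | no _ | yes refl = there (here refl)
      ... | no s≢u | no t≢u = there (there (∈-inners⁺ (s≢u , t≢u)))

  spokes : List (Fin n) → List (Edge n)
  spokes [] = []
  spokes (u ∷ us) = s ─ u ∷ u ─ t ∷ spokes us

  core : List (Fin n) → List (Edge n)
  core us = spokes us ++ [ s ─ t ]

  length-spokes : ∀ us → length (spokes us) ≡ 2 * length us
  length-spokes [] = refl
  length-spokes (u ∷ us) = ≡.trans (cong (2 +_) (length-spokes us)) (sym (*-suc 2 (length us)))

  length-core : ∀ us → length (core us) ≡ 1 + 2 * length us
  length-core us = ≡.trans (length-++ (spokes us))
    (≡.trans (+-comm (length (spokes us)) 1) (cong suc (length-spokes us)))

  spokes-++ : ∀ us vs → spokes (us ++ vs) ≡ spokes us ++ spokes vs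
  spokes-++ [] vs = refl
  spokes-++ (u ∷ us) vs = cong (λ z → s ─ u ∷ u ─ t ∷ z) (spokes-++ us vs)

  spokes-↭ : ∀ {us vs} → us ↭ vs → spokes us ↭ spokes vs
  spokes-↭ refl = refl
  spokes-↭ (prep u p) = prep _ (prep _ (spokes-↭ p))
  spokes-↭ {u ∷ v ∷ us} {_ ∷ _ ∷ vs} (swap _ _ p) =
    ↭-trans (shifts (s ─ u ∷ u ─ t ∷ []) (s ─ v ∷ v ─ t ∷ []))
            (prep _ (prep _ (prep _ (prep _ (spokes-↭ p)))))
  spokes-↭ (trans p q) = trans (spokes-↭ p) (spokes-↭ q)

  core-↭ : ∀ {us vs} → us ↭ vs → core us ↭ core vs
  core-↭ p = ++⁺ʳ _ (spokes-↭ p)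

  ∈-spokes⁺ˢ : ∀ {u us} → u ∈ us → s ─ u ∈ spokes us
  ∈-spokes⁺ˢ (here refl) = here refl
  ∈-spokes⁺ˢ (there u∈) = there (there (∈-spokes⁺ˢ u∈))

  ∈-spokes⁺ᵗ : ∀ {u us} → u ∈ us → u ─ t ∈ spokes us
  ∈-spokes⁺ᵗ (here refl) = there (here refl)
  ∈-spokes⁺ᵗ (there u∈) = there (there (∈-spokes⁺ᵗ u∈))

  ∈-spokes⁻ : ∀ {e us} → e ∈ spokes us → ∃[ u ] (u ∈ us × (e ≡ s ─ u ⊎ e ≡ u ─ t))
  ∈-spokes⁻ {us = u ∷ us} (here refl) = u , here refl , inj₁ refl
  ∈-spokes⁻ {us = u ∷ us} (there (here refl)) = u , here refl , inj₂ refl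
  ∈-spokes⁻ {us = u ∷ us} (there (there e∈)) with ∈-spokes⁻ e∈
  ... | v , v∈ , eq = v , there v∈ , eq

  inner-edge : ∀ {u v} → Inner u → Inner v → InnerEdge (u ─ v)
  inner-edge = ─-ends {P = Inner}

  inner-edge⁻ : ∀ u v → InnerEdge (u ─ v) → Inner u × Inner v
  inner-edge⁻ u v (p , q) = ─-ends⁻ {P = Inner} u v p q

  s─-outer : ∀ u → ¬ InnerEdge (s ─ u)
  s─-outer u i = proj₁ (proj₁ (inner-edge⁻ s u i)) refl

  ─t-outer : ∀ u → ¬ InnerEdge (u ─ t)
  ─t-outer u i = proj₂ (proj₂ (inner-edge⁻ u t i)) refl

  core-outer : ∀ {e us} → e ∈ core us → ¬ InnerEdge e
  core-outer {us = us} e∈ with ∈-++⁻ (spokes us) e∈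
  ... | inj₂ (here refl) = s─-outer t
  ... | inj₁ e∈′ with ∈-spokes⁻ e∈′
  ... | u , _ , inj₁ refl = s─-outer u
  ... | u , _ , inj₂ refl = ─t-outer u

  s─u≢v─t : ∀ {u v} → Inner u → s ─ u ≢ v ─ t
  s─u≢v─t (s≢u , t≢u) eq with ─-injective eq
  ... | inj₁ (_ , u≡t) = t≢u (sym u≡t)
  ... | inj₂ (s≡t , _) = s≢t s≡t

  s─-injective : ∀ {u v} → Inner u → s ─ u ≡ s ─ v → u ≡ v
  s─-injective (s≢u , _) eq with ─-injective eq
  ... | inj₁ (_ , u≡v) = u≡v
  ... | inj₂ (_ , u≡s) = contradiction (sym u≡s) s≢u

  ─t-injective : ∀ {u v} → Inner u → u ─ t ≡ v ─ t → u ≡ v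
  ─t-injective (_ , t≢u) eq with ─-injective eq
  ... | inj₁ (u≡v , _) = u≡v
  ... | inj₂ (u≡t , _) = contradiction (sym u≡t) t≢u

  spokes-unique : ∀ {us} → Unique us → All Inner us → Unique (spokes us)
  spokes-unique [] [] = []
  spokes-unique {u ∷ us} (u∉ ∷ uniq) (iu ∷ is) =
    (s─u≢v─t iu ∷ All.tabulate s─u∉) ∷ All.tabulate u─t∉ ∷ spokes-unique uniq is
    where
    s─u∉ : ∀ {e} → e ∈ spokes us → s ─ u ≢ e
    s─u∉ e∈ eq with ∈-spokes⁻ e∈
    ... | v , v∈ , inj₁ refl = All.lookup u∉ v∈ (s─-injective iu eq)
    ... | v , v∈ , inj₂ refl = s─u≢v─t iu eq
    u─t∉ : ∀ {e} → e ∈ spokes us → u ─ t ≢ e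
    u─t∉ e∈ eq with ∈-spokes⁻ e∈
    ... | v , v∈ , inj₁ refl = s─u≢v─t (All.lookup is v∈) (sym eq)
    ... | v , v∈ , inj₂ refl = All.lookup u∉ v∈ (─t-injective iu eq)

  core-simple : ∀ {us} → Unique us → All Inner us → Simple (core us)
  core-simple {us} uniq is = Unique.++⁺ (spokes-unique uniq is) ([] ∷ []) disj
                          , All.++⁺ (All.tabulate proper) (─-proper s≢t ∷ [])
    where
    disj : ∀ {e} → (e ∈ spokes us) × (e ∈ [ s ─ t ]) → ⊥
    disj (e∈ , here refl) with ∈-spokes⁻ e∈
    ... | v , v∈ , inj₁ eq = s─u≢v─t (All.lookup is v∈) (sym eq)
    ... | v , v∈ , inj₂ eq with ─-injective eq
    ... | inj₁ (s≡v , _) = proj₁ (All.lookup is v∈) s≡v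
    ... | inj₂ (s≡t , _) = s≢t s≡t
    proper : ∀ {e} → e ∈ spokes us → Proper e
    proper e∈ with ∈-spokes⁻ e∈
    ... | v , v∈ , inj₁ refl = ─-proper (proj₁ (All.lookup is v∈))
    ... | v , v∈ , inj₂ refl = ─-proper (proj₂ (All.lookup is v∈) ∘ sym)

  ++-core-simple : ∀ {F us} → Simple F → All InnerEdge F → Unique us → All Inner us → Simple (F ++ core us)
  ++-core-simple {F} {us} (uF , pF) iF uC iC =
      Unique.++⁺ uF (proj₁ (core-simple uC iC)) (λ (e∈F , e∈c) → core-outer {us = us} e∈c (All.lookup iF e∈F))
    , All.++⁺ pF (proj₂ (core-simple uC iC))

-- Paths with at most four edges, and cuts

module Paths {n : ℕ} (s t : Fin n) (s≢t : s ≢ t) (d : ℕ) (4≤d : 4 ≤ d) where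
  open Spokes s t s≢t
  open Terminals s t s≢t d

  path₁ : ∀ {S} → s ─ t ∈ S → ShortPath S
  path₁ st = 1 , ≤-trans (s≤s z≤n) 4≤d , cons st nil , (s≢t ∷ []) ∷ [] ∷ []

  path₂ : ∀ {S u} → Inner u → s ─ u ∈ S → u ─ t ∈ S → ShortPath S
  path₂ (s≢u , t≢u) su ut = 2 , ≤-trans (s≤s (s≤s z≤n)) 4≤d , cons su (cons ut nil)
    , (s≢u ∷ s≢t ∷ []) ∷ (t≢u ∘ sym ∷ []) ∷ [] ∷ []

  path₃ : ∀ {S u v} → Inner u → Inner v → u ≢ v → s ─ u ∈ S → u ─ v ∈ S → v ─ t ∈ S → ShortPath S
  path₃ (s≢u , t≢u) (s≢v , t≢v) u≢v su uv vt = 3 , ≤-trans (s≤s (s≤s (s≤s z≤n))) 4≤d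
    , cons su (cons uv (cons vt nil))
    , (s≢u ∷ s≢v ∷ s≢t ∷ []) ∷ (u≢v ∷ t≢u ∘ sym ∷ []) ∷ (t≢v ∘ sym ∷ []) ∷ [] ∷ []

  path₄ : ∀ {S u v w} → Inner u → Inner v → Inner w → u ≢ v → u ≢ w → v ≢ w →
          s ─ u ∈ S → u ─ v ∈ S → v ─ w ∈ S → w ─ t ∈ S → ShortPath S
  path₄ (s≢u , t≢u) (s≢v , t≢v) (s≢w , t≢w) u≢v u≢w v≢w su uv vw wt = 4 , 4≤d
    , cons su (cons uv (cons vw (cons wt nil)))
    , (s≢u ∷ s≢v ∷ s≢w ∷ s≢t ∷ []) ∷ (u≢v ∷ u≢w ∷ t≢u ∘ sym ∷ [])
      ∷ (v≢w ∷ t≢v ∘ sym ∷ []) ∷ (t≢w ∘ sym ∷ []) ∷ [] ∷ []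

  Uncrossed : (Fin n → Bool) → Edge n → Set
  Uncrossed σ e = σ (proj₁ e) ≡ σ (proj₂ e)

  uncrossed-─ : ∀ σ u v → Uncrossed σ (u ─ v) → σ u ≡ σ v
  uncrossed-─ σ u v eq with u Fin.<? v
  ... | yes _ = eq
  ... | no _ = sym eq

  ─-uncrossed : ∀ σ u v → σ u ≡ σ v → Uncrossed σ (u ─ v)
  ─-uncrossed σ u v eq with u Fin.<? v
  ... | yes _ = eq
  ... | no _ = sym eq

  cut : ∀ {S} (σ : Fin n → Bool) → σ s ≡ true → σ t ≡ false → All (Uncrossed σ) S → ¬ ShortPath S
  cut {S} σ σs σt unc (_ , _ , p , _) = true≢false (≡.trans (sym σs) (≡.trans (same p) σt))
    where
    true≢false : true ≢ false
    true≢false ()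
    same : ∀ {u w k} → Walk (Joins S) u w k → σ u ≡ σ w
    same nil = refl
    same (cons {u} {v} j p) = ≡.trans (uncrossed-─ σ u v (All.lookup unc j)) (same p)

  is-s : Fin n → Bool
  is-s v = ⌊ v Fin.≟ s ⌋

  is-s-s : is-s s ≡ true
  is-s-s with s Fin.≟ s
  ... | yes _ = refl
  ... | no s≢s = contradiction refl s≢s

  is-s-t : is-s t ≡ false
  is-s-t with t Fin.≟ s
  ... | yes t≡s = contradiction (sym t≡s) s≢t
  ... | no _ = refl

-- The terminal edge and the common neighbours

indicator : {P : Set} → Dec P → ℕ
indicator p = if ⌊ p ⌋ then 1 else 0

indicator-yes : {P : Set} (p : Dec P) → P → indicator p ≡ 1
indicator-yes (yes _) _ = refl
indicator-yes (no ¬p) p = contradiction p ¬p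

indicator-no : {P : Set} (p : Dec P) → ¬ P → indicator p ≡ 0
indicator-no (yes p) ¬p = contradiction p ¬p
indicator-no (no _) _ = refl

indicator-≤ : {P : Set} (p : Dec P) {c : ℕ} → (P → 1 ≤ c) → indicator p ≤ c
indicator-≤ (yes p) le = le p
indicator-≤ (no _) le = z≤n

indicator-⇔ : {P Q : Set} (p : Dec P) (q : Dec Q) → (P → Q) → (Q → P) → indicator p ≡ indicator q
indicator-⇔ (yes p) q f g = sym (indicator-yes q (f p))
indicator-⇔ (no ¬p) q f g = sym (indicator-no q (¬p ∘ g))

∈⇒≤-sum : ∀ {A : Set} (f : A → ℕ) {x xs} → x ∈ xs → f x ≤ sum (map f xs)
∈⇒≤-sum f {x} {_ ∷ xs} (here refl) = m≤m+n (f x) (sum (map f xs))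
∈⇒≤-sum f {x} {y ∷ xs} (there x∈) = ≤-trans (∈⇒≤-sum f x∈) (m≤n+m (sum (map f xs)) (f y))

sum-map-≤ : ∀ {A : Set} {f : A → ℕ} {c} xs → (∀ {x} → x ∈ xs → f x ≤ c) → sum (map f xs) ≤ length xs * c
sum-map-≤ [] _ = z≤n
sum-map-≤ (x ∷ xs) f≤ = +-mono-≤ (f≤ (here refl)) (sum-map-≤ xs (f≤ ∘ there))

large : {A : Set} → ℕ → List A → ℕ
large j S = indicator (j ≤? length S)

large-≤ : ∀ {A : Set} b .{{_ : NonZero b}} j (S : List A) → large j S * b ^ j ≤ b ^ length S
large-≤ b j S with j ≤? length S
... | yes j≤ = ≤-trans (≤-reflexive (+-identityʳ (b ^ j))) (^-monoʳ-≤ b j≤)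
... | no _ = z≤n

-- The estimate (b + 1)^r ≤ b^r + 3^r b^(r-1), multiplied by `b`. The constant `3 ^ r` is generous
-- enough for a direct induction.
suc^-≤ : ∀ b r → b * suc b ^ r ≤ b * b ^ r + 3 ^ r * b ^ r
suc^-≤ zero r = z≤n
suc^-≤ b@(suc _) zero = m≤m+n (b * 1) 1
suc^-≤ b@(suc b′) (suc r) = begin
  b * (suc b * suc b ^ r)
    ≡⟨ swap-* b (suc b ^ r) ⟩
  suc b * (b * suc b ^ r)
    ≤⟨ *-monoʳ-≤ (suc b) (suc^-≤ b r) ⟩
  suc b * (b * B + T)
    ≤⟨ m≤m+n _ (slack b′ B (3 ^ r)) ⟩
  suc b * (b * B + T) + slack b′ B (3 ^ r)
    ≡⟨ total b′ B (3 ^ r) (p 3^r≥1) ⟩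
  b * (b * B) + 3 * 3 ^ r * (b * B) ∎
  where
  open ≤-Reasoning
  B = b ^ r
  T = 3 ^ r * B
  3^r≥1 : 1 ≤ 3 ^ r
  3^r≥1 = m^n>0 3 r
  p : 1 ≤ 3 ^ r → suc (3 ^ r ∸ 1) ≡ 3 ^ r
  p = m+[n∸m]≡n
  swap-* : ∀ b x → b * ((1 + b) * x) ≡ (1 + b) * (b * x)
  swap-* = solve-∀
  -- Exactly the difference between the two sides after the induction hypothesis.
  slack : ℕ → ℕ → ℕ → ℕ
  slack b′ B q = (q ∸ 1) * (1 + b′) * B + q * b′ * B
  total : ∀ b′ B q → suc (q ∸ 1) ≡ q →
          (2 + b′) * ((1 + b′) * B + q * B) + slack b′ B q
        ≡ (1 + b′) * ((1 + b′) * B) + 3 * q * ((1 + b′) * B)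
  total b′ B q eq = subst (λ z → (2 + b′) * ((1 + b′) * B + z * B) + ((q ∸ 1) * (1 + b′) * B + z * b′ * B)
                               ≡ (1 + b′) * ((1 + b′) * B) + 3 * z * ((1 + b′) * B)) eq (ring b′ B (q ∸ 1))
    where
    ring : ∀ b′ B q → (2 + b′) * ((1 + b′) * B + (1 + q) * B) + (q * (1 + b′) * B + (1 + q) * b′ * B)
                    ≡ (1 + b′) * ((1 + b′) * B) + 3 * (1 + q) * ((1 + b′) * B)
    ring = solve-∀

module Comparison {n : ℕ} (s t : Fin n) (s≢t : s ≢ t) (d : ℕ) where
  open Terminals s t s≢t d

  module _ (a b : ℕ) where
    open Expectation {Edge n} a b

    𝔼-works+fails : ∀ L → 𝔼 L works [] + 𝔼 L fails [] ≡ (a + b) ^ length L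
    𝔼-works+fails L = begin-equality
      𝔼 L works [] + 𝔼 L fails []        ≡⟨ 𝔼-+ L works fails [] ⟨
      𝔼 L (λ S → works S + fails S) []   ≡⟨ ≤-antisym (𝔼-mono-all L [] (≤-reflexive ∘ works+fails))
                                                      (𝔼-mono-all L [] (≤-reflexive ∘ sym ∘ works+fails)) ⟩
      𝔼 L (λ _ → 1) []                   ≡⟨ 𝔼-const L 1 [] ⟩
      (a + b) ^ length L * 1             ≡⟨ *-identityʳ _ ⟩
      (a + b) ^ length L                 ∎
      where open ≤-Reasoning

    -- Working and failing weight add up to `(a + b) ^ length`, which is the same for both lists.
    optimal-fails : ∀ {es L} → Optimal s t s≢t d es → Simple L → length L ≡ length es → 0 < a + b →
                    𝔼 es fails [] ≤ 𝔼 L fails []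
    optimal-fails {es} {L} optimal sL len 0< = +-cancelˡ-≤ (𝔼 L works []) _ _ (begin
      𝔼 L works [] + 𝔼 es fails []   ≤⟨ +-monoˡ-≤ (𝔼 es fails []) (optimal L sL len a b 0<) ⟩
      𝔼 es works [] + 𝔼 es fails []  ≡⟨ 𝔼-works+fails es ⟩
      (a + b) ^ length es            ≡⟨ cong ((a + b) ^_) len ⟨
      (a + b) ^ length L             ≡⟨ 𝔼-works+fails L ⟨
      𝔼 L works [] + 𝔼 L fails []    ∎)
      where open ≤-Reasoning

  Optimal-resp-↭ : ∀ {es es′} → es ↭ es′ → Optimal s t s≢t d es → Optimal s t s≢t d es′
  Optimal-resp-↭ es↭ optimal L sL len a b 0< = ≤-trans
    (optimal L sL (≡.trans len (sym (↭-length es↭))) a b 0<)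
    (≤-reflexive (Expectation.𝔼-↭ a b works works-↭ es↭ []))

-- Consequences of optimality as ρ tends to 1

module Extremal {n : ℕ} (s t : Fin n) (s≢t : s ≢ t) (d : ℕ) (4≤d : 4 ≤ d)
                (es : List (Edge n)) (simple : Simple es) (optimal : Optimal s t s≢t d es) where
  open Spokes s t s≢t
  open Terminals s t s≢t d
  open Paths s t s≢t d 4≤d

  private
    m = length es

  works-≤1 : ∀ S → works S ≤ 1
  works-≤1 S = works-≤ λ _ → ≤-refl

  -- Without st every pathset has at least two edges. There are at most `2 ^ m` of them, each of
  -- weight at most b^(m-2), whereas the pathset st alone weighs b^(m-1); so any `b` above `2 ^ m`
  -- decides.
  joined : 1 ≤ m → s ─ t ∈ es
  joined 1≤m with s ─ t ∈ᵉ? es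
  ... | yes st∈ = st∈
  ... | no st∉ with extend {L = [ s ─ t ]} ([] ∷ [] , ─-proper s≢t ∷ []) 1≤m (Simple-length simple)
  ... | R , sL , len = contradiction b≤ (<⇒≱ (n<1+n (2 ^ m)))
    where
    open ≤-Reasoning
    b = suc (2 ^ m)
    open Expectation {Edge n} 1 b
    long : ∀ S → (Unique es → Unique S) → S ⊆ es → works (S ++ []) ≤ large 2 (S ++ [])
    long S _ S⊆ rewrite ++-identityʳ S = works-≤ λ
      { (0 , _ , nil , _) → contradiction refl s≢t
      ; (1 , _ , cons st nil , _) → contradiction (S⊆ st) st∉
      ; (suc (suc k) , _ , p) → ≤-reflexive (sym (indicator-yes (2 ≤? length S)
          (≤-trans (s≤s (s≤s z≤n)) (path-length p)))) }
    upper : 𝔼 es works [] * b ^ 2 ≤ 2 ^ m * b ^ m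
    upper = begin
      𝔼 es works [] * b ^ 2     ≤⟨ *-monoˡ-≤ (b ^ 2) (𝔼-mono es works (large 2) [] [] long) ⟩
      𝔼 es (large 2) [] * b ^ 2 ≤⟨ 𝔼-many b es (large 2) [] 2 (large-≤ b 2) ⟩
      2 ^ m * b ^ (m + 0)       ≡⟨ cong (λ z → 2 ^ m * b ^ z) (+-identityʳ m) ⟩
      2 ^ m * b ^ m             ∎
    lower : b ^ length R ≤ 𝔼 ([ s ─ t ] ++ R) works []
    lower = begin
      b ^ length R                       ≡⟨ *-identityʳ _ ⟨
      b ^ length R * 1                   ≡⟨ cong (b ^ length R *_) (works-yes (path₁ (here refl))) ⟨
      b ^ length R * works [ s ─ t ]     ≤⟨ 𝔼-≥-drop R works [ s ─ t ] ⟩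
      𝔼 R works [ s ─ t ]                ≤⟨ m≤m+n _ 0 ⟩
      𝔼 R works [ s ─ t ] + 0            ≤⟨ m≤m+n _ _ ⟩
      𝔼 ([ s ─ t ] ++ R) works []        ∎
    b≤ : b ≤ 2 ^ m
    b≤ = *-cancelʳ-≤ b (2 ^ m) (b ^ m) {{m^n≢0 b m}} (begin
      b * b ^ m                           ≡⟨ cong (λ z → b * b ^ z) len ⟨
      b * (b * b ^ length R)              ≡⟨ regroup b (b ^ length R) ⟩
      b ^ length R * b ^ 2                ≤⟨ *-monoˡ-≤ (b ^ 2) lower ⟩
      𝔼 ([ s ─ t ] ++ R) works [] * b ^ 2 ≤⟨ *-monoˡ-≤ (b ^ 2) (optimal _ sL len 1 b (s≤s z≤n)) ⟩
      𝔼 es works [] * b ^ 2               ≤⟨ upper ⟩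
      2 ^ m * b ^ m                       ∎)
      where
      regroup : ∀ b x → b * (b * x) ≡ x * (b * (b * 1))
      regroup = solve-∀

  common? : ∀ u → Dec (s ─ u ∈ es × u ─ t ∈ es)
  common? u = (s ─ u ∈ᵉ? es) ×-dec (u ─ t ∈ᵉ? es)

  common : List (Fin n)
  common = filter common? inners

  common-unique : Unique common
  common-unique = Unique.filter⁺ common? inners-unique

  common-inner : All Inner common
  common-inner = All.tabulate (∈-inners⁻ ∘ proj₁ ∘ ∈-filter⁻ common? {xs = inners})

  private
    both? : ∀ u S → Dec (s ─ u ∈ S × u ─ t ∈ S)
    both? u S = (s ─ u ∈ᵉ? S) ×-dec (u ─ t ∈ᵉ? S)

    both : Fin n → List (Edge n) → ℕ
    both u S = indicator (both? u S)

    module _ (b : ℕ) .{{_ : NonZero b}} where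
      open Expectation {Edge n} 1 b
      open ≤-Reasoning

      -- Counts only states made of the two spokes at one vertex: retain both spokes of `u` and drop
      -- the rest, or retain neither and recurse.
      spokes-lower : ∀ us R X → All Inner us →
        length us * b ^ (2 * length us + length R) ≤ 𝔼 (spokes us ++ R) works X * b ^ 2
      spokes-lower [] R X _ = z≤n
      spokes-lower (u ∷ us) R X (iu ∷ is) = begin
        suc c * b ^ (2 * suc c + length R)
          ≡⟨ cong (λ z → suc c * b ^ z) (arith c (length R)) ⟩
        suc c * (b * (b * b ^ q))
          ≡⟨ regroup c b (b ^ q) ⟩
        b ^ q * 1 * (b * (b * 1)) + b * b * (c * b ^ q)
          ≤⟨ +-mono-≤ (*-monoˡ-≤ (b ^ 2) first) (*-monoʳ-≤ (b * b) (spokes-lower us R X is)) ⟩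
        E₂ * (b * (b * 1)) + b * b * (E₀ * (b * (b * 1)))
          ≤⟨ m≤m+n _ (b * (b * 1) * (b * E₁ + b * E₁′)) ⟩
        E₂ * (b * (b * 1)) + b * b * (E₀ * (b * (b * 1))) + b * (b * 1) * (b * E₁ + b * E₁′)
          ≡⟨ regroup′ b E₂ E₁ E₁′ E₀ ⟩
        (1 * (1 * E₂ + b * E₁) + b * (1 * E₁′ + b * E₀)) * (b * (b * 1)) ∎
        where
        c = length us
        q = 2 * c + length R
        L = spokes us ++ R
        E₂ = 𝔼 L works (u ─ t ∷ s ─ u ∷ X)
        E₁ = 𝔼 L works (s ─ u ∷ X)
        E₁′ = 𝔼 L works (u ─ t ∷ X)
        E₀ = 𝔼 L works X
        arith : ∀ c r → 2 * suc c + r ≡ suc (suc (2 * c + r))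
        arith = solve-∀
        len : length L ≡ q
        len = ≡.trans (length-++ (spokes us)) (cong (_+ length R) (length-spokes us))
        first : b ^ q * 1 ≤ E₂
        first = begin
          b ^ q * 1 ≡⟨ cong₂ _*_ (cong (b ^_) len) (works-yes {u ─ t ∷ s ─ u ∷ X} (path₂ iu (there (here refl)) (here refl))) ⟨
          b ^ length L * works (u ─ t ∷ s ─ u ∷ X) ≤⟨ 𝔼-≥-drop L works _ ⟩
          E₂ ∎
        regroup : ∀ c b x → (1 + c) * (b * (b * x)) ≡ x * 1 * (b * (b * 1)) + b * b * (c * x)
        regroup = solve-∀
        regroup′ : ∀ b p q r w → p * (b * (b * 1)) + b * b * (w * (b * (b * 1))) + b * (b * 1) * (b * q + b * r)
                 ≡ (1 * (1 * p + b * q) + b * (1 * r + b * w)) * (b * (b * 1))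
        regroup′ = solve-∀

      -- Once the two spokes at `u` are fixed, the other `r` edges are free.
      both-upper : ∀ {es′ r u} → Unique es′ → length es′ ≡ 2 + r → Inner u → s ─ u ∈ es′ → u ─ t ∈ es′ →
                   𝔼 es′ (both u) [] ≤ suc b ^ r
      both-upper {es′} {r} {u} uniq len iu su ut
        with ⊆⇒↭ {xs = s ─ u ∷ u ─ t ∷ []} ((s─u≢v─t iu ∷ []) ∷ [] ∷ [])
                 (λ { (here refl) → su ; (there (here refl)) → ut })
      ... | rest , es′↭ with Unique-resp-↭ es′↭ uniq
      ... | (_ ∷ su∉) ∷ ut∉ ∷ _ = begin
        𝔼 es′ (both u) []
          ≡⟨ 𝔼-↭ (both u) both-↭ es′↭ [] ⟩
        𝔼 (s ─ u ∷ u ─ t ∷ rest) (both u) []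
          ≤⟨ +-mono-≤ (*-monoʳ-≤ 1 (+-mono-≤ (*-monoʳ-≤ 1 one) (*-monoʳ-≤ b (zeros (s ─ u ∷ []) λ S S⊆ (_ , q) → no-ut S S⊆ q))))
                      (*-monoʳ-≤ b (+-mono-≤ (*-monoʳ-≤ 1 (zeros (u ─ t ∷ []) λ S S⊆ (p , _) → no-su S S⊆ p))
                                             (*-monoʳ-≤ b (zeros [] λ S S⊆ (p , _) → no-su′ S S⊆ p)))) ⟩
        1 * (1 * suc b ^ r + b * 0) + b * (1 * 0 + b * 0)
          ≡⟨ tidy b (suc b ^ r) ⟩
        suc b ^ r ∎
        where
        tidy : ∀ b x → 1 * (1 * x + b * 0) + b * (1 * 0 + b * 0) ≡ x
        tidy = solve-∀
        both-↭ : ∀ {S S′} → S ↭ S′ → both u S ≡ both u S′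
        both-↭ {S} {S′} p = indicator-⇔ (both? u S) (both? u S′)
          (λ (x , y) → ∈-resp-↭ p x , ∈-resp-↭ p y)
          (λ (x , y) → ∈-resp-↭ (↭-sym p) x , ∈-resp-↭ (↭-sym p) y)
        r≡ : length rest ≡ r
        r≡ = suc-injective (suc-injective (≡.trans (sym (↭-length es′↭)) len))
        one : 𝔼 rest (both u) (u ─ t ∷ s ─ u ∷ []) ≤ suc b ^ r
        one = begin
          𝔼 rest (both u) (u ─ t ∷ s ─ u ∷ []) ≤⟨ 𝔼-mono-all rest _ (λ S → indicator-≤ (both? u S) (λ _ → ≤-refl)) ⟩
          𝔼 rest (λ _ → 1) (u ─ t ∷ s ─ u ∷ []) ≡⟨ 𝔼-const rest 1 _ ⟩
          suc b ^ length rest * 1 ≡⟨ *-identityʳ _ ⟩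
          suc b ^ length rest ≡⟨ cong (suc b ^_) r≡ ⟩
          suc b ^ r ∎
        zeros : ∀ X → (∀ S → S ⊆ rest → ¬ (s ─ u ∈ S ++ X × u ─ t ∈ S ++ X)) → 𝔼 rest (both u) X ≤ 0
        zeros X none = ≤-trans
          (𝔼-mono rest (both u) (λ _ → 0) X X λ S _ S⊆ → ≤-reflexive (indicator-no (both? u (S ++ X)) (none S S⊆)))
          (≤-reflexive (≡.trans (𝔼-const rest 0 X) (*-zeroʳ (suc b ^ length rest))))
        no-ut : ∀ S → S ⊆ rest → u ─ t ∉ S ++ s ─ u ∷ []
        no-ut S S⊆ q with ∈-++⁻ S q
        ... | inj₁ q∈ = All¬⇒¬Any ut∉ (S⊆ q∈)
        ... | inj₂ (here eq) = s─u≢v─t iu (sym eq)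
        no-su : ∀ S → S ⊆ rest → s ─ u ∉ S ++ u ─ t ∷ []
        no-su S S⊆ q with ∈-++⁻ S q
        ... | inj₁ q∈ = All¬⇒¬Any su∉ (S⊆ q∈)
        ... | inj₂ (here eq) = s─u≢v─t iu eq
        no-su′ : ∀ S → S ⊆ rest → s ─ u ∉ S ++ []
        no-su′ S S⊆ q with ∈-++⁻ S q
        ... | inj₁ q∈ = All¬⇒¬Any su∉ (S⊆ q∈)

  -- With st present, the next order counts pathsets with two edges, that is, common neighbours. In
  -- a competitor with `c` of them these weigh at least c b^r, while the given graph reaches at most
  -- γ (b + 1)^r plus the pathsets with three or more edges; for large `b` this excludes γ < c.
  common-maximal : ∀ {c} → c ≤ length inners → 3 ≤ m → 1 + 2 * c ≤ m → c ≤ length common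
  common-maximal {c} c≤ 3≤m le with c ≤? length common
  ... | yes done = done
  ... | no c≰ with ∈⇒↭ (joined (≤-trans (s≤s z≤n) 3≤m))
    | extend {L = core (take c inners)} (core-simple (Unique.take⁺ c inners-unique)
        (All.take⁺ c (All.tabulate ∈-inners⁻)))
        (≤-trans (≤-reflexive (≡.trans (length-core (take c inners))
          (cong (λ z → 1 + 2 * z) (≡.trans (length-take c inners) (m≤n⇒m⊓n≡m c≤))))) le)
        (Simple-length simple)
  ... | es′ , es↭ | R , sL , len = contradiction b≤ (<⇒≱ (n<1+n _))
    where
    open ≤-Reasoning
    us = take c inners
    L = core us ++ R
    r = m ∸ 3
    γ = length common
    -- The coefficients of the two error terms: (b + 1)^r against b^r for each common neighbour, and
    -- the at most `2 ^ (2 + r)` states with three or more edges.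
    w = γ * 3 ^ r + 2 ^ (2 + r)
    b = suc w
    open Expectation {Edge n} 1 b
    inner-us : All Inner us
    inner-us = All.take⁺ c (All.tabulate ∈-inners⁻)
    |us| : length us ≡ c
    |us| = ≡.trans (length-take c inners) (m≤n⇒m⊓n≡m c≤)
    m≡ : m ≡ 3 + r
    m≡ = sym (m+[n∸m]≡n 3≤m)
    |es′| : length es′ ≡ 2 + r
    |es′| = suc-injective (≡.trans (sym (↭-length es↭)) m≡)
    uniq∷ : Unique (s ─ t ∷ es′)
    uniq∷ = Unique-resp-↭ es↭ (proj₁ simple)
    st∉ : s ─ t ∉ es′
    st∉ with uniq∷
    ... | st∉ ∷ _ = All¬⇒¬Any st∉
    uniq′ : Unique es′
    uniq′ with uniq∷
    ... | _ ∷ u = u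
    ⊆es : ∀ {e} → e ∈ es′ → e ∈ es
    ⊆es e∈ = ∈-resp-↭ (↭-sym es↭) (there e∈)
    ∈es′ : ∀ {e} → e ∈ es → s ─ t ≢ e → e ∈ es′
    ∈es′ e∈ ne with ∈-resp-↭ es↭ e∈
    ... | here refl = contradiction refl ne
    ... | there e∈′ = e∈′
    L↭ : L ↭ s ─ t ∷ spokes us ++ R
    L↭ = ↭-trans (↭-reflexive (++-assoc (spokes us) [ s ─ t ] R)) (shift (s ─ t) (spokes us) R)
    |L′| : length (spokes us ++ R) ≡ 2 + r
    |L′| = suc-injective (≡.trans (sym (↭-length L↭)) (≡.trans len m≡))
    -- A state that retains st works in either graph, so only the states without st are left to
    -- compare.
    core≤ : 𝔼 (spokes us ++ R) works [] ≤ 𝔼 es′ works []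
    core≤ = *-cancelˡ-≤ b (+-cancelˡ-≤ (suc b ^ (2 + r)) _ _ (begin
      suc b ^ (2 + r) + b * 𝔼 (spokes us ++ R) works []
        ≡⟨ cong (λ z → suc b ^ z + b * 𝔼 (spokes us ++ R) works []) |L′| ⟨
      suc b ^ length (spokes us ++ R) + b * 𝔼 (spokes us ++ R) works []
        ≤⟨ +-monoˡ-≤ _ all-work ⟩
      1 * 𝔼 (spokes us ++ R) works [ s ─ t ] + b * 𝔼 (spokes us ++ R) works []
        ≡⟨ 𝔼-↭ works works-↭ L↭ [] ⟨
      𝔼 L works []
        ≤⟨ optimal L sL len 1 b (s≤s z≤n) ⟩
      𝔼 es works []
        ≡⟨ 𝔼-↭ works works-↭ es↭ [] ⟩
      1 * 𝔼 es′ works [ s ─ t ] + b * 𝔼 es′ works []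
        ≤⟨ +-monoˡ-≤ _ at-most ⟩
      suc b ^ (2 + r) + b * 𝔼 es′ works [] ∎))
      where
      all-work : suc b ^ length (spokes us ++ R) ≤ 1 * 𝔼 (spokes us ++ R) works [ s ─ t ]
      all-work = begin
        suc b ^ length (spokes us ++ R)      ≡⟨ *-identityʳ _ ⟨
        suc b ^ length (spokes us ++ R) * 1  ≡⟨ 𝔼-const (spokes us ++ R) 1 [ s ─ t ] ⟨
        𝔼 (spokes us ++ R) (λ _ → 1) [ s ─ t ]
          ≤⟨ 𝔼-mono (spokes us ++ R) (λ _ → 1) works [ s ─ t ] [ s ─ t ] (λ S _ _ →
               ≤-reflexive (sym (works-yes (path₁ (∈-++⁺ʳ S (here refl)))))) ⟩
        𝔼 (spokes us ++ R) works [ s ─ t ]   ≡⟨ *-identityˡ _ ⟨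
        1 * 𝔼 (spokes us ++ R) works [ s ─ t ] ∎
      at-most : 1 * 𝔼 es′ works [ s ─ t ] ≤ suc b ^ (2 + r)
      at-most = begin
        1 * 𝔼 es′ works [ s ─ t ]   ≡⟨ *-identityˡ _ ⟩
        𝔼 es′ works [ s ─ t ]       ≤⟨ 𝔼-mono-all es′ [ s ─ t ] works-≤1 ⟩
        𝔼 es′ (λ _ → 1) [ s ─ t ]   ≡⟨ 𝔼-const es′ 1 [ s ─ t ] ⟩
        suc b ^ length es′ * 1      ≡⟨ *-identityʳ _ ⟩
        suc b ^ length es′          ≡⟨ cong (suc b ^_) |es′| ⟩
        suc b ^ (2 + r)             ∎
    short : ∀ S → (Unique es′ → Unique S) → S ⊆ es′ →
            works (S ++ []) ≤ sum (map (λ u → both u (S ++ [])) common) + large 3 (S ++ [])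
    short S _ S⊆ rewrite ++-identityʳ S = works-≤ λ
      { (0 , _ , nil , _) → contradiction refl s≢t
      ; (1 , _ , cons st nil , _) → contradiction (S⊆ st) st∉
      ; (2 , _ , cons {v = u} su (cons ut nil) , (s≢u ∷ _) ∷ (u≢t ∷ _) ∷ _) →
          ≤-trans (≤-reflexive (sym (indicator-yes (both? u S) (su , ut))))
            (≤-trans (∈⇒≤-sum (λ u → both u S)
                       (∈-filter⁺ common? (∈-inners⁺ (s≢u , u≢t ∘ sym)) (⊆es (S⊆ su) , ⊆es (S⊆ ut))))
                     (m≤m+n _ _))
      ; (suc (suc (suc k)) , _ , p) →
          ≤-trans (≤-reflexive (sym (indicator-yes (3 ≤? length S) (≤-trans (s≤s (s≤s (s≤s z≤n))) (path-length p)))))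
                  (m≤n+m _ _) }
    upper : 𝔼 es′ works [] * b ^ 3 ≤ γ * suc b ^ r * b ^ 3 + 2 ^ (2 + r) * b ^ (2 + r)
    upper = begin
      𝔼 es′ works [] * b ^ 3
        ≤⟨ *-monoˡ-≤ (b ^ 3) (𝔼-mono es′ works _ [] [] short) ⟩
      𝔼 es′ (λ S → sum (map (λ u → both u S) common) + large 3 S) [] * b ^ 3
        ≡⟨ cong (_* b ^ 3) (≡.trans (𝔼-+ es′ _ (large 3) []) (cong (_+ 𝔼 es′ (large 3) []) (𝔼-sum es′ both common []))) ⟩
      (sum (map (λ u → 𝔼 es′ (both u) []) common) + 𝔼 es′ (large 3) []) * b ^ 3
        ≡⟨ *-distribʳ-+ (b ^ 3) (sum (map (λ u → 𝔼 es′ (both u) []) common)) (𝔼 es′ (large 3) []) ⟩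
      sum (map (λ u → 𝔼 es′ (both u) []) common) * b ^ 3 + 𝔼 es′ (large 3) [] * b ^ 3
        ≤⟨ +-mono-≤ (*-monoˡ-≤ (b ^ 3) (sum-map-≤ common each)) (𝔼-many b es′ (large 3) [] 3 (large-≤ b 3)) ⟩
      γ * suc b ^ r * b ^ 3 + 2 ^ length es′ * b ^ (length es′ + 0)
        ≡⟨ cong₂ (λ y z → γ * suc b ^ r * b ^ 3 + 2 ^ y * b ^ z) |es′| (≡.trans (+-identityʳ _) |es′|) ⟩
      γ * suc b ^ r * b ^ 3 + 2 ^ (2 + r) * b ^ (2 + r) ∎
      where
      each : ∀ {u} → u ∈ common → 𝔼 es′ (both u) [] ≤ suc b ^ r
      each u∈ with ∈-filter⁻ common? {xs = inners} u∈
      ... | u∈i , su , ut = both-upper b uniq′ |es′| iu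
        (∈es′ su λ eq → proj₂ iu (sym (t≡ eq))) (∈es′ ut λ eq → proj₁ iu (≡s eq))
        where
        iu = ∈-inners⁻ u∈i
        t≡ : s ─ t ≡ s ─ _ → _ ≡ t
        t≡ eq = sym (s─-injective′ eq)
          where
          s─-injective′ : ∀ {u} → s ─ t ≡ s ─ u → t ≡ u
          s─-injective′ eq with ─-injective eq
          ... | inj₁ (_ , q) = q
          ... | inj₂ (_ , q) = contradiction (sym q) s≢t
        ≡s : ∀ {u} → s ─ t ≡ u ─ t → s ≡ u
        ≡s eq with ─-injective eq
        ... | inj₁ (q , _) = q
        ... | inj₂ (q , _) = contradiction q s≢t
    lower : c * b ^ (2 + r) ≤ 𝔼 (spokes us ++ R) works [] * b ^ 2
    lower = begin
      c * b ^ (2 + r) ≡⟨ cong₂ (λ x y → x * b ^ y) |us| (≡.trans (≡.trans (cong (_+ length R) (sym (length-spokes us))) (sym (length-++ (spokes us)))) |L′|) ⟨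
      length us * b ^ (2 * length us + length R) ≤⟨ spokes-lower b us R [] inner-us ⟩
      𝔼 (spokes us ++ R) works [] * b ^ 2 ∎
    B = b ^ r
    b≤ : b ≤ w
    b≤ = *-cancelʳ-≤ b w (b * (b * B)) {{m^n≢0 b (2 + r)}} (+-cancelˡ-≤ (γ * (b * (b * (b * B)))) _ _ (begin
      γ * (b * (b * (b * B))) + b * (b * (b * B))
        ≡⟨ +-comm (γ * (b * (b * (b * B)))) _ ⟩
      suc γ * (b * (b * (b * B)))
        ≤⟨ *-monoˡ-≤ (b * (b * (b * B))) (≰⇒> c≰) ⟩
      c * (b * (b * (b * B)))
        ≡⟨ x1 c b (b * (b * B)) ⟩
      b * (c * (b * (b * B)))
        ≤⟨ *-monoʳ-≤ b lower ⟩
      b * (𝔼 (spokes us ++ R) works [] * b ^ 2)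
        ≤⟨ *-monoʳ-≤ b (*-monoˡ-≤ (b ^ 2) core≤) ⟩
      b * (𝔼 es′ works [] * b ^ 2)
        ≡⟨ x2 b (𝔼 es′ works []) ⟩
      𝔼 es′ works [] * b ^ 3
        ≤⟨ upper ⟩
      γ * suc b ^ r * b ^ 3 + 2 ^ (2 + r) * (b * (b * B))
        ≡⟨ cong (_+ 2 ^ (2 + r) * (b * (b * B))) (x3 b γ (suc b ^ r)) ⟩
      γ * b * b * (b * suc b ^ r) + 2 ^ (2 + r) * (b * (b * B))
        ≤⟨ +-monoˡ-≤ (2 ^ (2 + r) * (b * (b * B))) (*-monoʳ-≤ (γ * b * b) (suc^-≤ b r)) ⟩
      γ * b * b * (b * B + 3 ^ r * B) + 2 ^ (2 + r) * (b * (b * B))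
        ≡⟨ x4 b γ B (3 ^ r) (2 ^ (2 + r)) ⟩
      γ * (b * (b * (b * B))) + w * (b * (b * B)) ∎))
      where
      x1 : ∀ c b x → c * (b * x) ≡ b * (c * x)
      x1 = solve-∀
      x2 : ∀ b x → b * (x * (b * (b * 1))) ≡ x * (b * (b * (b * 1)))
      x2 = solve-∀
      x3 : ∀ b γ x → γ * x * (b * (b * (b * 1))) ≡ γ * b * b * (b * x)
      x3 = solve-∀
      x4 : ∀ b γ B p q → γ * b * b * (b * B + p * B) + q * (b * (b * B))
                       ≡ γ * (b * (b * (b * B))) + (γ * p + q) * (b * (b * B))
      x4 = solve-∀

-- Weights of partitions into components

-- The weight with which the terminal edges at x mutually connected vertices
-- leave s and t separated: none at s, or none at t.
block : ℕ → ℕ → ℕ → ℕ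
block a b zero = 1
block a b (suc x) = a * (b * (b * (a + b)) ^ x) + b * (a * (b * (a + b)) ^ x + b * block a b x)

blocks : ℕ → ℕ → ∀ {A : Set} → List (List A) → ℕ
blocks a b bs = product (map (block a b ∘ length) bs)

concat-↭ : ∀ {A : Set} {bs bs′ : List (List A)} → bs ↭ bs′ → concat bs ↭ concat bs′
concat-↭ refl = refl
concat-↭ (prep ys p) = ++⁺ˡ ys (concat-↭ p)
concat-↭ (swap ys zs p) = ↭-trans (shifts ys zs) (++⁺ˡ zs (++⁺ˡ ys (concat-↭ p)))
concat-↭ (trans p q) = trans (concat-↭ p) (concat-↭ q)

concat-singletons : ∀ {A : Set} (xs : List A) → concat (map [_] xs) ≡ xs
concat-singletons [] = refl
concat-singletons (x ∷ xs) = cong (x ∷_) (concat-singletons xs)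

Within : ∀ {n} → List (List (Fin n)) → Edge n → Set
Within bs e = ∃[ ys ] (ys ∈ bs × proj₁ e ∈ ys × proj₂ e ∈ ys)

module Blocks {n : ℕ} (s t : Fin n) (s≢t : s ≢ t) (d : ℕ) (4≤d : 4 ≤ d) (a b : ℕ) where
  open Spokes s t s≢t
  open Terminals s t s≢t d
  open Paths s t s≢t d 4≤d
  open Expectation {Edge n} a b
  open DecMembership (Fin._≟_ {n}) using () renaming (_∈?_ to _∈ⱽ?_)
  open ≤-Reasoning

  coreOf : List (List (Fin n)) → List (Edge n)
  coreOf [] = [ s ─ t ]
  coreOf (ys ∷ bs) = spokes ys ++ coreOf bs

  coreOf≡core : ∀ bs → coreOf bs ≡ core (concat bs)
  coreOf≡core [] = refl
  coreOf≡core (ys ∷ bs) = ≡.trans (cong (spokes ys ++_) (coreOf≡core bs))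
    (≡.trans (sym (++-assoc (spokes ys) (spokes (concat bs)) [ s ─ t ]))
             (cong (_++ [ s ─ t ]) (sym (spokes-++ ys (concat bs)))))

  𝔼-fails-zero : ∀ L {X} → ShortPath X → 𝔼 L fails X ≡ 0
  𝔼-fails-zero L {X} p = n≤0⇒n≡0 (≤-trans
    (𝔼-mono L fails (λ _ → 0) X X λ S _ _ → ≤-reflexive (fails-yes (ShortPath-⊆ (∈-++⁺ʳ S) p)))
    (≤-reflexive (≡.trans (𝔼-const L 0 X) (*-zeroʳ ((a + b) ^ length L)))))

  𝔼-fails-anti : ∀ L {X Y} → X ⊆ Y → 𝔼 L fails Y ≤ 𝔼 L fails X
  𝔼-fails-anti L {X} {Y} X⊆Y = 𝔼-mono L fails fails Y X λ S _ _ → fails-anti (both S)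
    where
    both : ∀ S → S ++ X ⊆ S ++ Y
    both S e∈ with ∈-++⁻ S e∈
    ... | inj₁ e∈S = ∈-++⁺ˡ e∈S
    ... | inj₂ e∈X = ∈-++⁺ʳ S (X⊆Y e∈X)

  private
    -- A vertex whose side is settled: the spoke to the other terminal is dropped, its own spoke is
    -- free.
    side = b * (a + b)

    side-once : ∀ a b x → a * (a * 0 + b * x) + b * (a * 0 + b * x) ≡ b * (a + b) * x
    side-once = solve-∀

    side-once′ : ∀ a b x → a * 0 + b * (a * x + b * x) ≡ b * (a + b) * x
    side-once′ = solve-∀

  -- `X` already links the block to s, so any retained spoke to t completes a path, while the spokes
  -- to s are free.
  upper-s : ∀ ys L X → (∀ {y S} → y ∈ ys → X ⊆ S → y ─ t ∈ S → ShortPath S) →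
            𝔼 (spokes ys ++ L) fails X ≤ side ^ length ys * 𝔼 L fails X
  upper-s [] L X _ = ≤-reflexive (sym (+-identityʳ _))
  upper-s (y ∷ ys) L X path = begin
    a * (a * 𝔼 L′ fails (y ─ t ∷ s ─ y ∷ X) + b * 𝔼 L′ fails (s ─ y ∷ X))
    + b * (a * 𝔼 L′ fails (y ─ t ∷ X) + b * 𝔼 L′ fails X)
      ≤⟨ +-mono-≤ (*-monoʳ-≤ a (+-mono-≤ (*-monoʳ-≤ a zero₁) (*-monoʳ-≤ b fewer)))
                  (*-monoʳ-≤ b (+-mono-≤ (*-monoʳ-≤ a zero₂) (*-monoʳ-≤ b ih))) ⟩
    a * (a * 0 + b * Z) + b * (a * 0 + b * Z)
      ≡⟨ side-once a b Z ⟩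
    side * Z
      ≡⟨ *-assoc side (side ^ length ys) (𝔼 L fails X) ⟨
    side ^ length (y ∷ ys) * 𝔼 L fails X ∎
    where
    L′ = spokes ys ++ L
    Z = side ^ length ys * 𝔼 L fails X
    ih : 𝔼 L′ fails X ≤ Z
    ih = upper-s ys L X (path ∘ there)
    fewer : 𝔼 L′ fails (s ─ y ∷ X) ≤ Z
    fewer = ≤-trans (𝔼-fails-anti L′ there) ih
    zero₁ : 𝔼 L′ fails (y ─ t ∷ s ─ y ∷ X) ≤ 0
    zero₁ = ≤-reflexive (𝔼-fails-zero L′ (path (here refl) (there ∘ there) (here refl)))
    zero₂ : 𝔼 L′ fails (y ─ t ∷ X) ≤ 0
    zero₂ = ≤-reflexive (𝔼-fails-zero L′ (path (here refl) there (here refl)))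

  upper-t : ∀ ys L X → (∀ {y S} → y ∈ ys → X ⊆ S → s ─ y ∈ S → ShortPath S) →
            𝔼 (spokes ys ++ L) fails X ≤ side ^ length ys * 𝔼 L fails X
  upper-t [] L X _ = ≤-reflexive (sym (+-identityʳ _))
  upper-t (y ∷ ys) L X path = begin
    a * 𝔼 (y ─ t ∷ L′) fails (s ─ y ∷ X) + b * (a * 𝔼 L′ fails (y ─ t ∷ X) + b * 𝔼 L′ fails X)
      ≤⟨ +-mono-≤ (*-monoʳ-≤ a zero₁) (*-monoʳ-≤ b (+-mono-≤ (*-monoʳ-≤ a fewer) (*-monoʳ-≤ b ih))) ⟩
    a * 0 + b * (a * Z + b * Z)
      ≡⟨ side-once′ a b Z ⟩
    side * Z
      ≡⟨ *-assoc side (side ^ length ys) (𝔼 L fails X) ⟨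
    side ^ length (y ∷ ys) * 𝔼 L fails X ∎
    where
    L′ = spokes ys ++ L
    Z = side ^ length ys * 𝔼 L fails X
    ih : 𝔼 L′ fails X ≤ Z
    ih = upper-t ys L X (path ∘ there)
    fewer : 𝔼 L′ fails (y ─ t ∷ X) ≤ Z
    fewer = ≤-trans (𝔼-fails-anti L′ there) ih
    zero₁ : 𝔼 (y ─ t ∷ L′) fails (s ─ y ∷ X) ≤ 0
    zero₁ = ≤-reflexive (𝔼-fails-zero (y ─ t ∷ L′) (path (here refl) there (here refl)))

  -- What connectedness of a block has to mean here: a spoke from s and a spoke to t into the block
  -- complete a path with at most `d` edges. It is required in every state above `X`, so that it
  -- survives retaining spokes. Stars satisfy it, via s, leaf, centre, leaf, t, and this needs
  -- `4 ≤ d`.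
  Tight : List (Edge n) → List (Fin n) → Set
  Tight X ys = ∀ {y z S} → y ∈ ys → z ∈ ys → X ⊆ S → s ─ y ∈ S → z ─ t ∈ S → ShortPath S

  tight-single : ∀ {X u} → Inner u → Tight X [ u ]
  tight-single iu (here refl) (here refl) _ su ut = path₂ iu su ut

  tight-star : ∀ {c B X} → c ∈ B → (∀ {y} → y ∈ B → Inner y) → (∀ {y} → y ∈ B → y ≢ c → c ─ y ∈ X) → Tight X B
  tight-star {c} c∈ inner-B attached {y} {z} y∈ z∈ X⊆ sy zt with y Fin.≟ z
  ... | yes refl = path₂ (inner-B y∈) sy zt
  ... | no y≢z with y Fin.≟ c | z Fin.≟ c
  ... | yes refl | _ = path₃ (inner-B y∈) (inner-B z∈) y≢z sy (X⊆ (attached z∈ (y≢z ∘ sym))) zt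
  ... | no y≢c | yes refl = path₃ (inner-B y∈) (inner-B z∈) y≢z sy
          (subst (_∈ _) (─-comm c y) (X⊆ (attached y∈ y≢c))) zt
  ... | no y≢c | no z≢c = path₄ (inner-B y∈) (inner-B c∈) (inner-B z∈) y≢c y≢z (z≢c ∘ sym) sy
          (subst (_∈ _) (─-comm c y) (X⊆ (attached y∈ y≢c))) (X⊆ (attached z∈ z≢c)) zt

  -- The cases are those of `block`: with both spokes at `y` there is a path, with one of them the
  -- rest of the block lies on that side, and with none the block is one vertex smaller.
  upper-block : ∀ ys L X → Tight X ys → 𝔼 (spokes ys ++ L) fails X ≤ block a b (length ys) * 𝔼 L fails X
  upper-block [] L X _ = ≤-reflexive (sym (+-identityʳ _))
  upper-block (y ∷ ys) L X tight = begin
    a * (a * 𝔼 L′ fails (y ─ t ∷ s ─ y ∷ X) + b * 𝔼 L′ fails (s ─ y ∷ X))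
    + b * (a * 𝔼 L′ fails (y ─ t ∷ X) + b * 𝔼 L′ fails X)
      ≤⟨ +-mono-≤ (*-monoʳ-≤ a (+-mono-≤ (*-monoʳ-≤ a zero₁) (*-monoʳ-≤ b on-s)))
                  (*-monoʳ-≤ b (+-mono-≤ (*-monoʳ-≤ a on-t) (*-monoʳ-≤ b ih))) ⟩
    a * (a * 0 + b * (side ^ x * E)) + b * (a * (side ^ x * E) + b * (block a b x * E))
      ≡⟨ regroup a b (side ^ x) (block a b x) E ⟩
    block a b (suc x) * E ∎
    where
    L′ = spokes ys ++ L
    x = length ys
    E = 𝔼 L fails X
    regroup : ∀ a b p q e → a * (a * 0 + b * (p * e)) + b * (a * (p * e) + b * (q * e))
                          ≡ (a * (b * p) + b * (a * p + b * q)) * e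
    regroup = solve-∀
    ih : 𝔼 L′ fails X ≤ block a b x * E
    ih = upper-block ys L X (λ p q → tight (there p) (there q))
    zero₁ : 𝔼 L′ fails (y ─ t ∷ s ─ y ∷ X) ≤ 0
    zero₁ = ≤-reflexive (𝔼-fails-zero L′ (tight (here refl) (here refl) (there ∘ there) (there (here refl)) (here refl)))
    on-s : 𝔼 L′ fails (s ─ y ∷ X) ≤ side ^ x * E
    on-s = ≤-trans
      (upper-s ys L (s ─ y ∷ X) (λ z∈ X⊆ zt → tight (here refl) (there z∈) (X⊆ ∘ there) (X⊆ (here refl)) zt))
      (*-monoʳ-≤ (side ^ x) (𝔼-fails-anti L there))
    on-t : 𝔼 L′ fails (y ─ t ∷ X) ≤ side ^ x * E
    on-t = ≤-trans
      (upper-t ys L (y ─ t ∷ X) (λ z∈ X⊆ sz → tight (there z∈) (here refl) (X⊆ ∘ there) sz (X⊆ (here refl))))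
      (*-monoʳ-≤ (side ^ x) (𝔼-fails-anti L there))

  upper-blocks : ∀ bs X → All (Tight X) bs → 𝔼 (coreOf bs) fails X ≤ blocks a b bs * b
  upper-blocks [] X _ = begin
    a * fails (s ─ t ∷ X) + b * fails X
      ≤⟨ +-mono-≤ (*-monoʳ-≤ a (≤-reflexive (fails-yes {s ─ t ∷ X} (path₁ (here refl)))))
                  (*-monoʳ-≤ b (fails-≤ {X} λ _ → ≤-refl)) ⟩
    a * 0 + b * 1 ≡⟨ tidy a b ⟩
    1 * b ∎
    where
    tidy : ∀ a b → a * 0 + b * 1 ≡ 1 * b
    tidy = solve-∀
  upper-blocks (ys ∷ bs) X (tight ∷ tights) = begin
    𝔼 (spokes ys ++ coreOf bs) fails X ≤⟨ upper-block ys (coreOf bs) X tight ⟩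
    block a b (length ys) * 𝔼 (coreOf bs) fails X ≤⟨ *-monoʳ-≤ (block a b (length ys)) (upper-blocks bs X tights) ⟩
    block a b (length ys) * (blocks a b bs * b) ≡⟨ *-assoc (block a b (length ys)) _ b ⟨
    blocks a b (ys ∷ bs) * b ∎

  Constant : (Fin n → Bool) → List (Fin n) → Set
  Constant σ ys = ∀ {y z} → y ∈ ys → z ∈ ys → σ y ≡ σ z

  -- D holds of the vertices that meet terminal edges; the sides of the other
  -- vertices may be adjusted at the end so as not to cross X.
  module _ (D : Fin n → Set) where

    -- The invariant of the lower bound. `σ` is settled outside the pending blocks `bs`, and any
    -- choice of one side for each of these still leads to a cut that `X` does not cross.
    Safe : List (List (Fin n)) → (Fin n → Bool) → List (Edge n) → Set
    Safe bs σ X = ∀ σ′ → (∀ v → v ∉ concat bs → σ′ v ≡ σ v) → All (Constant σ′) bs →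
      ∃[ τ ] ((∀ v → D v → τ v ≡ σ′ v) × All (Uncrossed τ) X)

    record Sided (bs : List (List (Fin n))) (σ : Fin n → Bool) (X : List (Edge n)) : Set where
      field
        σs : σ s ≡ true
        σt : σ t ≡ false
        safe : Safe bs σ X

    paint : (Fin n → Bool) → List (Fin n) → Bool → Fin n → Bool
    paint σ ys c v = if ⌊ v ∈ⱽ? ys ⌋ then c else σ v

    paint-∈ : ∀ σ ys c {v} → v ∈ ys → paint σ ys c v ≡ c
    paint-∈ σ ys c {v} v∈ with v ∈ⱽ? ys
    ... | yes _ = refl
    ... | no v∉ = contradiction v∈ v∉

    paint-∉ : ∀ σ ys c {v} → v ∉ ys → paint σ ys c v ≡ σ v
    paint-∉ σ ys c {v} v∉ with v ∈ⱽ? ys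
    ... | yes v∈ = contradiction v∈ v∉
    ... | no _ = refl

    private
      Base : List (List (Fin n)) → List (Edge n) → ℕ → Set
      Base bs L Z = ∀ σ X → Sided bs σ X → Z ≤ 𝔼 L fails X

    module _ (Ds : D s) (Dt : D t) (bs : List (List (Fin n))) (s∉ : s ∉ concat bs) (t∉ : t ∉ concat bs)
             {L : List (Edge n)} {Z : ℕ} (base : Base bs L Z) where

      keep-s : ∀ {σ X y} → Sided bs σ X → σ y ≡ true → D y → y ∉ concat bs → Sided bs σ (s ─ y ∷ X)
      keep-s {σ} {X} {y} sd σy Dy y∉ = record { σs = σs ; σt = σt ; safe = safe′ }
        where
        open Sided sd
        safe′ : Safe bs σ (s ─ y ∷ X)
        safe′ σ′ agree const with safe σ′ agree const
        ... | τ , τ≡ , unc = τ , τ≡ , ─-uncrossed τ s y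
          (≡.trans (≡.trans (τ≡ s Ds) (≡.trans (agree s s∉) σs)) (sym (≡.trans (τ≡ y Dy) (≡.trans (agree y y∉) σy)))) ∷ unc

      keep-t : ∀ {σ X y} → Sided bs σ X → σ y ≡ false → D y → y ∉ concat bs → Sided bs σ (y ─ t ∷ X)
      keep-t {σ} {X} {y} sd σy Dy y∉ = record { σs = σs ; σt = σt ; safe = safe′ }
        where
        open Sided sd
        safe′ : Safe bs σ (y ─ t ∷ X)
        safe′ σ′ agree const with safe σ′ agree const
        ... | τ , τ≡ , unc = τ , τ≡ , ─-uncrossed τ y t
          (≡.trans (≡.trans (τ≡ y Dy) (≡.trans (agree y y∉) σy)) (sym (≡.trans (τ≡ t Dt) (≡.trans (agree t t∉) σt)))) ∷ unc

      lower-s : ∀ ys σ X → Sided bs σ X → All (λ y → σ y ≡ true × D y × y ∉ concat bs) ys →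
                side ^ length ys * Z ≤ 𝔼 (spokes ys ++ L) fails X
      lower-s [] σ X sd [] = ≤-trans (≤-reflexive (+-identityʳ Z)) (base σ X sd)
      lower-s (y ∷ ys) σ X sd ((σy , Dy , y∉) ∷ ps) = begin
        side * side ^ length ys * Z ≡⟨ *-assoc side _ Z ⟩
        side * (side ^ length ys * Z) ≡⟨ side-once a b _ ⟨
        a * (a * 0 + b * Z′) + b * (a * 0 + b * Z′)
          ≤⟨ +-mono-≤ (*-monoʳ-≤ a (+-mono-≤ (*-monoʳ-≤ a z≤n) (*-monoʳ-≤ b (lower-s ys σ _ (keep-s sd σy Dy y∉) ps))))
                      (*-monoʳ-≤ b (+-mono-≤ (*-monoʳ-≤ a z≤n) (*-monoʳ-≤ b (lower-s ys σ X sd ps)))) ⟩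
        𝔼 (spokes (y ∷ ys) ++ L) fails X ∎
        where Z′ = side ^ length ys * Z

      lower-t : ∀ ys σ X → Sided bs σ X → All (λ y → σ y ≡ false × D y × y ∉ concat bs) ys →
                side ^ length ys * Z ≤ 𝔼 (spokes ys ++ L) fails X
      lower-t [] σ X sd [] = ≤-trans (≤-reflexive (+-identityʳ Z)) (base σ X sd)
      lower-t (y ∷ ys) σ X sd ((σy , Dy , y∉) ∷ ps) = begin
        side * side ^ length ys * Z ≡⟨ *-assoc side _ Z ⟩
        side * (side ^ length ys * Z) ≡⟨ side-once′ a b _ ⟨
        a * 0 + b * (a * Z′ + b * Z′)
          ≤⟨ +-mono-≤ (*-monoʳ-≤ a z≤n)
                      (*-monoʳ-≤ b (+-mono-≤ (*-monoʳ-≤ a (lower-t ys σ _ (keep-t sd σy Dy y∉) ps))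
                                             (*-monoʳ-≤ b (lower-t ys σ X sd ps)))) ⟩
        𝔼 (spokes (y ∷ ys) ++ L) fails X ∎
        where Z′ = side ^ length ys * Z

      sided-paint : ∀ {w σ X} c → s ∉ w → t ∉ w → (∀ {v} → v ∈ w → v ∉ concat bs) →
                    Sided (w ∷ bs) σ X → Sided bs (paint σ w c) X
      sided-paint {w} {σ} {X} c s∉w t∉w disj sd = record
        { σs = ≡.trans (paint-∉ σ w c s∉w) σs
        ; σt = ≡.trans (paint-∉ σ w c t∉w) σt
        ; safe = λ σ′ agree const → safe σ′
            (λ v v∉ → ≡.trans (agree v (v∉ ∘ ∈-++⁺ʳ w)) (paint-∉ σ w c (v∉ ∘ ∈-++⁺ˡ)))
            ((λ y∈ z∈ → ≡.trans (painted σ′ agree y∈) (sym (painted σ′ agree z∈))) ∷ const)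
        }
        where
        open Sided sd
        painted : ∀ σ′ → (∀ v → v ∉ concat bs → σ′ v ≡ paint σ w c v) → ∀ {y} → y ∈ w → σ′ y ≡ c
        painted σ′ agree y∈ = ≡.trans (agree _ (disj y∈)) (paint-∈ σ w c y∈)

      -- The first retained spoke determines the side of the whole block `w`; `ys` are those of its
      -- vertices whose spokes are still undecided. States with both spokes at that vertex are
      -- counted as zero.
      lower-block : ∀ w ys σ X → ys ⊆ w → s ∉ w → t ∉ w → (∀ {v} → v ∈ w → D v × v ∉ concat bs) →
                    Sided (w ∷ bs) σ X → block a b (length ys) * Z ≤ 𝔼 (spokes ys ++ L) fails X
      -- No spoke was retained, so either side would do.
      lower-block w [] σ X _ s∉w t∉w disj sd = ≤-trans (≤-reflexive (+-identityʳ Z))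
        (base (paint σ w true) X (sided-paint true s∉w t∉w (proj₂ ∘ disj) sd))
      lower-block w (y ∷ ys) σ X ys⊆ s∉w t∉w disj sd = begin
        block a b (suc x) * Z
          ≡⟨ regroup a b (side ^ x) (block a b x) Z ⟩
        a * (a * 0 + b * (side ^ x * Z)) + b * (a * (side ^ x * Z) + b * (block a b x * Z))
          ≤⟨ +-mono-≤ (*-monoʳ-≤ a (+-mono-≤ (*-monoʳ-≤ a z≤n) (*-monoʳ-≤ b
                        (lower-s ys _ _ (keep-s (sdc true) (paint-∈ σ w true y∈) (proj₁ (disj y∈)) (proj₂ (disj y∈))) (coloured true)))))
                      (*-monoʳ-≤ b (+-mono-≤ (*-monoʳ-≤ a
                        (lower-t ys _ _ (keep-t (sdc false) (paint-∈ σ w false y∈) (proj₁ (disj y∈)) (proj₂ (disj y∈))) (coloured false)))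
                                             (*-monoʳ-≤ b (lower-block w ys σ X (ys⊆ ∘ there) s∉w t∉w disj sd)))) ⟩
        𝔼 (spokes (y ∷ ys) ++ L) fails X ∎
        where
        x = length ys
        y∈ = ys⊆ (here refl)
        sdc : ∀ c → Sided bs (paint σ w c) X
        sdc c = sided-paint c s∉w t∉w (proj₂ ∘ disj) sd
        coloured : ∀ c → All (λ y → paint σ w c y ≡ c × D y × y ∉ concat bs) ys
        coloured c = All.tabulate λ z∈ → paint-∈ σ w c (ys⊆ (there z∈))
          , proj₁ (disj (ys⊆ (there z∈))) , proj₂ (disj (ys⊆ (there z∈)))
        regroup : ∀ a b p q e → (a * (b * p) + b * (a * p + b * q)) * e
                              ≡ a * (a * 0 + b * (p * e)) + b * (a * (p * e) + b * (q * e))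
        regroup = solve-∀

    lower-blocks : D s → D t → ∀ bs → Unique (concat bs) → (∀ {v} → v ∈ concat bs → Inner v × D v) →
                   ∀ σ X → Sided bs σ X → blocks a b bs * b ≤ 𝔼 (coreOf bs) fails X
    lower-blocks Ds Dt [] _ _ σ X sd with Sided.safe sd σ (λ _ _ → refl) []
    ... | τ , τ≡ , unc = begin
      1 * b ≡⟨ *-comm 1 b ⟩
      b * 1 ≡⟨ cong (b *_) (fails-no {X} (cut τ (≡.trans (τ≡ s Ds) (Sided.σs sd)) (≡.trans (τ≡ t Dt) (Sided.σt sd)) unc)) ⟨
      b * fails X ≤⟨ m≤n+m _ _ ⟩
      𝔼 [ s ─ t ] fails X ∎
    lower-blocks Ds Dt (ys ∷ bs) uniq inn σ X sd = begin
      block a b (length ys) * blocks a b bs * b ≡⟨ *-assoc (block a b (length ys)) _ b ⟩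
      block a b (length ys) * (blocks a b bs * b)
        ≤⟨ lower-block Ds Dt bs (outer s (λ i → proj₁ i refl)) (outer t (λ i → proj₂ i refl))
             (lower-blocks Ds Dt bs (Unique-++⁻ʳ ys uniq) (inn ∘ ∈-++⁺ʳ ys))
             ys ys σ X id (λ s∈ → proj₁ (proj₁ (inn (∈-++⁺ˡ s∈))) refl) (λ t∈ → proj₂ (proj₁ (inn (∈-++⁺ˡ t∈))) refl)
             (λ v∈ → proj₂ (inn (∈-++⁺ˡ v∈)) , Unique-++-disjoint ys uniq v∈) sd ⟩
      𝔼 (spokes ys ++ coreOf bs) fails X ∎
      where
      outer : ∀ v → ¬ Inner v → v ∉ concat bs
      outer v ¬i v∈ = ¬i (proj₁ (inn (∈-++⁺ʳ ys v∈)))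

  𝔼-core-↭ : ∀ {us vs} X → us ↭ vs → 𝔼 (core us) fails X ≡ 𝔼 (core vs) fails X
  𝔼-core-↭ X p = 𝔼-↭ fails fails-↭ (core-↭ p) X

  -- Sides that are constant on the blocks are not crossed by `X`, so every vertex may be put into
  -- `D` and nothing is adjusted at the end. The blocks may be coarser than the components of `X`.
  lower-within : ∀ {us} → Unique us → All Inner us → ∀ bs X → concat bs ↭ us → All (Within bs) X →
                 blocks a b bs * b ≤ 𝔼 (core us) fails X
  lower-within {us} uniq inn bs X bs↭ within = begin
    blocks a b bs * b
      ≤⟨ lower-blocks (λ _ → ⊤) tt tt bs (Unique-resp-↭ (↭-sym bs↭) uniq)
           (λ v∈ → All.lookup inn (∈-resp-↭ bs↭ v∈) , tt) is-s X
           (record { σs = is-s-s ; σt = is-s-t ; safe = λ σ′ _ const → σ′ , (λ _ _ → refl) ,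
             All.map (λ (ys , ys∈ , p , q) → All.lookup const ys∈ p q) within }) ⟩
    𝔼 (coreOf bs) fails X
      ≡⟨ cong (λ L → 𝔼 L fails X) (coreOf≡core bs) ⟩
    𝔼 (core (concat bs)) fails X
      ≡⟨ 𝔼-core-↭ X bs↭ ⟩
    𝔼 (core us) fails X ∎

  upper-tight : ∀ {us} bs X → concat bs ↭ us → All (Tight X) bs → 𝔼 (core us) fails X ≤ blocks a b bs * b
  upper-tight {us} bs X bs↭ tight = begin
    𝔼 (core us) fails X          ≡⟨ 𝔼-core-↭ X bs↭ ⟨
    𝔼 (core (concat bs)) fails X ≡⟨ cong (λ L → 𝔼 L fails X) (coreOf≡core bs) ⟨
    𝔼 (coreOf bs) fails X        ≤⟨ upper-blocks bs X tight ⟩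
    blocks a b bs * b            ∎

-- Stars

-- At a = b = 1: the number of failing states of a star with x leaves attached
-- to the centre, k undecided ones and i detached vertices.
star : ℕ → ℕ → ℕ → ℕ
star zero x i = block 1 1 x * 3 ^ i
star (suc k) x i = star k (suc x) i + star k x (suc i)

block-closed : ∀ x → block 1 1 x + 1 ≡ 2 * 2 ^ x
block-closed zero = refl
block-closed (suc x) = begin-equality
  1 * (1 * 2 ^ x) + 1 * (1 * 2 ^ x + 1 * block 1 1 x) + 1 ≡⟨ regroup (2 ^ x) (block 1 1 x) ⟩
  2 * 2 ^ x + (block 1 1 x + 1)                           ≡⟨ cong (2 * 2 ^ x +_) (block-closed x) ⟩
  2 * 2 ^ x + 2 * 2 ^ x                                   ≡⟨ double (2 ^ x) ⟩
  2 * (2 * 2 ^ x)                                         ∎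
  where
  open ≤-Reasoning
  regroup : ∀ p q → 1 * (1 * p) + 1 * (1 * p + 1 * q) + 1 ≡ 2 * p + (q + 1)
  regroup = solve-∀
  double : ∀ p → 2 * p + 2 * p ≡ 2 * (2 * p)
  double = solve-∀

-- In `block 1 1 x * 3 ^ i`, which is 2 · 2^x · 3^i - 3^i, an undecided leaf multiplies the first
-- term by 2 or 3 and the second by 1 or 3; summing gives the factors 5 and 4.
star-closed : ∀ k x i → star k x i + 3 ^ i * 4 ^ k ≡ 2 * 2 ^ x * 3 ^ i * 5 ^ k
star-closed zero x i = begin-equality
  block 1 1 x * 3 ^ i + 3 ^ i * 1 ≡⟨ factor (block 1 1 x) (3 ^ i) ⟩
  (block 1 1 x + 1) * 3 ^ i * 1   ≡⟨ cong (λ z → z * 3 ^ i * 1) (block-closed x) ⟩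
  2 * 2 ^ x * 3 ^ i * 1           ∎
  where
  open ≤-Reasoning
  factor : ∀ p q → p * q + q * 1 ≡ (p + 1) * q * 1
  factor = solve-∀
star-closed (suc k) x i = begin-equality
  star k (suc x) i + star k x (suc i) + 3 ^ i * (4 * 4 ^ k)
    ≡⟨ regroup (star k (suc x) i) (star k x (suc i)) (3 ^ i) (4 ^ k) ⟩
  (star k (suc x) i + 3 ^ i * 4 ^ k) + (star k x (suc i) + 3 * 3 ^ i * 4 ^ k)
    ≡⟨ cong₂ _+_ (star-closed k (suc x) i) (star-closed k x (suc i)) ⟩
  2 * (2 * 2 ^ x) * 3 ^ i * 5 ^ k + 2 * 2 ^ x * (3 * 3 ^ i) * 5 ^ k
    ≡⟨ collect (2 ^ x) (3 ^ i) (5 ^ k) ⟩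
  2 * 2 ^ x * 3 ^ i * (5 * 5 ^ k) ∎
  where
  open ≤-Reasoning
  regroup : ∀ p q t f → p + q + t * (4 * f) ≡ (p + t * f) + (q + 3 * t * f)
  regroup = solve-∀
  collect : ∀ p t f → 2 * (2 * p) * t * f + 2 * p * (3 * t) * f ≡ 2 * p * t * (5 * f)
  collect = solve-∀

star-detached : ∀ k x i j → star k x (i + j) ≡ 3 ^ i * star k x j
star-detached zero x i j = begin-equality
  block 1 1 x * 3 ^ (i + j)       ≡⟨ cong (block 1 1 x *_) (^-distribˡ-+-* 3 i j) ⟩
  block 1 1 x * (3 ^ i * 3 ^ j)   ≡⟨ exchange (block 1 1 x) (3 ^ i) (3 ^ j) ⟩
  3 ^ i * (block 1 1 x * 3 ^ j)   ∎
  where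
  open ≤-Reasoning
  exchange : ∀ p q r → p * (q * r) ≡ q * (p * r)
  exchange = solve-∀
star-detached (suc k) x i j = ≡.trans
  (cong₂ _+_ (star-detached k (suc x) i j)
             (≡.trans (cong (star k x) (sym (+-suc i j))) (star-detached k x i (suc j))))
  (sym (*-distribˡ-+ (3 ^ i) _ _))

-- By `star-closed`, after division by 3^j, the claim is 11 · 4^(k+2) < 8 · 5^(k+2). It holds from
-- exponent 2 on, hence the form `2 + k`. Giving up one vertex with its two spokes pays for two more
-- leaves.
star-trade₁ : ∀ k j → star (4 + k) 1 j < star (2 + k) 1 (3 + j)
star-trade₁ k j = +-cancelʳ-< (16 * (T * Q) + 8 * (T * F)) _ _ (begin-strict
  star (4 + k) 1 j + (16 * (T * Q) + 8 * (T * F))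
    ≡⟨ +-assoc (star (4 + k) 1 j) (16 * (T * Q)) (8 * (T * F)) ⟨
  star (4 + k) 1 j + 16 * (T * Q) + 8 * (T * F)
    ≡⟨ cong (λ z → star (4 + k) 1 j + z + 8 * (T * F)) (e₁ T Q) ⟩
  star (4 + k) 1 j + T * (4 * (4 * Q)) + 8 * (T * F)
    ≡⟨ cong (_+ 8 * (T * F)) (star-closed (4 + k) 1 j) ⟩
  2 * 2 * T * (5 * (5 * F)) + 8 * (T * F)
    ≡⟨ e₂ T F ⟩
  2 * 2 * (27 * T) * F
    ≡⟨ cong (λ z → 2 * 2 * z * F) (^-distribˡ-+-* 3 3 j) ⟨
  2 * 2 * 3 ^ (3 + j) * F
    ≡⟨ star-closed (2 + k) 1 (3 + j) ⟨
  star (2 + k) 1 (3 + j) + 3 ^ (3 + j) * Q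
    ≡⟨ cong (λ z → star (2 + k) 1 (3 + j) + z * Q) (^-distribˡ-+-* 3 3 j) ⟩
  star (2 + k) 1 (3 + j) + 27 * T * Q
    ≡⟨ cong (star (2 + k) 1 (3 + j) +_) (e₃ T (4 ^ k)) ⟩
  star (2 + k) 1 (3 + j) + (16 * (T * Q) + 176 * (T * 4 ^ k))
    <⟨ +-monoʳ-< (star (2 + k) 1 (3 + j)) (+-monoʳ-< (16 * (T * Q)) (begin-strict
         176 * (T * 4 ^ k)  ≤⟨ *-monoʳ-≤ 176 (*-monoʳ-≤ T (^-monoˡ-≤ k (n≤1+n 4))) ⟩
         176 * (T * 5 ^ k)  <⟨ *-monoˡ-< (T * 5 ^ k) {{m*n≢0 T (5 ^ k) {{m^n≢0 3 j}} {{m^n≢0 5 k}}}} {176} {200} (m≤m+n 177 23) ⟩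
         200 * (T * 5 ^ k)  ≡⟨ e₄ T (5 ^ k) ⟩
         8 * (T * F)        ∎)) ⟩
  star (2 + k) 1 (3 + j) + (16 * (T * Q) + 8 * (T * F)) ∎)
  where
  open ≤-Reasoning
  T = 3 ^ j
  Q = 4 ^ (2 + k)
  F = 5 ^ (2 + k)
  e₁ : ∀ T Q → 16 * (T * Q) ≡ T * (4 * (4 * Q))
  e₁ = solve-∀
  e₂ : ∀ T F → 2 * 2 * T * (5 * (5 * F)) + 8 * (T * F) ≡ 2 * 2 * (27 * T) * F
  e₂ = solve-∀
  e₃ : ∀ T q → 27 * T * (4 * (4 * q)) ≡ 16 * (T * (4 * (4 * q))) + 176 * (T * q)
  e₃ = solve-∀
  e₄ : ∀ T f → 200 * (T * f) ≡ 8 * (T * (5 * (5 * f)))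
  e₄ = solve-∀

star-trade-at : ∀ {k k′ i} → star k′ 1 0 < star k 1 i → ∀ j → star k′ 1 j < star k 1 (j + i)
star-trade-at {k} {k′} {i} lt j = begin-strict
  star k′ 1 j        ≡⟨ cong (star k′ 1) (+-identityʳ j) ⟨
  star k′ 1 (j + 0)  ≡⟨ star-detached k′ 1 j 0 ⟩
  3 ^ j * star k′ 1 0 <⟨ *-monoʳ-< (3 ^ j) {{m^n≢0 3 j}} lt ⟩
  3 ^ j * star k 1 i ≡⟨ star-detached k 1 j i ⟨
  star k 1 (j + i)   ∎
  where open ≤-Reasoning

-- Starting from one leaf, a single trade loses, 436 against 432; two trades at once win, 11476
-- against 11664.
star-trade₂ : ∀ j → star 5 1 j < star 1 1 (j + 6)
star-trade₂ = star-trade-at {1} {5} (<ᵇ⇒< (star 5 1 0) (star 1 1 6) _)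

-- Starting from no leaf, two trades still lose, 2244 against 2187; three at once win, 58404 against
-- 59049.
star-trade₃ : ∀ j → star 6 1 j < star 0 1 (j + 9)
star-trade₃ = star-trade-at {0} {6} (<ᵇ⇒< (star 6 1 0) (star 0 1 9) _)

private
  -- Writing `2 ^ p` as `suc u` frees the weight 4 · 2^p - 1 from subtraction, so that comparisons
  -- become polynomial identities.
  Form : ℕ → Set
  Form p = ∃[ u ] (2 ^ p ≡ suc u × block 1 1 (suc p) ≡ 3 + 4 * u)

  block-form : ∀ p → Form p
  block-form p = u , 2^p , +-cancelʳ-≡ 1 _ _ (begin-equality
    block 1 1 (suc p) + 1  ≡⟨ block-closed (suc p) ⟩
    2 * (2 * 2 ^ p)        ≡⟨ cong (λ z → 2 * (2 * z)) 2^p ⟩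
    2 * (2 * suc u)        ≡⟨ expand u ⟩
    3 + 4 * u + 1          ∎)
    where
    open ≤-Reasoning
    u = 2 ^ p ∸ 1
    2^p : 2 ^ p ≡ suc u
    2^p = sym (m+[n∸m]≡n (m^n>0 2 p))
    expand : ∀ u → 2 * (2 * (1 + u)) ≡ 3 + 4 * u + 1
    expand = solve-∀

-- All but one vertex of a block move into the other one, and `3` is `block 1 1 1`. In terms of
-- `Form` the two sides differ by `4 * (u * v)`.
block-merge : ∀ p q → 3 * block 1 1 (suc (p + q)) ≤ block 1 1 (suc p) * block 1 1 (suc q)
block-merge p q = combine (block-form p) (block-form q) (block-form (p + q))
  where
  open ≤-Reasoning
  expand : ∀ u v → 3 * (3 + 4 * (u + v + u * v)) + 4 * (u * v) ≡ (3 + 4 * u) * (3 + 4 * v)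
  expand = solve-∀
  product′ : ∀ u v → (1 + u) * (1 + v) ≡ 1 + (u + v + u * v)
  product′ = solve-∀
  combine : Form p → Form q → Form (p + q) → 3 * block 1 1 (suc (p + q)) ≤ block 1 1 (suc p) * block 1 1 (suc q)
  combine (u , eu , bu) (v , ev , bv) (w , ew , bw) = begin
    3 * block 1 1 (suc (p + q))                     ≡⟨ cong (3 *_) bw ⟩
    3 * (3 + 4 * w)                                 ≡⟨ cong (λ z → 3 * (3 + 4 * z)) w≡ ⟩
    3 * (3 + 4 * (u + v + u * v))                   ≤⟨ m≤m+n _ (4 * (u * v)) ⟩
    3 * (3 + 4 * (u + v + u * v)) + 4 * (u * v)     ≡⟨ expand u v ⟩
    (3 + 4 * u) * (3 + 4 * v)                       ≡⟨ cong₂ _*_ bu bv ⟨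
    block 1 1 (suc p) * block 1 1 (suc q)           ∎
    where
    w≡ : w ≡ u + v + u * v
    w≡ = suc-injective (≡.trans (sym ew) (≡.trans (^-distribˡ-+-* 2 p q)
           (≡.trans (cong₂ _*_ eu ev) (product′ u v))))

block-join : ∀ p q → block 1 1 (suc p + suc q) ≤ block 1 1 (suc p) * block 1 1 (suc q)
block-join p q = ≤-trans (step (block-form (p + q)) (block-form (suc (p + q)))) (block-merge p q)
  where
  open ≤-Reasoning
  y = suc (p + q)
  double : ∀ u → 2 * (1 + u) ≡ 1 + (1 + 2 * u)
  double = solve-∀
  expand : ∀ u → 3 + 4 * (1 + 2 * u) + (2 + 4 * u) ≡ 3 * (3 + 4 * u)
  expand = solve-∀
  step : Form (p + q) → Form (suc (p + q)) → block 1 1 (suc p + suc q) ≤ 3 * block 1 1 y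
  step (u , eu , bu) (v , ev , bv) = begin
    block 1 1 (suc p + suc q)         ≡⟨ cong (λ z → block 1 1 (suc z)) (+-suc p q) ⟩
    block 1 1 (suc y)                 ≡⟨ bv ⟩
    3 + 4 * v                         ≡⟨ cong (λ z → 3 + 4 * z) v≡ ⟩
    3 + 4 * (1 + 2 * u)               ≤⟨ m≤m+n _ (2 + 4 * u) ⟩
    3 + 4 * (1 + 2 * u) + (2 + 4 * u) ≡⟨ expand u ⟩
    3 * (3 + 4 * u)                   ≡⟨ cong (3 *_) bu ⟨
    3 * block 1 1 y                   ∎
    where
    v≡ : v ≡ 1 + 2 * u
    v≡ = suc-injective (≡.trans (sym ev) (≡.trans (cong (2 *_) eu) (double u)))

NonEmpty : {A : Set} → List A → Set
NonEmpty ys = 1 ≤ length ys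

length-concat-≥ : ∀ {A : Set} (bs : List (List A)) → All NonEmpty bs → length bs ≤ length (concat bs)
length-concat-≥ [] [] = z≤n
length-concat-≥ (ys ∷ bs) (ne ∷ nes) =
  ≤-trans (+-mono-≤ ne (length-concat-≥ bs nes)) (≤-reflexive (sym (length-++ ys)))

-- `block-merge` shrinks one block after the other to a single vertex until there are `i`
-- singletons; the blocks that then remain are united by `block-join`.
blocks-≥-star : ∀ {A : Set} (bs : List (List A)) i x → All NonEmpty bs → suc i ≤ length bs →
                x + i ≡ length (concat bs) → star 0 x i ≤ blocks 1 1 bs
blocks-≥-star (ys ∷ []) zero x _ _ eq = ≤-reflexive (cong (λ z → block 1 1 z * 1)
  (≡.trans (≡.trans (sym (+-identityʳ x)) eq) (cong length (++-identityʳ ys))))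
blocks-≥-star (ys ∷ []) (suc i) x _ (s≤s ()) eq
blocks-≥-star ((y ∷ ys) ∷ bs@(zs ∷ bs′)) zero x (_ ∷ nes) _ eq = begin
  block 1 1 x * 1
    ≡⟨ cong (λ z → block 1 1 z * 1) (≡.trans (≡.trans (sym (+-identityʳ x)) eq) (length-++ (y ∷ ys))) ⟩
  block 1 1 (suc p + c) * 1
    ≡⟨ cong (λ z → block 1 1 (suc p + z) * 1) c≡ ⟩
  block 1 1 (suc p + suc q) * 1
    ≤⟨ *-monoˡ-≤ 1 (block-join p q) ⟩
  block 1 1 (suc p) * block 1 1 (suc q) * 1
    ≡⟨ cong (λ z → block 1 1 (suc p) * block 1 1 z * 1) c≡ ⟨
  block 1 1 (suc p) * block 1 1 c * 1
    ≡⟨ *-assoc (block 1 1 (suc p)) _ 1 ⟩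
  block 1 1 (suc p) * (block 1 1 c * 1)
    ≤⟨ *-monoʳ-≤ (block 1 1 (suc p)) (blocks-≥-star bs zero c nes (s≤s z≤n) (+-identityʳ c)) ⟩
  block 1 1 (suc p) * blocks 1 1 bs ∎
  where
  open ≤-Reasoning
  p = length ys
  c = length (concat bs)
  q = c ∸ 1
  c≡ : c ≡ suc q
  c≡ = sym (m+[n∸m]≡n (≤-trans (s≤s z≤n) (length-concat-≥ bs nes)))
blocks-≥-star ((y ∷ ys) ∷ bs) (suc i) x (_ ∷ nes) (s≤s i<) eq = begin
  block 1 1 x * (3 * 3 ^ i)
    ≡⟨ cong (λ z → block 1 1 z * (3 * 3 ^ i)) x≡ ⟩
  block 1 1 (suc (p + q)) * (3 * 3 ^ i)
    ≡⟨ exchange (block 1 1 (suc (p + q))) (3 ^ i) ⟩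
  3 * block 1 1 (suc (p + q)) * 3 ^ i
    ≤⟨ *-monoˡ-≤ (3 ^ i) (block-merge p q) ⟩
  block 1 1 (suc p) * block 1 1 (suc q) * 3 ^ i
    ≡⟨ *-assoc (block 1 1 (suc p)) _ (3 ^ i) ⟩
  block 1 1 (suc p) * star 0 (suc q) i
    ≤⟨ *-monoʳ-≤ (block 1 1 (suc p)) (blocks-≥-star bs i (suc q) nes i< (sym c≡)) ⟩
  block 1 1 (suc p) * blocks 1 1 bs ∎
  where
  open ≤-Reasoning
  p = length ys
  c = length (concat bs)
  q = c ∸ suc i
  c≡ : c ≡ suc q + i
  c≡ = ≡.trans (sym (m+[n∸m]≡n (≤-trans i< (length-concat-≥ bs nes)))) (cong suc (+-comm i q))
  x≡ : x ≡ suc (p + q)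
  x≡ = +-cancelʳ-≡ (suc i) x _ (begin-equality
    x + suc i ≡⟨ eq ⟩
    suc (length (ys ++ concat bs)) ≡⟨ cong suc (length-++ ys) ⟩
    suc (p + c) ≡⟨ cong (λ z → suc (p + z)) c≡ ⟩
    suc (p + (suc q + i)) ≡⟨ arith p q i ⟩
    suc (p + q) + suc i ∎)
    where
    arith : ∀ p q i → 1 + (p + (1 + q + i)) ≡ 1 + (p + q) + (1 + i)
    arith = solve-∀
  exchange : ∀ p t → p * (3 * t) ≡ 3 * p * t
  exchange = solve-∀

module _ {n : ℕ} where

  -- An edge unites at most two blocks; this bound on the loss is what `star-lower` relies on.
  merge : ∀ bs (e : Edge n) → All NonEmpty bs → proj₁ e ∈ concat bs → proj₂ e ∈ concat bs →
          ∃[ bs′ ] (concat bs′ ↭ concat bs × All NonEmpty bs′ × length bs ≤ suc (length bs′)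
                    × (∀ {f} → Within bs f → Within bs′ f) × Within bs′ e)
  merge bs e nes u∈ v∈ with ∈-concat⁻′ bs u∈ | ∈-concat⁻′ bs v∈
  ... | ys , u∈ys , ys∈ | zs , v∈zs , zs∈ with ∈⇒↭ ys∈
  ... | bs₁ , bs↭ with ∈-resp-↭ bs↭ zs∈
  ... | here refl = bs , refl , nes , n≤1+n _ , id , (ys , ys∈ , u∈ys , v∈zs)
  ... | there zs∈₁ with ∈⇒↭ zs∈₁
  ... | bs₂ , bs₁↭ = (ys ++ zs) ∷ bs₂ , concat↭ , nonempty , ≤-reflexive (↭-length all↭) , lift
                   , (ys ++ zs , here refl , ∈-++⁺ˡ u∈ys , ∈-++⁺ʳ ys v∈zs)
    where
    all↭ : bs ↭ ys ∷ zs ∷ bs₂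
    all↭ = ↭-trans bs↭ (prep ys bs₁↭)
    concat↭ : concat ((ys ++ zs) ∷ bs₂) ↭ concat bs
    concat↭ = ↭-trans (↭-reflexive (++-assoc ys zs (concat bs₂))) (concat-↭ (↭-sym all↭))
    nonempty : All NonEmpty ((ys ++ zs) ∷ bs₂)
    nonempty with All-resp-↭ all↭ nes
    ... | p ∷ _ ∷ ps = ≤-trans p (≤-trans (m≤m+n _ (length zs)) (≤-reflexive (sym (length-++ ys)))) ∷ ps
    lift : ∀ {f} → Within bs f → Within ((ys ++ zs) ∷ bs₂) f
    lift (ws , ws∈ , p , q) with ∈-resp-↭ all↭ ws∈
    ... | here refl = ys ++ zs , here refl , ∈-++⁺ˡ p , ∈-++⁺ˡ q
    ... | there (here refl) = ys ++ zs , here refl , ∈-++⁺ʳ ys p , ∈-++⁺ʳ ys q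
    ... | there (there ws∈′) = ws , there ws∈′ , p , q

module Stars {n : ℕ} (s t : Fin n) (s≢t : s ≢ t) (d : ℕ) (4≤d : 4 ≤ d) where
  open Spokes s t s≢t
  open Terminals s t s≢t d
  open Paths s t s≢t d 4≤d
  open Expectation {Edge n} 1 1
  open Blocks s t s≢t d 4≤d 1 1
  open ≤-Reasoning

  private
    1*-+ : ∀ x y → 1 * x + 1 * y ≡ x + y
    1*-+ = solve-∀

  module _ {us : List (Fin n)} (uniq : Unique us) (inn : All Inner us) where

    -- The number of blocks exceeds `i` plus the number of edges to come: a retained edge costs at
    -- most one block, and a dropped one is credited to `i`. At the end at least `i + 1` blocks
    -- remain, for which `blocks-≥-star` gives the final value of `star`.
    star-lower : ∀ F bs X k x i → length F ≡ k → All (λ e → proj₁ e ∈ us × proj₂ e ∈ us) F →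
                 concat bs ↭ us → All NonEmpty bs → i + suc k ≤ length bs → x + i + k ≡ length us →
                 All (Within bs) X → star k x i ≤ 𝔼 F (𝔼 (core us) fails) X
    star-lower [] bs X .zero x i refl _ bs↭ nes i< eq within = begin
      star 0 x i
        ≤⟨ blocks-≥-star bs i x nes (≤-trans (≤-reflexive (+-comm 1 i)) i<)
             (≡.trans (≡.trans (sym (+-identityʳ (x + i))) eq) (sym (↭-length bs↭))) ⟩
      blocks 1 1 bs
        ≡⟨ *-identityʳ _ ⟨
      blocks 1 1 bs * 1
        ≤⟨ lower-within uniq inn bs X bs↭ within ⟩
      𝔼 (core us) fails X ∎
    star-lower (e ∷ F) bs X (suc k) x i len ((p , q) ∷ ends) bs↭ nes i< eq within
      with merge bs e nes (∈-resp-↭ (↭-sym bs↭) p) (∈-resp-↭ (↭-sym bs↭) q)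
    ... | bs′ , bs′↭ , nes′ , shrink , lift , e-within = begin
      star k (suc x) i + star k x (suc i)
        ≤⟨ +-mono-≤
             (star-lower F bs′ (e ∷ X) k (suc x) i (suc-injective len) ends (↭-trans bs′↭ bs↭) nes′
               (s≤s⁻¹ (≤-trans (≤-trans (≤-reflexive (sym (+-suc i (suc k)))) i<) shrink))
               (≡.trans (sym (+-suc (x + i) k)) eq)
               (e-within ∷ All.map lift within))
             (star-lower F bs X k x (suc i) (suc-injective len) ends bs↭ nes
               (≤-trans (≤-reflexive (sym (+-suc i (suc k)))) i<)
               (≡.trans (arith x i k) eq) within) ⟩
      𝔼 F (𝔼 (core us) fails) (e ∷ X) + 𝔼 F (𝔼 (core us) fails) X
        ≡⟨ 1*-+ (𝔼 F (𝔼 (core us) fails) (e ∷ X)) (𝔼 F (𝔼 (core us) fails) X) ⟨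
      𝔼 (e ∷ F) (𝔼 (core us) fails) X ∎
      where
      arith : ∀ x i k → x + (1 + i) + k ≡ x + i + (1 + k)
      arith = solve-∀

    -- An extra edge that is not between common neighbours never helps: an end outside `D` can take
    -- the side of the other end, so both states of `f` contribute the full `3 ^ length us`.
    pendant-lower : ∀ f → Proper f → ¬ (proj₁ f ∈ us × proj₂ f ∈ us) → f ∉ core us →
                    2 * 3 ^ length us ≤ 𝔼 [ f ] (𝔼 (core us) fails) []
    pendant-lower f@(x , y) proper apart f∉ = begin
      2 * 3 ^ length us
        ≡⟨ cong (2 *_) (weight us) ⟨
      2 * (blocks 1 1 bs * 1)
        ≡⟨ double (blocks 1 1 bs * 1) ⟩
      1 * (blocks 1 1 bs * 1) + 1 * (blocks 1 1 bs * 1)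
        ≤⟨ +-mono-≤ (*-monoʳ-≤ 1 (bound [ f ] (record { σs = is-s-s ; σt = is-s-t ; safe = λ σ′ _ _ → adjust σ′ })))
                    (*-monoʳ-≤ 1 (bound [] (record { σs = is-s-s ; σt = is-s-t ; safe = λ σ′ _ _ → σ′ , (λ _ _ → refl) , [] }))) ⟩
      1 * 𝔼 (core us) fails [ f ] + 1 * 𝔼 (core us) fails [] ∎
      where
      bs = map [_] us
      double : ∀ z → 2 * z ≡ 1 * z + 1 * z
      double = solve-∀
      weight : ∀ (vs : List (Fin n)) → blocks 1 1 (map [_] vs) * 1 ≡ 3 ^ length vs
      weight vs = ≡.trans (*-identityʳ _) (go vs)
        where
        go : ∀ (vs : List (Fin n)) → blocks 1 1 (map [_] vs) ≡ 3 ^ length vs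
        go [] = refl
        go (_ ∷ vs) = cong (3 *_) (go vs)
      D : Fin n → Set
      D v = v ∈ s ∷ t ∷ us
      open import Data.List.Membership.DecPropositional (Fin._≟_ {n}) using () renaming (_∈?_ to _∈ⱽ?_)
      bound : ∀ X → Sided D bs is-s X → blocks 1 1 bs * 1 ≤ 𝔼 (core us) fails X
      bound X sd = begin
        blocks 1 1 bs * 1
          ≤⟨ lower-blocks D (here refl) (there (here refl)) bs (subst Unique (sym (concat-singletons us)) uniq)
               (λ v∈ → let v∈us = subst (_ ∈_) (concat-singletons us) v∈ in
                       All.lookup inn v∈us , there (there v∈us)) is-s X sd ⟩
        𝔼 (coreOf bs) fails X
          ≡⟨ cong (λ L → 𝔼 L fails X) (≡.trans (coreOf≡core bs) (cong core (concat-singletons us))) ⟩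
        𝔼 (core us) fails X ∎
      off-core : ¬ (D x × D y)
      off-core (here refl , here refl) = <-irrefl refl proper
      off-core (here refl , there (here refl)) = f∉ (subst (_∈ core us) (─-proper-≡ proper) (∈-++⁺ʳ (spokes us) (here refl)))
      off-core (here refl , there (there y∈)) = f∉ (subst (_∈ core us) (─-proper-≡ proper) (∈-++⁺ˡ (∈-spokes⁺ˢ y∈)))
      off-core (there (here refl) , here refl) = f∉ (subst (_∈ core us) (≡.trans (─-comm s t) (─-proper-≡ proper)) (∈-++⁺ʳ (spokes us) (here refl)))
      off-core (there (here refl) , there (here refl)) = <-irrefl refl proper
      off-core (there (here refl) , there (there y∈)) = f∉ (subst (_∈ core us) (≡.trans (─-comm y t) (─-proper-≡ proper)) (∈-++⁺ˡ (∈-spokes⁺ᵗ y∈)))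
      off-core (there (there x∈) , here refl) = f∉ (subst (_∈ core us) (≡.trans (─-comm s x) (─-proper-≡ proper)) (∈-++⁺ˡ (∈-spokes⁺ˢ x∈)))
      off-core (there (there x∈) , there (here refl)) = f∉ (subst (_∈ core us) (─-proper-≡ proper) (∈-++⁺ˡ (∈-spokes⁺ᵗ x∈)))
      off-core (there (there x∈) , there (there y∈)) = apart (x∈ , y∈)
      D? : ∀ v → Dec (D v)
      D? v = v ∈ⱽ? (s ∷ t ∷ us)
      adjust : ∀ σ′ → ∃[ τ ] ((∀ v → D v → τ v ≡ σ′ v) × All (Uncrossed τ) [ f ])
      adjust σ′ = τ , on , (same (D? x) (D? y) ∷ [])
        where
        -- The side of the end of `f` that lies in `D`, if there is one; all vertices outside `D`
        -- receive it.
        c = if ⌊ D? x ⌋ then σ′ x else σ′ y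
        τ : Fin n → Bool
        τ v = if ⌊ D? v ⌋ then σ′ v else c
        on : ∀ v → D v → τ v ≡ σ′ v
        on v Dv with D? v
        ... | yes _ = refl
        ... | no ¬Dv = contradiction Dv ¬Dv
        off : ∀ v → ¬ D v → τ v ≡ c
        off v ¬Dv with D? v
        ... | yes Dv = contradiction Dv ¬Dv
        ... | no _ = refl
        c-x : D x → c ≡ σ′ x
        c-x Dx with D? x
        ... | yes _ = refl
        ... | no ¬Dx = contradiction Dx ¬Dx
        c-y : ¬ D x → c ≡ σ′ y
        c-y ¬Dx with D? x
        ... | yes Dx = contradiction Dx ¬Dx
        ... | no _ = refl
        same : Dec (D x) → Dec (D y) → τ x ≡ τ y
        same (yes Dx) (yes Dy) = contradiction (Dx , Dy) off-core
        same (yes Dx) (no ¬Dy) = ≡.trans (on x Dx) (≡.trans (sym (c-x Dx)) (sym (off y ¬Dy)))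
        same (no ¬Dx) (yes Dy) = ≡.trans (off x ¬Dx) (≡.trans (c-y ¬Dx) (sym (on y Dy)))
        same (no ¬Dx) (no ¬Dy) = ≡.trans (off x ¬Dx) (sym (off y ¬Dy))

  -- `B` is the centre with the leaves attached so far and `I` the detached vertices, as in the
  -- recursion of `star`. A star is tight, hence a single block.
  star-upper : ∀ c ls B I X → c ∈ B → All Inner (B ++ ls ++ I) → (∀ {y} → y ∈ B → y ≢ c → c ─ y ∈ X) →
               𝔼 (map (c ─_) ls) (𝔼 (core (B ++ ls ++ I)) fails) X ≤ star (length ls) (length B) (length I)
  star-upper c [] B I X c∈ inn attached = begin
    𝔼 (core (B ++ I)) fails X
      ≡⟨ cong (λ L → 𝔼 L fails X) (≡.trans (cong (λ z → core (B ++ z)) (sym (concat-singletons I))) (sym (coreOf≡core (B ∷ map [_] I)))) ⟩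
    𝔼 (coreOf (B ∷ map [_] I)) fails X
      ≤⟨ upper-blocks (B ∷ map [_] I) X (tight ∷ All.map⁺ (All.map tight-single (All.++⁻ʳ B inn))) ⟩
    block 1 1 (length B) * blocks 1 1 (map [_] I) * 1
      ≡⟨ *-identityʳ _ ⟩
    block 1 1 (length B) * blocks 1 1 (map [_] I)
      ≡⟨ cong (block 1 1 (length B) *_) (weight I) ⟩
    block 1 1 (length B) * 3 ^ length I ∎
    where
    weight : ∀ (vs : List (Fin n)) → blocks 1 1 (map [_] vs) ≡ 3 ^ length vs
    weight [] = refl
    weight (_ ∷ vs) = cong (3 *_) (weight vs)
    inner-B : ∀ {y} → y ∈ B → Inner y
    inner-B y∈ = All.lookup inn (∈-++⁺ˡ y∈)
    tight : Tight X B
    tight = tight-star c∈ inner-B attached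
  star-upper c (l ∷ ls) B I X c∈ inn attached = begin
    1 * 𝔼 (map (c ─_) ls) (𝔼 (core us) fails) (c ─ l ∷ X) + 1 * 𝔼 (map (c ─_) ls) (𝔼 (core us) fails) X
      ≡⟨ 1*-+ (𝔼 (map (c ─_) ls) (𝔼 (core us) fails) (c ─ l ∷ X)) (𝔼 (map (c ─_) ls) (𝔼 (core us) fails) X) ⟩
    𝔼 (map (c ─_) ls) (𝔼 (core us) fails) (c ─ l ∷ X) + 𝔼 (map (c ─_) ls) (𝔼 (core us) fails) X
      ≤⟨ +-mono-≤ (𝔼-mono-all (map (c ─_) ls) (c ─ l ∷ X) (λ S → ≤-reflexive (𝔼-core-↭ S on)))
                  (𝔼-mono-all (map (c ─_) ls) X (λ S → ≤-reflexive (𝔼-core-↭ S off))) ⟩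
    𝔼 (map (c ─_) ls) (𝔼 (core (l ∷ B ++ ls ++ I)) fails) (c ─ l ∷ X)
    + 𝔼 (map (c ─_) ls) (𝔼 (core (B ++ ls ++ l ∷ I)) fails) X
      ≤⟨ +-mono-≤
           (star-upper c ls (l ∷ B) I (c ─ l ∷ X) (there c∈) (All-resp-↭ on inn)
             (λ { (here refl) _ → here refl ; (there y∈) y≢c → there (attached y∈ y≢c) }))
           (star-upper c ls B (l ∷ I) X c∈ (All-resp-↭ off inn) attached) ⟩
    star (length (l ∷ ls)) (length B) (length I) ∎
    where
    us = B ++ l ∷ ls ++ I
    on : us ↭ l ∷ B ++ ls ++ I
    on = shift l B (ls ++ I)
    off : us ↭ B ++ ls ++ l ∷ I
    off = ++⁺ˡ B (↭-sym (shift l ls I))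

  module _ (c : Fin n) (ls I : List (Fin n)) (uniq : Unique (c ∷ ls ++ I)) (inn : All Inner (c ∷ ls ++ I)) where

    fan : List (Edge n)
    fan = map (c ─_) ls ++ core (c ∷ ls ++ I)

    fan-simple : Simple fan
    fan-simple = ++-core-simple
      ( Unique.map⁺ inj (Unique-++⁻ˡ ls (AllPairs.tail uniq))
      , All.map⁺ (All.map (λ c≢l → ─-proper c≢l) (All.++⁻ˡ ls (AllPairs.head uniq))))
      (All.map⁺ (All.map (inner-edge (All.head inn)) (All.++⁻ˡ ls (All.tail inn)))) uniq inn
      where
      inj : ∀ {x y} → c ─ x ≡ c ─ y → x ≡ y
      inj eq with ─-injective eq
      ... | inj₁ (_ , q) = q
      ... | inj₂ (p , q) = ≡.trans q p

    length-fan : length fan ≡ length ls + (1 + 2 * suc (length ls + length I))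
    length-fan = ≡.trans (length-++ (map (c ─_) ls)) (cong₂ _+_ (length-map _ ls)
      (≡.trans (length-core (c ∷ ls ++ I)) (cong (λ z → 1 + 2 * suc z) (length-++ ls))))

    fan-upper : 𝔼 fan fails [] ≤ star (length ls) 1 (length I)
    fan-upper = ≤-trans (≤-reflexive (𝔼-++ (map (c ─_) ls) (core (c ∷ ls ++ I)) fails []))
      (star-upper c ls [ c ] I [] (here refl) inn (λ { (here refl) c≢c → contradiction refl c≢c }))

-- Sparse graphs

split-at : ∀ {A : Set} k (ws : List A) → k ≤ length ws → ∃[ xs ] ∃[ ys ] (ws ≡ xs ++ ys × length xs ≡ k)
split-at k ws k≤ = take k ws , drop k ws , sym (take++drop≡id k ws) , ≡.trans (length-take k ws) (m≤n⇒m⊓n≡m k≤)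

module Candidates {n : ℕ} (s t : Fin n) (s≢t : s ≢ t) (d : ℕ) where
  open Spokes s t s≢t

  -- An optimal edge list, sorted into the edges at the common neighbours of s
  -- and t and the remaining ones.
  record Candidate : Set where
    field
      common        : List (Fin n)
      F             : List (Edge n)
      common-unique : Unique common
      common-inner  : All Inner common
      simple        : Simple (F ++ core common)
      optimal       : Optimal s t s≢t d (F ++ core common)
      saturated     : length common < length inners → length F ≤ 1

  module _ (4≤d : 4 ≤ d) {es : List (Edge n)} (simple : Simple es) (optimal : Optimal s t s≢t d es)
           (3≤m : 3 ≤ length es) where
    open Extremal s t s≢t d 4≤d es simple optimal
    open Comparison s t s≢t d

    private
      rest : ∃[ F ] es ↭ F ++ core common
      rest with ⊆⇒↭ (proj₁ (core-simple common-unique common-inner)) core⊆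
        where
        core⊆ : core common ⊆ es
        core⊆ e∈ with ∈-++⁻ (spokes common) e∈
        ... | inj₂ (here refl) = joined (≤-trans (s≤s z≤n) 3≤m)
        ... | inj₁ e∈′ with ∈-spokes⁻ e∈′
        ... | u , u∈ , inj₁ refl = proj₁ (proj₂ (∈-filter⁻ common? {xs = inners} u∈))
        ... | u , u∈ , inj₂ refl = proj₂ (proj₂ (∈-filter⁻ common? {xs = inners} u∈))
      ... | F , es↭ = F , ↭-trans es↭ (++-comm (core common) F)

      -- Two spare edges would pay for another common neighbour, against `common-maximal`.
      saturated : ∀ F → es ↭ F ++ core common → length common < length inners → length F ≤ 1
      saturated F es↭ c<N with length F ≤? 1
      ... | yes le = le
      ... | no F≰ = contradiction (common-maximal c<N 3≤m (≤-trans (≤-trans (≤-reflexive (arith (length common)))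
                      (+-monoˡ-≤ (1 + 2 * length common) (≰⇒> F≰))) (≤-reflexive (sym length-es)))) (<⇒≱ (n<1+n _))
        where
        arith : ∀ c → 1 + 2 * (1 + c) ≡ 2 + (1 + 2 * c)
        arith = solve-∀
        length-es : length es ≡ length F + (1 + 2 * length common)
        length-es = ≡.trans (↭-length es↭) (≡.trans (length-++ F) (cong (length F +_) (length-core common)))

    candidate : Σ[ 𝒢 ∈ Candidate ] length (Candidate.F 𝒢 ++ core (Candidate.common 𝒢)) ≡ length es
    candidate = record
      { common = common
      ; F = proj₁ rest
      ; common-unique = common-unique
      ; common-inner = common-inner
      ; simple = Simple-resp-↭ (proj₂ rest) simple
      ; optimal = Optimal-resp-↭ (proj₂ rest) optimal
      ; saturated = saturated (proj₁ rest) (proj₂ rest)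
      } , sym (↭-length (proj₂ rest))

module Structure {n : ℕ} (s t : Fin n) (s≢t : s ≢ t) (d : ℕ) (𝒢 : Candidates.Candidate s t s≢t d) where
  open Spokes s t s≢t
  open Candidates.Candidate 𝒢

  private
    N = length inners

  es : List (Edge n)
  es = F ++ core common

  F-proper : All Proper F
  F-proper = All.++⁻ˡ F (proj₂ simple)

  F-unique : Unique F
  F-unique = Unique-++⁻ˡ F (proj₁ simple)

  F∉core : ∀ {e} → e ∈ F → e ∉ core common
  F∉core = Unique-++-disjoint F (proj₁ simple)

  length-es : length es ≡ length F + (1 + 2 * length common)
  length-es = ≡.trans (length-++ F) (cong (length F +_) (length-core common))

  common≤ : length common ≤ N
  common≤ = Unique-⊆-length common-unique (λ u∈ → ∈-inners⁺ (All.lookup common-inner u∈))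

  module Full (full : N ≤ length common) where

    inners⊆common : ∀ {u} → Inner u → u ∈ common
    inners⊆common i with ⊆⇒↭ common-unique (λ u∈ → ∈-inners⁺ (All.lookup common-inner u∈))
    ... | [] , p = subst (_ ∈_) (++-identityʳ common) (∈-resp-↭ p (∈-inners⁺ i))
    ... | z ∷ zs , p = contradiction full (<⇒≱ (≤-trans
          (≤-trans (≤-reflexive (+-comm 1 _)) (+-monoʳ-≤ (length common) (s≤s z≤n)))
          (≤-reflexive (sym (≡.trans (↭-length p) (length-++ common))))))

    -- All possible edges at s or t already belong to the core.
    F-inner : All InnerEdge F
    F-inner = All.tabulate λ {e} e∈ → go e (All.lookup F-proper e∈) (F∉core e∈)
      where
      go : ∀ e → Proper e → e ∉ core common → InnerEdge e
      go (x , y) proper e∉ with s Fin.≟ x | t Fin.≟ x | s Fin.≟ y | t Fin.≟ y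
      ... | yes refl | _ | yes refl | _ = contradiction proper (<-irrefl refl)
      ... | yes refl | _ | no _ | yes refl =
            contradiction (subst (_∈ core common) (─-proper-≡ proper) (∈-++⁺ʳ (spokes common) (here refl))) e∉
      ... | yes refl | _ | no s≢y | no t≢y =
            contradiction (subst (_∈ core common) (─-proper-≡ proper) (∈-++⁺ˡ (∈-spokes⁺ˢ (inners⊆common (s≢y , t≢y))))) e∉
      ... | no _ | yes refl | yes refl | _ =
            contradiction (subst (_∈ core common) (≡.trans (─-comm s t) (─-proper-≡ proper)) (∈-++⁺ʳ (spokes common) (here refl))) e∉
      ... | no _ | yes refl | no _ | yes refl = contradiction proper (<-irrefl refl)
      ... | no _ | yes refl | no s≢y | no t≢y =
            contradiction (subst (_∈ core common) (≡.trans (─-comm y t) (─-proper-≡ proper)) (∈-++⁺ˡ (∈-spokes⁺ᵗ (inners⊆common (s≢y , t≢y))))) e∉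
      ... | no s≢x | no t≢x | yes refl | _ =
            contradiction (subst (_∈ core common) (≡.trans (─-comm s x) (─-proper-≡ proper)) (∈-++⁺ˡ (∈-spokes⁺ˢ (inners⊆common (s≢x , t≢x))))) e∉
      ... | no s≢x | no t≢x | no _ | yes refl =
            contradiction (subst (_∈ core common) (─-proper-≡ proper) (∈-++⁺ˡ (∈-spokes⁺ᵗ (inners⊆common (s≢x , t≢x))))) e∉
      ... | no s≢x | no t≢x | no s≢y | no t≢y = (s≢x , t≢x) , (s≢y , t≢y)

    common↭inners : common ↭ inners
    common↭inners = Unique-set⇒↭ inners-unique common-unique (λ u∈ → inners⊆common (∈-inners⁻ u∈))
                      (λ u∈ → ∈-inners⁺ (All.lookup common-inner u∈))

module Sparse {n : ℕ} (s t : Fin n) (s≢t : s ≢ t) (d : ℕ) (4≤d : 4 ≤ d) (𝒢 : Candidates.Candidate s t s≢t d) where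
  open Spokes s t s≢t
  open Terminals s t s≢t d
  open Comparison s t s≢t d
  open Candidates.Candidate 𝒢
  open Structure s t s≢t d 𝒢
  open Stars s t s≢t d 4≤d
  open Expectation {Edge n} 1 1
  open ≤-Reasoning

  private
    m = length es
    N = length inners
    c = length common
    U = 𝔼 es fails []

    U≡ : U ≡ 𝔼 F (𝔼 (core common) fails) []
    U≡ = 𝔼-++ F (core common) fails []

    all-inside : All (λ e → proj₁ e ∈ common × proj₂ e ∈ common) F → ∀ k i → length F ≡ k → 1 + i + k ≡ c →
                 star k 1 i ≤ U
    all-inside ends k i len eq = ≤-trans
      (star-lower common-unique common-inner F (map [_] common) [] k 1 i len ends
        (↭-reflexive (concat-singletons common)) (All.map⁺ (All.universal (λ _ → s≤s z≤n) common))
        (≤-reflexive (≡.trans (+-suc i k) (≡.trans eq (sym (length-map [_] common)))))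
        eq [])
      (≤-reflexive (sym U≡))

    fan-beats : ∀ k j → 1 + k + j ≤ N → k + (1 + 2 * suc (k + j)) ≡ m → U ≤ star k 1 j
    fan-beats k j le len with split-at (suc k + j) inners le
    ... | xs , ys , inners≡ , |xs| with split-at (suc k) xs (≤-trans (m≤m+n (suc k) j) (≤-reflexive (sym |xs|)))
    ... | v ∷ ls , I , refl , |ls| = ≤-trans
      (optimal-fails 1 1 {es} optimal (fan-simple v ls I uniq inn) (≡.trans (length-fan v ls I uniq inn) len′) (s≤s z≤n))
      (≤-trans (fan-upper v ls I uniq inn) (≤-reflexive (cong₂ (λ x y → star x 1 y) |ls|′ |I|)))
      where
      uniq : Unique (v ∷ ls ++ I)
      uniq = Unique-++⁻ˡ (v ∷ ls ++ I) (subst Unique inners≡ inners-unique)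
      inn : All Inner (v ∷ ls ++ I)
      inn = All.tabulate λ u∈ → ∈-inners⁻ (subst (_ ∈_) (sym inners≡) (∈-++⁺ˡ u∈))
      |ls|′ : length ls ≡ k
      |ls|′ = suc-injective |ls|
      |I| : length I ≡ j
      |I| = +-cancelˡ-≡ (suc k) _ _ (≡.trans (cong (_+ length I) (sym |ls|))
              (≡.trans (sym (length-++ (v ∷ ls))) |xs|))
      len′ : length ls + (1 + 2 * suc (length ls + length I)) ≡ m
      len′ = ≡.trans (cong₂ (λ x y → x + (1 + 2 * suc (x + y))) |ls|′ |I|) len

    worse : ∀ {k′ j k i} → star k′ 1 j < star k 1 i → U ≤ star k′ 1 j → star k 1 i ≤ U → ⊥
    worse lt upper lower = <-irrefl refl (<-≤-trans lt (≤-trans lower upper))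

  sparse : 20 ≤ m → m + 3 ≤ 3 * N → ⊥
  sparse 20≤m m≤ = go F refl
    where
    go : ∀ F′ → F ≡ F′ → ⊥
    -- Here m is odd, hence m ≥ 21 and c ≥ 10. Three common neighbours are given up for six leaves.
    go [] F≡ = worse {6} {j} {0} {j + 9} (star-trade₃ j)
      (fan-beats 6 j (≤-trans (m≤n+m (7 + j) 3) (≤-trans (≤-reflexive c≡) common≤)) (≡.trans (arith₁ j) (sym m≡)))
      (all-inside (subst (All _) (sym F≡) []) 0 (j + 9) (cong length F≡) (≡.trans (arith₂ j) c≡))
      where
      m≡c : m ≡ 1 + 2 * c
      m≡c = ≡.trans length-es (cong (λ z → length z + (1 + 2 * c)) F≡)
      j = c ∸ 10
      c≡ : 10 + j ≡ c
      c≡ = m+[n∸m]≡n (*-cancelˡ-< 2 9 c (s≤s⁻¹ (≤-trans 20≤m (≤-reflexive m≡c))))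
      m≡ : m ≡ 1 + 2 * (10 + j)
      m≡ = ≡.trans m≡c (cong (λ z → 1 + 2 * z) (sym c≡))
      arith₁ : ∀ j → 6 + (1 + 2 * (1 + (6 + j))) ≡ 1 + 2 * (10 + j)
      arith₁ = solve-∀
      arith₂ : ∀ j → 1 + (j + 9) + 0 ≡ 10 + j
      arith₂ = solve-∀
    -- Two common neighbours are given up for four more leaves. If `f` is not between common
    -- neighbours, the same bound follows from `pendant-lower`, since 2 · 3^8 = 13122 exceeds 11664.
    go (f ∷ []) F≡ = worse {5} {j} {1} {j + 6} (star-trade₂ j)
      (fan-beats 5 j (≤-trans (m≤n+m (6 + j) 2) (≤-trans (≤-reflexive c≡) common≤)) (≡.trans (arith₁ j) (sym m≡)))
      lower
      where
      m≡c : m ≡ 2 + 2 * c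
      m≡c = ≡.trans length-es (cong (λ z → length z + (1 + 2 * c)) F≡)
      j = c ∸ 8
      c≡ : 8 + j ≡ c
      c≡ = m+[n∸m]≡n (≤-trans (n≤1+n 8) (*-cancelˡ-≤ 2 (s≤s⁻¹ (s≤s⁻¹ (≤-trans 20≤m (≤-reflexive m≡c))))))
      m≡ : m ≡ 2 + 2 * (8 + j)
      m≡ = ≡.trans m≡c (cong (λ z → 2 + 2 * z) (sym c≡))
      arith₁ : ∀ j → 5 + (1 + 2 * (1 + (5 + j))) ≡ 2 + 2 * (8 + j)
      arith₁ = solve-∀
      arith₂ : ∀ j → 1 + (j + 6) + 1 ≡ 8 + j
      arith₂ = solve-∀
      f∈ : f ∈ F
      f∈ = subst (f ∈_) (sym F≡) (here refl)
      open import Data.List.Membership.DecPropositional (Fin._≟_ {n}) using () renaming (_∈?_ to _∈ⱽ?_)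
      lower : star 1 1 (j + 6) ≤ U
      lower with (proj₁ f ∈ⱽ? common) ×-dec (proj₂ f ∈ⱽ? common)
      ... | yes (p , q) = all-inside (subst (All _) (sym F≡) ((p , q) ∷ [])) 1 (j + 6) (cong length F≡)
                            (≡.trans (arith₂ j) c≡)
      ... | no apart = begin
        star 1 1 (j + 6)    ≡⟨ star-detached 1 1 j 6 ⟩
        3 ^ j * 11664       ≤⟨ *-monoʳ-≤ (3 ^ j) (m≤m+n 11664 1458) ⟩
        3 ^ j * (2 * 3 ^ 8) ≡⟨ exchange (3 ^ j) (3 ^ 8) ⟩
        2 * (3 ^ 8 * 3 ^ j) ≡⟨ cong (2 *_) (^-distribˡ-+-* 3 8 j) ⟨
        2 * 3 ^ (8 + j)     ≡⟨ cong (λ z → 2 * 3 ^ z) c≡ ⟩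
        2 * 3 ^ c
          ≤⟨ pendant-lower common-unique common-inner f (All.lookup F-proper f∈) apart (F∉core f∈) ⟩
        𝔼 [ f ] (𝔼 (core common) fails) []
          ≡⟨ cong (λ z → 𝔼 z (𝔼 (core common) fails) []) F≡ ⟨
        𝔼 F (𝔼 (core common) fails) []
          ≡⟨ U≡ ⟨
        U ∎
        where
        exchange : ∀ p q → p * (2 * q) ≡ 2 * (q * p)
        exchange = solve-∀
    -- Two or more further edges force all inner vertices to be common neighbours, and m + 3 ≤ 3N
    -- leaves three of them detached from the star; one common neighbour is given up for two leaves.
    go (f ∷ f′ ∷ G) F≡ with N ≤? c
    ... | no N≰c = contradiction (≤-trans (≤-reflexive (cong length (sym F≡))) (saturated (≰⇒> N≰c)))
                     (λ { (s≤s ()) })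
    ... | yes N≤c = worse {4 + k} {j} {2 + k} {3 + j} (star-trade₁ k j)
      (fan-beats (4 + k) j (≤-trans (n≤1+n _) (≤-trans (≤-reflexive c≡) common≤)) (≡.trans (arith₁ k j) (sym m≡)))
      (all-inside ends (2 + k) (3 + j) (cong length F≡) (≡.trans (arith₂ k j) c≡))
      where
      open Full N≤c
      k = length G
      m≡c : m ≡ 2 + k + (1 + 2 * c)
      m≡c = ≡.trans length-es (cong (λ z → length z + (1 + 2 * c)) F≡)
      6+k≤c : 6 + k ≤ c
      6+k≤c = +-cancelʳ-≤ (2 * c) (6 + k) c (≤-trans (≤-reflexive (arith₀ k c))
        (≤-trans (+-monoˡ-≤ 3 (≤-reflexive (sym m≡c))) (≤-trans m≤ (≤-trans (*-monoʳ-≤ 3 N≤c) (≤-reflexive (three c))))))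
        where
        arith₀ : ∀ k c → 6 + k + 2 * c ≡ 2 + k + (1 + 2 * c) + 3
        arith₀ = solve-∀
        three : ∀ c → 3 * c ≡ c + 2 * c
        three = solve-∀
      j = c ∸ (6 + k)
      c≡ : 6 + k + j ≡ c
      c≡ = m+[n∸m]≡n 6+k≤c
      m≡ : m ≡ 2 + k + (1 + 2 * (6 + k + j))
      m≡ = ≡.trans m≡c (cong (λ z → 2 + k + (1 + 2 * z)) (sym c≡))
      arith₁ : ∀ k j → 4 + k + (1 + 2 * (1 + (4 + k + j))) ≡ 2 + k + (1 + 2 * (6 + k + j))
      arith₁ = solve-∀
      arith₂ : ∀ k j → 1 + (3 + j) + (2 + k) ≡ 6 + k + j
      arith₂ = solve-∀
      ends : All (λ e → proj₁ e ∈ common × proj₂ e ∈ common) F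
      ends = All.map (λ (p , q) → inners⊆common p , inners⊆common q) F-inner

-- Mixed connectivity

count-map : ∀ {A B : Set} (φ : B → Bool) (f : A → B) xs → count φ (map f xs) ≡ count (φ ∘ f) xs
count-map φ f [] = refl
count-map φ f (x ∷ xs) = cong ((if φ (f x) then 1 else 0) +_) (count-map φ f xs)

count-cong : ∀ {A : Set} {φ ψ : A → Bool} xs → (∀ {x} → x ∈ xs → φ x ≡ ψ x) → count φ xs ≡ count ψ xs
count-cong [] _ = refl
count-cong (x ∷ xs) eq = cong₂ _+_ (cong (λ z → if z then 1 else 0) (eq (here refl))) (count-cong xs (eq ∘ there))

∈⇒1≤count : ∀ {A : Set} (φ : A → Bool) {x xs} → x ∈ xs → φ x ≡ true → 1 ≤ count φ xs
∈⇒1≤count φ {x} (here refl) eq rewrite eq = s≤s z≤n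
∈⇒1≤count φ {xs = y ∷ _} (there x∈) eq = ≤-trans (∈⇒1≤count φ x∈ eq) (m≤n+m _ (if φ y then 1 else 0))

-- The parts of a vertex set: two sides to be separated, and removed vertices.
data Part : Set where
  left right off : Part

isLeft isRight isOff : Part → Bool
isLeft left = true
isLeft _ = false
isRight right = true
isRight _ = false
isOff off = true
isOff _ = false

opposite : Part → Part → Bool
opposite left right = true
opposite right left = true
opposite _ _ = false

flip : Part → Part
flip left = right
flip right = left
flip off = off

opposite-comm : ∀ p q → opposite p q ≡ opposite q p
opposite-comm left left = refl
opposite-comm left right = refl
opposite-comm left off = refl
opposite-comm right left = refl
opposite-comm right right = refl
opposite-comm right off = refl
opposite-comm off left = refl
opposite-comm off right = refl
opposite-comm off off = refl

opposite-flip : ∀ p q → opposite (flip p) (flip q) ≡ opposite p q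
opposite-flip left left = refl
opposite-flip left right = refl
opposite-flip left off = refl
opposite-flip right left = refl
opposite-flip right right = refl
opposite-flip right off = refl
opposite-flip off left = refl
opposite-flip off right = refl
opposite-flip off off = refl

module _ {n : ℕ} where

  open ≤-Reasoning

  crosses : (Fin n → Part) → Edge n → Bool
  crosses p e = opposite (p (proj₁ e)) (p (proj₂ e))

  crosses-─ : ∀ p u v → crosses p (u ─ v) ≡ opposite (p u) (p v)
  crosses-─ p u v with u Fin.<? v
  ... | yes _ = refl
  ... | no _ = opposite-comm (p v) (p u)

  lefts rights offs : (Fin n → Part) → List (Fin n) → ℕ
  lefts p = count (isLeft ∘ p)
  rights p = count (isRight ∘ p)
  offs p = count (isOff ∘ p)

  cost : (Fin n → Part) → List (Fin n) → List (Edge n) → ℕ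
  cost p vs es = offs p vs + count (crosses p) es

  private
    isLeft-flip : ∀ q → isLeft (flip q) ≡ isRight q
    isLeft-flip left = refl
    isLeft-flip right = refl
    isLeft-flip off = refl

    isRight-flip : ∀ q → isRight (flip q) ≡ isLeft q
    isRight-flip left = refl
    isRight-flip right = refl
    isRight-flip off = refl

    isOff-flip : ∀ q → isOff (flip q) ≡ isOff q
    isOff-flip left = refl
    isOff-flip right = refl
    isOff-flip off = refl

  lefts-flip : ∀ p vs → lefts (flip ∘ p) vs ≡ rights p vs
  lefts-flip p vs = count-cong vs (λ {v} _ → isLeft-flip (p v))

  rights-flip : ∀ p vs → rights (flip ∘ p) vs ≡ lefts p vs
  rights-flip p vs = count-cong vs (λ {v} _ → isRight-flip (p v))

  cost-flip : ∀ p vs es → cost (flip ∘ p) vs es ≡ cost p vs es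
  cost-flip p vs es = cong₂ _+_ (count-cong vs (λ {v} _ → isOff-flip (p v)))
    (count-cong es (λ {e} _ → opposite-flip (p (proj₁ e)) (p (proj₂ e))))

  parts : ∀ p vs → lefts p vs + rights p vs + offs p vs ≡ length vs
  parts p [] = refl
  parts p (v ∷ vs) with p v
  ... | left = cong suc (parts p vs)
  ... | right = ≡.trans (cong (_+ offs p vs) (+-suc (lefts p vs) (rights p vs))) (cong suc (parts p vs))
  ... | off = ≡.trans (+-suc (lefts p vs + rights p vs) (offs p vs)) (cong suc (parts p vs))

  -- No deletion of fewer than r vertices and edges separates two vertices.
  Connected : ℕ → List (Fin n) → List (Edge n) → Set
  Connected r vs es = ∀ p → 1 ≤ lefts p vs → 1 ≤ rights p vs → r ≤ cost p vs es

  hub : Fin n → List (Fin n) → List (Edge n)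
  hub u vs = map (u ─_) vs

  private
    hub-crosses : ∀ p u vs → count (crosses p) (hub u vs) ≡ count (opposite (p u) ∘ p) vs
    hub-crosses p u vs = ≡.trans (count-map (crosses p) (u ─_) vs) (count-cong vs (λ {v} _ → crosses-─ p u v))

  hub-left : ∀ p u vs → p u ≡ left → count (crosses p) (hub u vs) ≡ rights p vs
  hub-left p u vs eq = ≡.trans (hub-crosses p u vs) (count-cong vs (λ {v} _ → ≡.trans (cong (λ q → opposite q (p v)) eq) (go (p v))))
    where
    go : ∀ q → opposite left q ≡ isRight q
    go left = refl
    go right = refl
    go off = refl

  hub-right : ∀ p u vs → p u ≡ right → count (crosses p) (hub u vs) ≡ lefts p vs
  hub-right p u vs eq = ≡.trans (hub-crosses p u vs) (count-cong vs (λ {v} _ → ≡.trans (cong (λ q → opposite q (p v)) eq) (go (p v))))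
    where
    go : ∀ q → opposite right q ≡ isLeft q
    go left = refl
    go right = refl
    go off = refl

  private
    Half : ℕ → Fin n → List (Fin n) → List (Edge n) → Set
    Half r u vs es = ∀ p → p u ≢ right → 1 ≤ lefts p vs → 1 ≤ rights p vs → r ≤ cost p vs es

    -- The two sides may be exchanged, so that `u` is never `right`.
    by-symmetry : ∀ {r u vs es} → Half r u vs es → Connected r vs es
    by-symmetry {r} {u} {vs} {es} half p l≥ r≥ with p u in eq
    ... | left = half p (λ e → case (≡.trans (sym eq) e)) l≥ r≥
      where
      case : left ≢ right
      case ()
    ... | off = half p (λ e → case (≡.trans (sym eq) e)) l≥ r≥
      where
      case : off ≢ right
      case ()
    ... | right = subst (r ≤_) (cost-flip p vs es)
      (half (flip ∘ p) (λ e → case (≡.trans (sym (cong flip eq)) e))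
        (subst (1 ≤_) (sym (lefts-flip p vs)) r≥) (subst (1 ≤_) (sym (rights-flip p vs)) l≥))
      where
      case : left ≢ right
      case ()

    none-or-some : ∀ k → k ≡ 0 ⊎ 1 ≤ k
    none-or-some zero = inj₁ refl
    none-or-some (suc k) = inj₂ (s≤s z≤n)

    no-lefts : ∀ p vs → lefts p vs ≡ 0 → rights p vs + offs p vs ≡ length vs
    no-lefts p vs eq = subst (λ z → z + rights p vs + offs p vs ≡ length vs) eq (parts p vs)

    no-rights : ∀ p vs → rights p vs ≡ 0 → lefts p vs + offs p vs ≡ length vs
    no-rights p vs eq = ≡.trans (cong (_+ offs p vs) (sym (+-identityʳ (lefts p vs))))
      (subst (λ z → lefts p vs + z + offs p vs ≡ length vs) eq (parts p vs))

  -- If u is removed, this costs one on top of `r`. Otherwise each vertex on the other side gives a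
  -- crossing edge at u; and if no vertex of `vs` shares the side of u, all of `vs` is crossed or
  -- removed, which costs `length vs`.
  join-connected : ∀ {r u vs es} → Connected r vs es → suc r ≤ length vs → Connected (suc r) (u ∷ vs) (hub u vs ++ es)
  join-connected {r} {u} {vs} {es} conn r< = by-symmetry {u = u} {u ∷ vs} {hub u vs ++ es} half
    where
    half : Half (suc r) u (u ∷ vs) (hub u vs ++ es)
    half p ≢right l≥ r≥ rewrite count-++ (crosses p) (hub u vs) es with p u in eq
    ... | right = contradiction refl ≢right
    ... | off = s≤s (≤-trans (conn p l≥ r≥) (+-monoʳ-≤ (offs p vs) (m≤n+m _ _)))
    ... | left rewrite hub-left p u vs eq with none-or-some (lefts p vs)
    ... | inj₁ none = begin
      suc r                           ≤⟨ r< ⟩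
      length vs                       ≡⟨ no-lefts p vs none ⟨
      rights p vs + offs p vs         ≡⟨ +-comm (rights p vs) _ ⟩
      offs p vs + rights p vs         ≤⟨ +-monoʳ-≤ (offs p vs) (m≤m+n _ _) ⟩
      offs p vs + (rights p vs + count (crosses p) es) ∎
    ... | inj₂ some = begin
      1 + r                                            ≤⟨ +-mono-≤ r≥ (conn p some r≥) ⟩
      rights p vs + (offs p vs + count (crosses p) es) ≡⟨ exchange (rights p vs) (offs p vs) _ ⟩
      offs p vs + (rights p vs + count (crosses p) es) ∎
      where
      exchange : ∀ a b c → a + (b + c) ≡ b + (a + c)
      exchange = solve-∀

  chain : Fin n → List (Fin n) → Fin n → List (Edge n)
  chain u [] w = [ u ─ w ]
  chain u (v ∷ vs) w = u ─ v ∷ chain v vs w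

  private
    crossing-edge : ∀ p u v {k} → opposite (p u) (p v) ≡ true → 1 ≤ (if crosses p (u ─ v) then 1 else 0) + k
    crossing-edge p u v eq rewrite crosses-─ p u v | eq = s≤s z≤n

    skip : ∀ {r} a b c → r ≤ a + c → r ≤ a + (b + c)
    skip a b c le = ≤-trans le (+-monoʳ-≤ a (m≤n+m c b))

    chain₁ : ∀ p u vs w → opposite (p u) (p w) ≡ true → 1 ≤ cost p vs (chain u vs w)
    chain₁ p u [] w opp = crossing-edge p u w opp
    chain₁ p u (v ∷ vs) w opp with p v in eq
    ... | off = s≤s z≤n
    ... | left with p u in equ
    ... | left = skip (offs p vs) _ _ (chain₁ p v vs w (subst (λ q → opposite q (p w) ≡ true) (sym eq) opp))
    ... | right = ≤-trans (crossing-edge p u v (≡.trans (cong₂ opposite equ eq) refl)) (m≤n+m _ (offs p vs))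
    chain₁ p u (v ∷ vs) w opp | right with p u in equ
    ... | right = skip (offs p vs) _ _ (chain₁ p v vs w (subst (λ q → opposite q (p w) ≡ true) (sym eq) opp))
    ... | left = ≤-trans (crossing-edge p u v (≡.trans (cong₂ opposite equ eq) refl)) (m≤n+m _ (offs p vs))

    chain-end : ∀ p u vs w → p w ≡ left → 1 ≤ rights p vs → 1 ≤ cost p vs (chain u vs w)
    chain-end p u (v ∷ vs) w pw r≥ with p v in eq
    ... | off = s≤s z≤n
    ... | left = skip (offs p vs) _ _ (chain-end p v vs w pw r≥)
    ... | right = skip (offs p vs) _ _ (chain₁ p v vs w (cong₂ opposite eq pw))

    chain-start : ∀ p u vs w → p u ≡ left → 1 ≤ rights p vs → 1 ≤ cost p vs (chain u vs w)
    chain-start p u (v ∷ vs) w pu r≥ with p v in eq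
    ... | off = s≤s z≤n
    ... | left = skip (offs p vs) _ _ (chain-start p v vs w eq r≥)
    ... | right = ≤-trans (crossing-edge p u v (cong₂ opposite pu eq)) (m≤n+m _ (offs p vs))

    chain-closed : ∀ p u vs w → p u ≡ left → p w ≡ left → 1 ≤ rights p vs → 2 ≤ cost p vs (chain u vs w)
    chain-closed p u (v ∷ vs) w pu pw r≥ with p v in eq
    ... | off = s≤s (skip (offs p vs) _ _ (offCase vs r≥))
      where
      offCase : ∀ vs → 1 ≤ rights p vs → 1 ≤ cost p vs (chain v vs w)
      offCase vs r≥ = chain-end p v vs w pw r≥
    ... | left = skip (offs p vs) _ _ (chain-closed p v vs w eq pw r≥)
    ... | right = ≤-trans (+-mono-≤ (crossing-edge p u v {0} (cong₂ opposite pu eq)) (chain₁ p v vs w (cong₂ opposite eq pw)))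
                          (≤-reflexive (exchange (if crosses p (u ─ v) then 1 else 0) (offs p vs) _))
      where
      exchange : ∀ a b c → a + 0 + (b + c) ≡ b + (a + c)
      exchange = solve-∀

    chain-inside : ∀ p u vs w → 1 ≤ lefts p vs → 1 ≤ rights p vs → 1 ≤ cost p vs (chain u vs w)
    chain-inside p u (v ∷ vs) w l≥ r≥ with p v in eq
    ... | off = s≤s z≤n
    ... | left = skip (offs p vs) _ _ (chain-start p v vs w eq r≥)
    ... | right = skip (offs p vs) _ _ (subst (1 ≤_) (cost-flip p vs (chain v vs w))
                    (chain-start (flip ∘ p) v vs w (cong flip eq) (subst (1 ≤_) (sym (rights-flip p vs)) l≥)))

  -- If u is left, a right vertex splits the cycle into two chains from u to it, each costing one.
  -- If u is removed, that is one unit, and the remaining path costs another.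
  cycle-connected : ∀ u vs → Connected 2 (u ∷ vs) (chain u vs u)
  cycle-connected u vs = by-symmetry {u = u} {u ∷ vs} {chain u vs u} half
    where
    half : Half 2 u (u ∷ vs) (chain u vs u)
    half p ≢right l≥ r≥ with p u in eq
    ... | right = contradiction refl ≢right
    ... | off = s≤s (chain-inside p u vs u l≥ r≥)
    ... | left = chain-closed p u vs u eq eq r≥

  private
    drop₂ : ∀ a b c → c ≤ a + (b + c)
    drop₂ a b c = ≤-trans (m≤n+m c b) (m≤n+m (b + c) a)

    mid₂ : ∀ a b c → b ≤ a + (b + c)
    mid₂ a b c = ≤-trans (m≤m+n b c) (m≤n+m (b + c) a)

    #hub : (Fin n → Part) → Fin n → List (Fin n) → ℕ
    #hub p u vs = count (crosses p) (hub u vs)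

  -- A wheel whose hub is split into two adjacent vertices, each joined to one arc of the rim. If
  -- the rim meets both sides, it costs two, and one more unit comes from a removed hub, from a rim
  -- vertex opposite to both hubs, or from the edge uv. If the rim misses one side, a hub on that
  -- side has its whole arc crossed or removed.
  split-wheel-connected : ∀ {u v rs rs′ es} → Connected 2 (rs ++ rs′) es → 2 ≤ length rs → 2 ≤ length rs′ →
    Connected 3 (u ∷ v ∷ rs ++ rs′) (u ─ v ∷ hub u rs ++ hub v rs′ ++ es)
  split-wheel-connected {u} {v} {rs} {rs′} {es} conn 2≤ 2≤′ =
    by-symmetry {u = u} {u ∷ v ∷ rs ++ rs′} {u ─ v ∷ hub u rs ++ hub v rs′ ++ es} half
    where
    half : Half 3 u (u ∷ v ∷ rs ++ rs′) (u ─ v ∷ hub u rs ++ hub v rs′ ++ es)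
    half p ≢right l≥ r≥
      rewrite crosses-─ p u v | count-++ (crosses p) (hub u rs) (hub v rs′ ++ es)
            | count-++ (crosses p) (hub v rs′) es
      with p u in equ | p v in eqv
    ... | right | _ = contradiction refl ≢right
    ... | off | off = s≤s (s≤s (≤-trans (≤-trans (s≤s z≤n) (conn p l≥ r≥))
                        (+-monoʳ-≤ (offs p (rs ++ rs′)) (drop₂ (#hub p u rs) (#hub p v rs′) (count (crosses p) es)))))
    ... | off | left rewrite hub-left p v rs′ eqv = one-off (rights p) (λ vs → no-lefts p vs) r≥ (λ l → conn p l r≥)
      where
      W = rs ++ rs′
      h = count (crosses p) (hub u rs)
      c = count (crosses p) es
      one-off : (R : List (Fin n) → ℕ) → (∀ vs → lefts p vs ≡ 0 → R vs + offs p vs ≡ length vs) →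
                1 ≤ R W → (1 ≤ lefts p W → 2 ≤ offs p W + c) → 3 ≤ suc (offs p W + (h + (R rs′ + c)))
      one-off R none-eq _ c₂ with none-or-some (lefts p W)
      ... | inj₂ some = s≤s (≤-trans (c₂ some) (+-monoʳ-≤ (offs p W) (≤-trans (m≤n+m c (R rs′)) (m≤n+m _ h))))
      ... | inj₁ none = s≤s (begin
        2 ≤⟨ 2≤′ ⟩
        length rs′ ≡⟨ none-eq rs′ (m+n≡0⇒n≡0 (lefts p rs) (≡.trans (sym (count-++ (isLeft ∘ p) rs rs′)) none)) ⟨
        R rs′ + offs p rs′ ≤⟨ +-mono-≤ (≤-trans (m≤m+n (R rs′) c) (m≤n+m _ h))
                                       (≤-trans (m≤n+m (offs p rs′) (offs p rs)) (≤-reflexive (sym (count-++ (isOff ∘ p) rs rs′)))) ⟩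
        h + (R rs′ + c) + offs p W ≡⟨ +-comm (h + (R rs′ + c)) _ ⟩
        offs p W + (h + (R rs′ + c)) ∎)
    ... | off | right rewrite hub-right p v rs′ eqv with none-or-some (rights p (rs ++ rs′))
    ... | inj₂ some = s≤s (≤-trans (conn p l≥ some) (+-monoʳ-≤ (offs p (rs ++ rs′)) (drop₂ (#hub p u rs) (lefts p rs′) (count (crosses p) es))))
    ... | inj₁ none = s≤s (begin
        2 ≤⟨ 2≤′ ⟩
        length rs′ ≡⟨ no-rights p rs′ (m+n≡0⇒n≡0 (rights p rs) (≡.trans (sym (count-++ (isRight ∘ p) rs rs′)) none)) ⟨
        lefts p rs′ + offs p rs′ ≤⟨ +-mono-≤ (mid₂ (#hub p u rs) (lefts p rs′) (count (crosses p) es))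
                                       (≤-trans (m≤n+m (offs p rs′) (offs p rs)) (≤-reflexive (sym (count-++ (isOff ∘ p) rs rs′)))) ⟩
        _ ≡⟨ +-comm _ (offs p (rs ++ rs′)) ⟩
        _ ∎)
    half p ≢right l≥ r≥ | left | off rewrite hub-left p u rs equ with none-or-some (lefts p (rs ++ rs′))
    ... | inj₂ some = s≤s (≤-trans (conn p some r≥) (+-monoʳ-≤ (offs p (rs ++ rs′)) (drop₂ (rights p rs) (#hub p v rs′) (count (crosses p) es))))
    ... | inj₁ none = s≤s (begin
        2 ≤⟨ 2≤ ⟩
        length rs ≡⟨ no-lefts p rs (m+n≡0⇒m≡0 (lefts p rs) (≡.trans (sym (count-++ (isLeft ∘ p) rs rs′)) none)) ⟨
        rights p rs + offs p rs ≤⟨ +-mono-≤ (m≤m+n (rights p rs) _)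
                                       (≤-trans (m≤m+n (offs p rs) (offs p rs′)) (≤-reflexive (sym (count-++ (isOff ∘ p) rs rs′)))) ⟩
        _ ≡⟨ +-comm _ (offs p (rs ++ rs′)) ⟩
        _ ∎)
    half p ≢right l≥ r≥ | left | left rewrite hub-left p u rs equ | hub-left p v rs′ eqv with none-or-some (lefts p (rs ++ rs′))
    ... | inj₂ some = begin
        1 + 2
          ≤⟨ +-mono-≤ r≥ (conn p some r≥) ⟩
        rights p (rs ++ rs′) + (offs p (rs ++ rs′) + count (crosses p) es)
          ≡⟨ cong (_+ (offs p (rs ++ rs′) + count (crosses p) es)) (count-++ (isRight ∘ p) rs rs′) ⟩
        rights p rs + rights p rs′ + (offs p (rs ++ rs′) + count (crosses p) es)
          ≡⟨ exchange (rights p rs) (rights p rs′) (offs p (rs ++ rs′)) (count (crosses p) es) ⟩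
        offs p (rs ++ rs′) + (rights p rs + (rights p rs′ + count (crosses p) es)) ∎
        where
        exchange : ∀ a b c d → a + b + (c + d) ≡ c + (a + (b + d))
        exchange = solve-∀
    ... | inj₁ none = begin
        3
          ≤⟨ ≤-trans (n≤1+n 3) (+-mono-≤ 2≤ 2≤′) ⟩
        length rs + length rs′
          ≡⟨ length-++ rs ⟨
        length (rs ++ rs′)
          ≡⟨ no-lefts p (rs ++ rs′) none ⟨
        rights p (rs ++ rs′) + offs p (rs ++ rs′)
          ≡⟨ cong (_+ offs p (rs ++ rs′)) (count-++ (isRight ∘ p) rs rs′) ⟩
        rights p rs + rights p rs′ + offs p (rs ++ rs′)
          ≤⟨ m≤m+n _ (count (crosses p) es) ⟩
        rights p rs + rights p rs′ + offs p (rs ++ rs′) + count (crosses p) es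
          ≡⟨ exchange (rights p rs) (rights p rs′) (offs p (rs ++ rs′)) (count (crosses p) es) ⟩
        offs p (rs ++ rs′) + (rights p rs + (rights p rs′ + count (crosses p) es)) ∎
        where
        exchange : ∀ a b c d → a + b + c + d ≡ c + (a + (b + d))
        exchange = solve-∀
    half p ≢right l≥ r≥ | left | right rewrite hub-left p u rs equ | hub-right p v rs′ eqv
      with none-or-some (lefts p (rs ++ rs′)) | none-or-some (rights p (rs ++ rs′))
    ... | inj₂ l | inj₂ r = ≤-trans (s≤s (≤-trans (conn p l r) (+-monoʳ-≤ (offs p (rs ++ rs′))
                              (drop₂ (rights p rs) (lefts p rs′) (count (crosses p) es)))))
                              (≤-reflexive (sym (+-suc (offs p (rs ++ rs′)) _)))
    ... | inj₁ none | _ = ≤-trans (s≤s (begin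
        2 ≤⟨ 2≤ ⟩
        length rs ≡⟨ no-lefts p rs (m+n≡0⇒m≡0 (lefts p rs) (≡.trans (sym (count-++ (isLeft ∘ p) rs rs′)) none)) ⟨
        rights p rs + offs p rs ≤⟨ +-mono-≤ (m≤m+n (rights p rs) _)
                                       (≤-trans (m≤m+n (offs p rs) (offs p rs′)) (≤-reflexive (sym (count-++ (isOff ∘ p) rs rs′)))) ⟩
        _ ≡⟨ +-comm _ (offs p (rs ++ rs′)) ⟩
        _ ∎)) (≤-reflexive (sym (+-suc (offs p (rs ++ rs′)) _)))
    ... | inj₂ _ | inj₁ none = ≤-trans (s≤s (begin
        2 ≤⟨ 2≤′ ⟩
        length rs′ ≡⟨ no-rights p rs′ (m+n≡0⇒n≡0 (rights p rs) (≡.trans (sym (count-++ (isRight ∘ p) rs rs′)) none)) ⟨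
        lefts p rs′ + offs p rs′ ≤⟨ +-mono-≤ (mid₂ (rights p rs) (lefts p rs′) (count (crosses p) es))
                                       (≤-trans (m≤n+m (offs p rs′) (offs p rs)) (≤-reflexive (sym (count-++ (isOff ∘ p) rs rs′)))) ⟩
        _ ≡⟨ +-comm _ (offs p (rs ++ rs′)) ⟩
        _ ∎)) (≤-reflexive (sym (+-suc (offs p (rs ++ rs′)) _)))

  -- The two apices are not adjacent. If they are on different sides, each rim vertex costs one,
  -- hence `4 ≤ length rs`. If they are on the same side and the rim meets both, each opposite rim
  -- vertex costs two in addition to the two of the rim; a removed apex costs one itself.
  bipyramid-connected : ∀ {u v rs es} → Connected 2 rs es → 4 ≤ length rs →
    Connected 4 (u ∷ v ∷ rs) (hub u rs ++ hub v rs ++ es)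
  bipyramid-connected {u} {v} {rs} {es} conn 4≤ =
    by-symmetry {u = u} {u ∷ v ∷ rs} {hub u rs ++ hub v rs ++ es} half
    where
    half : Half 4 u (u ∷ v ∷ rs) (hub u rs ++ hub v rs ++ es)
    half p ≢right l≥ r≥
      rewrite count-++ (crosses p) (hub u rs) (hub v rs ++ es) | count-++ (crosses p) (hub v rs) es
      with p u in equ | p v in eqv
    ... | right | _ = contradiction refl ≢right
    ... | off | off = s≤s (s≤s (≤-trans (conn p l≥ r≥) (+-monoʳ-≤ (offs p rs) (drop₂ (#hub p u rs) (#hub p v rs) (count (crosses p) es)))))
    ... | off | left rewrite hub-left p v rs eqv =
            s≤s (≤-trans (three p r≥ (conn p)) (+-monoʳ-≤ (offs p rs) (m≤n+m _ (#hub p u rs))))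
      where
      three : ∀ p → 1 ≤ rights p rs → (1 ≤ lefts p rs → 1 ≤ rights p rs → 2 ≤ cost p rs es) →
              3 ≤ offs p rs + (rights p rs + count (crosses p) es)
      three p r≥ conn′ with none-or-some (lefts p rs)
      ... | inj₂ some = ≤-trans (+-mono-≤ r≥ (conn′ some r≥)) (≤-reflexive (exchange (rights p rs) (offs p rs) _))
        where
        exchange : ∀ a b c → a + (b + c) ≡ b + (a + c)
        exchange = solve-∀
      ... | inj₁ none = begin
        3 ≤⟨ ≤-trans (n≤1+n 3) 4≤ ⟩
        length rs ≡⟨ no-lefts p rs none ⟨
        rights p rs + offs p rs ≡⟨ +-comm (rights p rs) _ ⟩
        offs p rs + rights p rs ≤⟨ +-monoʳ-≤ (offs p rs) (m≤m+n _ _) ⟩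
        offs p rs + (rights p rs + count (crosses p) es) ∎
    ... | off | right rewrite hub-right p v rs eqv with none-or-some (rights p rs)
    ... | inj₂ some = s≤s (≤-trans (≤-trans (+-mono-≤ l≥ (conn p l≥ some)) (≤-reflexive (exchange (lefts p rs) (offs p rs) _)))
                        (+-monoʳ-≤ (offs p rs) (m≤n+m _ (#hub p u rs))))
      where
      exchange : ∀ a b c → a + (b + c) ≡ b + (a + c)
      exchange = solve-∀
    ... | inj₁ none = s≤s (begin
      3 ≤⟨ ≤-trans (n≤1+n 3) 4≤ ⟩
      length rs ≡⟨ no-rights p rs none ⟨
      lefts p rs + offs p rs ≡⟨ +-comm (lefts p rs) _ ⟩
      offs p rs + lefts p rs ≤⟨ +-monoʳ-≤ (offs p rs) (mid₂ (#hub p u rs) (lefts p rs) (count (crosses p) es)) ⟩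
      _ ∎)
    half p ≢right l≥ r≥ | left | off rewrite hub-left p u rs equ with none-or-some (lefts p rs)
    ... | inj₂ some = s≤s (≤-trans (+-mono-≤ r≥ (conn p some r≥)) (≤-trans (≤-reflexive (exchange (rights p rs) (offs p rs) _))
                        (+-monoʳ-≤ (offs p rs) (+-monoʳ-≤ (rights p rs) (m≤n+m _ (#hub p v rs))))))
      where
      exchange : ∀ a b c → a + (b + c) ≡ b + (a + c)
      exchange = solve-∀
    ... | inj₁ none = s≤s (begin
      3 ≤⟨ ≤-trans (n≤1+n 3) 4≤ ⟩
      length rs ≡⟨ no-lefts p rs none ⟨
      rights p rs + offs p rs ≡⟨ +-comm (rights p rs) _ ⟩
      offs p rs + rights p rs ≤⟨ +-monoʳ-≤ (offs p rs) (m≤m+n _ _) ⟩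
      _ ∎)
    half p ≢right l≥ r≥ | left | left rewrite hub-left p u rs equ | hub-left p v rs eqv with none-or-some (lefts p rs)
    ... | inj₂ some = ≤-trans (+-mono-≤ (+-mono-≤ r≥ r≥) (conn p some r≥)) (≤-reflexive (exchange (rights p rs) (offs p rs) _))
      where
      exchange : ∀ a b c → a + a + (b + c) ≡ b + (a + (a + c))
      exchange = solve-∀
    ... | inj₁ none = begin
      4 ≤⟨ 4≤ ⟩
      length rs ≡⟨ no-lefts p rs none ⟨
      rights p rs + offs p rs ≡⟨ +-comm (rights p rs) _ ⟩
      offs p rs + rights p rs ≤⟨ +-monoʳ-≤ (offs p rs) (m≤m+n _ _) ⟩
      _ ∎
    half p ≢right l≥ r≥ | left | right rewrite hub-left p u rs equ | hub-right p v rs eqv = begin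
      4 ≤⟨ 4≤ ⟩
      length rs ≡⟨ parts p rs ⟨
      lefts p rs + rights p rs + offs p rs ≤⟨ m≤m+n _ (count (crosses p) es) ⟩
      lefts p rs + rights p rs + offs p rs + count (crosses p) es ≡⟨ exchange (lefts p rs) (rights p rs) (offs p rs) _ ⟩
      offs p rs + (rights p rs + (lefts p rs + count (crosses p) es)) ∎
      where
      exchange : ∀ a b c d → a + b + c + d ≡ c + (b + (a + d))
      exchange = solve-∀

-- Networks of prescribed connectivity

-- The number of edges meeting δ dominating vertices when ρ others remain.
dominated : ℕ → ℕ → ℕ
dominated zero ρ = 0
dominated (suc δ) ρ = δ + ρ + dominated δ ρ

module _ {n : ℕ} where

  EndsIn : List (Fin n) → List (Edge n) → Set
  EndsIn vs = All (λ e → proj₁ e ∈ vs × proj₂ e ∈ vs)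

  Misses : Fin n → Edge n → Set
  Misses u e = u ≢ proj₁ e × u ≢ proj₂ e

  ∉-missed : ∀ {u v L} → All (Misses u) L → u ─ v ∉ L
  ∉-missed {u} {v} miss e∈ with ─-either u v | All.lookup miss e∈
  ... | inj₁ eq | p , _ = p (sym (cong proj₁ eq))
  ... | inj₂ eq | _ , q = q (sym (cong proj₂ eq))

  EndsIn-misses : ∀ {u vs L} → u ∉ vs → EndsIn vs L → All (Misses u) L
  EndsIn-misses u∉ = All.map λ (p , q) → (λ { refl → u∉ p }) , (λ { refl → u∉ q })

  ─-injectiveʳ : ∀ {u v w : Fin n} → u ─ v ≡ u ─ w → v ≡ w
  ─-injectiveʳ eq with ─-injective eq
  ... | inj₁ (_ , q) = q
  ... | inj₂ (p , q) = ≡.trans q p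

  hub-simple : ∀ {u vs rs es} → u ∉ vs → Unique rs → rs ⊆ vs → Simple es → EndsIn vs es → Simple (hub u rs ++ es)
  hub-simple {u} {vs} {rs} {es} u∉ uniq rs⊆ (ue , pe) ends =
      Unique.++⁺ (Unique.map⁺ ─-injectiveʳ uniq) ue disj
    , All.++⁺ (All.map⁺ (All.tabulate λ {x} x∈ → ─-proper {u = u} {x} λ { refl → u∉ (rs⊆ x∈) })) pe
    where
    disj : ∀ {e} → (e ∈ hub u rs) × (e ∈ es) → ⊥
    disj (p , q) with ∈-map⁻ (u ─_) p
    ... | v , _ , refl = ∉-missed (EndsIn-misses u∉ ends) q

  hub-ends : ∀ {u vs rs es} → rs ⊆ vs → EndsIn vs es → EndsIn (u ∷ vs) (hub u rs ++ es)
  hub-ends {u} {vs} rs⊆ ends = All.++⁺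
    (All.map⁺ (All.tabulate λ {x} x∈ → ─-ends {P = _∈ u ∷ vs} {u} {x} (here refl) (there (rs⊆ x∈))))
    (All.map (λ (p , q) → there p , there q) ends)

  chain-all : ∀ {P : Fin n → Set} {u vs w} → P u → All P vs → P w → All (λ e → P (proj₁ e) × P (proj₂ e)) (chain u vs w)
  chain-all {P} {vs = []} pu [] pw = ─-ends {P = P} pu pw ∷ []
  chain-all {P} {vs = v ∷ vs} pu (pv ∷ pvs) pw = ─-ends {P = P} pu pv ∷ chain-all pv pvs pw

  chain-simple : ∀ {u vs w} → Unique (u ∷ vs) → w ∉ u ∷ vs → Simple (chain u vs w)
  chain-simple {u} {[]} {w} _ w∉ = [] ∷ [] , ─-proper {u = u} {w} (λ { refl → w∉ (here refl) }) ∷ []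
  chain-simple {u} {v ∷ vs} {w} ((u≢v ∷ u∉) ∷ uniq) w∉ with chain-simple uniq (w∉ ∘ there)
  ... | uc , pc = ¬Any⇒All¬ (chain v vs w) (∉-missed {u} {v} (chain-all {P = u ≢_} {v} {vs} {w} u≢v u∉ (λ { refl → w∉ (here refl) }))) ∷ uc
                , ─-proper u≢v ∷ pc

  length-chain : ∀ (u : Fin n) vs w → length (chain u vs w) ≡ suc (length vs)
  length-chain u [] w = refl
  length-chain u (v ∷ vs) w = cong suc (length-chain v vs w)

  record Network (r ℓ : ℕ) (vs : List (Fin n)) : Set where
    field
      edges     : List (Edge n)
      simple    : Simple edges
      ends      : EndsIn vs edges
      size      : length edges ≡ ℓ
      connected : Connected r vs edges

  open Network

  cycle : ∀ {vs} → Unique vs → 3 ≤ length vs → Network 2 (length vs) vs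
  cycle {u ∷ []} _ (s≤s ())
  cycle {u ∷ v ∷ []} _ (s≤s (s≤s ()))
  cycle {u ∷ v ∷ w ∷ ws} (u∉@(u≢v ∷ u≢w ∷ _) ∷ uniq@((v≢w ∷ v∉) ∷ _)) _ = record
    { edges = chain u (v ∷ w ∷ ws) u
    ; simple = ¬Any⇒All¬ _ closing ∷ proj₁ rest , ─-proper u≢v ∷ proj₂ rest
    ; ends = chain-all {P = _∈ u ∷ v ∷ w ∷ ws} {u} {v ∷ w ∷ ws} {u} (here refl) (All.tabulate there) (here refl)
    ; size = length-chain u (v ∷ w ∷ ws) u
    ; connected = cycle-connected u (v ∷ w ∷ ws)
    }
    where
    rest : Simple (chain v (w ∷ ws) u)
    rest = chain-simple uniq (All¬⇒¬Any u∉)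
    closing : u ─ v ∉ chain v (w ∷ ws) u
    closing (here eq) with ─-injective eq
    ... | inj₁ (u≡v , _) = u≢v u≡v
    ... | inj₂ (u≡w , _) = u≢w u≡w
    closing (there e∈) = ∉-missed {v} {u} (chain-all {P = v ≢_} {w} {ws} {u} v≢w v∉ (u≢v ∘ sym)) (subst (_∈ chain w ws u) (─-comm u v) e∈)

  length-hub-++ : ∀ u rs (es : List (Edge n)) → length (hub u rs ++ es) ≡ length rs + length es
  length-hub-++ u rs es = ≡.trans (length-++ (hub u rs)) (cong (_+ length es) (length-map _ rs))

  join : ∀ {r ℓ u vs} → Unique (u ∷ vs) → suc r ≤ length vs → Network r ℓ vs → Network (suc r) (length vs + ℓ) (u ∷ vs)
  join {u = u} {vs} (u∉ ∷ uniq) r< net = record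
    { edges = hub u vs ++ edges net
    ; simple = hub-simple (All¬⇒¬Any u∉) uniq id (simple net) (ends net)
    ; ends = hub-ends id (ends net)
    ; size = ≡.trans (length-hub-++ u vs (edges net)) (cong (length vs +_) (size net))
    ; connected = join-connected {u = u} {vs} {edges net} (connected net) r<
    }

  join-all : ∀ {r ℓ vs} us → Unique (us ++ vs) → suc r ≤ length vs → Network r ℓ vs →
             Network (length us + r) (dominated (length us) (length vs) + ℓ) (us ++ vs)
  join-all [] _ _ net = net
  join-all {r} {ℓ} {vs} (u ∷ us) uniq@(_ ∷ uniq′) r< net =
    subst (λ z → Network (suc (length us + r)) z (u ∷ us ++ vs))
      (≡.trans (cong (_+ (dominated (length us) (length vs) + ℓ)) (length-++ us)) (sym (+-assoc (length us + length vs) _ ℓ)))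
      (join uniq (≤-trans (≤-reflexive (sym (+-suc (length us) r)))
        (≤-trans (+-monoʳ-≤ (length us) r<) (≤-reflexive (sym (length-++ us))))) (join-all us uniq′ r< net))

  split-wheel : ∀ {ℓ u v} rs rs′ → Unique (u ∷ v ∷ rs ++ rs′) → 2 ≤ length rs → 2 ≤ length rs′ →
                Network 2 ℓ (rs ++ rs′) → Network 3 (suc (length rs + (length rs′ + ℓ))) (u ∷ v ∷ rs ++ rs′)
  split-wheel {ℓ} {u} {v} rs rs′ (u∉ ∷ v∉ ∷ uniq) 2≤ 2≤′ net = record
    { edges = u ─ v ∷ hub u rs ++ hub v rs′ ++ edges net
    ; simple = hub-simple {rs = v ∷ rs} (All¬⇒¬Any u∉)
        (All.++⁻ˡ rs v∉ ∷ Unique-++⁻ˡ rs uniq) (λ { (here refl) → here refl ; (there x∈) → there (∈-++⁺ˡ x∈) })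
        (hub-simple (All¬⇒¬Any v∉) (Unique-++⁻ʳ rs uniq) (∈-++⁺ʳ rs) (simple net) (ends net))
        (hub-ends (∈-++⁺ʳ rs) (ends net))
    ; ends = hub-ends {rs = v ∷ rs} (λ { (here refl) → here refl ; (there x∈) → there (∈-++⁺ˡ x∈) })
        (hub-ends (∈-++⁺ʳ rs) (ends net))
    ; size = cong suc (≡.trans (length-hub-++ u rs (hub v rs′ ++ edges net)) (cong (length rs +_)
        (≡.trans (length-hub-++ v rs′ (edges net)) (cong (length rs′ +_) (size net)))))
    ; connected = split-wheel-connected {u = u} {v} {rs} {rs′} {edges net} (connected net) 2≤ 2≤′
    }

  bipyramid : ∀ {ℓ u v rs} → Unique (u ∷ v ∷ rs) → 4 ≤ length rs → Network 2 ℓ rs →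
              Network 4 (length rs + (length rs + ℓ)) (u ∷ v ∷ rs)
  bipyramid {ℓ} {u} {v} {rs} (u∉ ∷ v∉ ∷ uniq) 4≤ net = record
    { edges = hub u rs ++ hub v rs ++ edges net
    ; simple = hub-simple (All¬⇒¬Any u∉) uniq there
        (hub-simple (All¬⇒¬Any v∉) uniq id (simple net) (ends net)) (hub-ends id (ends net))
    ; ends = hub-ends there (hub-ends id (ends net))
    ; size = ≡.trans (length-hub-++ u rs (hub v rs ++ edges net)) (cong (length rs +_)
        (≡.trans (length-hub-++ v rs (edges net)) (cong (length rs +_) (size net))))
    ; connected = bipyramid-connected {u = u} {v} {rs} {edges net} (connected net) 4≤
    }

  ends? : ∀ (v : Fin n) e → Bool
  ends? v e = ⌊ v Fin.≟ proj₁ e ⌋ ∨ ⌊ v Fin.≟ proj₂ e ⌋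

  degree : Fin n → List (Edge n) → ℕ
  degree v = count (ends? v)

avoid-zero : ∀ {A : Set} (φ : A → Bool) S → avoid φ S ≡ 1 ⊎ (∃[ e ] (e ∈ S × φ e ≡ true))
avoid-zero φ [] = inj₁ refl
avoid-zero φ (e ∷ S) with φ e in eq
... | true = inj₂ (e , here refl , eq)
... | false with avoid-zero φ S
... | inj₁ p = inj₁ p
... | inj₂ (f , f∈ , p) = inj₂ (f , there f∈ , p)

avoid⇒All : ∀ {A : Set} (φ : A → Bool) S → avoid φ S ≢ 0 → All (λ e → φ e ≡ false) S
avoid⇒All φ [] _ = []
avoid⇒All φ (e ∷ S) ne with φ e in eq
... | true = contradiction refl ne
... | false = eq ∷ avoid⇒All φ S ne

avoid-01 : ∀ {A : Set} (φ : A → Bool) S → avoid φ S ≡ 0 ⊎ avoid φ S ≡ 1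
avoid-01 φ [] = inj₂ refl
avoid-01 φ (e ∷ S) with φ e
... | true = inj₁ refl
... | false = avoid-01 φ S

avoid-∨ : ∀ {A : Set} (φ ψ : A → Bool) S → avoid (λ e → φ e ∨ ψ e) S ≡ avoid φ S * avoid ψ S
avoid-∨ φ ψ [] = refl
avoid-∨ φ ψ (e ∷ S) with φ e | ψ e
... | true | _ = refl
... | false | true = sym (*-zeroʳ (avoid φ S))
... | false | false = avoid-∨ φ ψ S

-- The second Bonferroni inequality, for the indicators of three events each of which implies
-- failure.
bonferroni : ∀ {x y z} f → x ≡ 0 ⊎ x ≡ 1 → y ≡ 0 ⊎ y ≡ 1 → z ≡ 0 ⊎ z ≡ 1 →
             (x ≡ 1 → 1 ≤ f) → (y ≡ 1 → 1 ≤ f) → (z ≡ 1 → 1 ≤ f) →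
             x + y + z ≤ f + (x * y + x * z + y * z)
bonferroni f (inj₁ refl) (inj₁ refl) (inj₁ refl) _ _ _ = z≤n
bonferroni f (inj₂ refl) (inj₁ refl) (inj₁ refl) p _ _ = ≤-trans (p refl) (m≤m+n f _)
bonferroni f (inj₁ refl) (inj₂ refl) (inj₁ refl) _ p _ = ≤-trans (p refl) (m≤m+n f _)
bonferroni f (inj₁ refl) (inj₁ refl) (inj₂ refl) _ _ p = ≤-trans (p refl) (m≤m+n f _)
bonferroni f (inj₂ refl) (inj₂ refl) (inj₁ refl) p _ _ = +-monoˡ-≤ 1 (p refl)
bonferroni f (inj₂ refl) (inj₁ refl) (inj₂ refl) p _ _ = +-monoˡ-≤ 1 (p refl)
bonferroni f (inj₁ refl) (inj₂ refl) (inj₂ refl) _ p _ = +-monoˡ-≤ 1 (p refl)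
bonferroni f (inj₂ refl) (inj₂ refl) (inj₂ refl) _ _ _ = m≤n+m 3 f

-- Cuts

bit : Bool → ℕ
bit b = if b then 1 else 0

count-∨ʳ : ∀ {A : Set} (φ ψ : A → Bool) xs → count ψ xs ≤ count (λ x → φ x ∨ ψ x) xs
count-∨ʳ φ ψ [] = z≤n
count-∨ʳ φ ψ (x ∷ xs) with φ x | ψ x
... | true | true = s≤s (count-∨ʳ φ ψ xs)
... | true | false = m≤n⇒m≤1+n (count-∨ʳ φ ψ xs)
... | false | true = s≤s (count-∨ʳ φ ψ xs)
... | false | false = count-∨ʳ φ ψ xs

count-exclusive : ∀ {A : Set} (φ ψ : A → Bool) xs → (∀ {x} → x ∈ xs → bit (φ x) + bit (ψ x) ≤ 1) →
                  count φ xs + count ψ xs ≤ length xs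
count-exclusive φ ψ [] _ = z≤n
count-exclusive φ ψ (x ∷ xs) excl = ≤-trans (≤-reflexive (exchange (bit (φ x)) (count φ xs) (bit (ψ x)) (count ψ xs)))
  (+-mono-≤ (excl (here refl)) (count-exclusive φ ψ xs (excl ∘ there)))
  where
  exchange : ∀ a b c d → a + b + (c + d) ≡ a + c + (b + d)
  exchange = solve-∀

count-all : ∀ {A : Set} (φ : A → Bool) xs → (∀ {x} → x ∈ xs → φ x ≡ true) → count φ xs ≡ length xs
count-all φ [] _ = refl
count-all φ (x ∷ xs) all rewrite all (here refl) = cong suc (count-all φ xs (all ∘ there))

count-none : ∀ {A : Set} (φ : A → Bool) xs → (∀ {x} → x ∈ xs → φ x ≡ false) → count φ xs ≡ 0
count-none φ [] _ = refl
count-none φ (x ∷ xs) none rewrite none (here refl) = count-none φ xs (none ∘ there)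

module _ {A : Set} (a : ℕ) where
  open Expectation {A} a 1

  𝔼-avoid-lower : ∀ φ L {c j} → count φ L ≤ c → c + j ≡ length L → suc a ^ j ≤ 𝔼 L (avoid φ) []
  𝔼-avoid-lower φ L {c} {j} c≥ len = *-cancelʳ-≤ (suc a ^ j) _ (suc a ^ c) {{m^n≢0 (suc a) c}} (begin
    suc a ^ j * suc a ^ c              ≡⟨ *-comm (suc a ^ j) _ ⟩
    suc a ^ c * suc a ^ j              ≡⟨ ^-distribˡ-+-* (suc a) c j ⟨
    suc a ^ (c + j)                    ≡⟨ cong (suc a ^_) len ⟩
    suc a ^ length L                   ≡⟨ *-identityʳ _ ⟨
    suc a ^ length L * 1               ≡⟨ 𝔼-avoid a φ L [] ⟨
    𝔼 L (avoid φ) [] * suc a ^ count φ L ≤⟨ *-monoʳ-≤ (𝔼 L (avoid φ) []) (^-monoʳ-≤ (suc a) c≥) ⟩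
    𝔼 L (avoid φ) [] * suc a ^ c       ∎)
    where open ≤-Reasoning

  𝔼-avoid-upper : ∀ φ L {c j} → c ≤ count φ L → c + j ≡ length L → 𝔼 L (avoid φ) [] ≤ suc a ^ j
  𝔼-avoid-upper φ L {c} {j} c≤ len = *-cancelʳ-≤ _ (suc a ^ j) (suc a ^ c) {{m^n≢0 (suc a) c}} (begin
    𝔼 L (avoid φ) [] * suc a ^ c       ≤⟨ *-monoʳ-≤ (𝔼 L (avoid φ) []) (^-monoʳ-≤ (suc a) c≤) ⟩
    𝔼 L (avoid φ) [] * suc a ^ count φ L ≡⟨ 𝔼-avoid a φ L [] ⟩
    suc a ^ length L * 1               ≡⟨ *-identityʳ _ ⟩
    suc a ^ length L                   ≡⟨ cong (suc a ^_) len ⟨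
    suc a ^ (c + j)                    ≡⟨ ^-distribˡ-+-* (suc a) c j ⟩
    suc a ^ c * suc a ^ j              ≡⟨ *-comm (suc a ^ c) _ ⟩
    suc a ^ j * suc a ^ c              ∎)
    where open ≤-Reasoning

module Cuts {n : ℕ} (s t : Fin n) (s≢t : s ≢ t) (d : ℕ) (4≤d : 4 ≤ d) where
  open Spokes s t s≢t
  open Terminals s t s≢t d
  open Paths s t s≢t d 4≤d
  open ≤-Reasoning

  cross : (Fin n → Bool) → Edge n → Bool
  cross σ e = σ (proj₁ e) xor σ (proj₂ e)

  cross-─ : ∀ σ u v → cross σ (u ─ v) ≡ σ u xor σ v
  cross-─ σ u v with u Fin.<? v
  ... | yes _ = refl
  ... | no _ = xor-comm (σ v) (σ u)
    where
    xor-comm : ∀ x y → x xor y ≡ y xor x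
    xor-comm false false = refl
    xor-comm false true = refl
    xor-comm true false = refl
    xor-comm true true = refl

  fails-avoid : ∀ σ {S} → σ s ≡ true → σ t ≡ false → avoid (cross σ) S ≡ 1 → 1 ≤ fails S
  fails-avoid σ {S} σs σt eq = ≤-reflexive (sym (fails-no (cut σ σs σt
    (All.map same (avoid⇒All (cross σ) S (λ eq0 → 1≢0 (≡.trans (sym eq) eq0)))))))
    where
    1≢0 : 1 ≢ 0
    1≢0 ()
    xor-false : ∀ x y → x xor y ≡ false → x ≡ y
    xor-false false false _ = refl
    xor-false true true _ = refl
    same : ∀ {e} → cross σ e ≡ false → Uncrossed σ e
    same {e} = xor-false (σ (proj₁ e)) (σ (proj₂ e))

  pair : (Edge n → Bool) → Fin n → ℕ
  pair φ u = bit (φ (s ─ u)) + bit (φ (u ─ t))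

  private
    add-assoc : ∀ a b c → a + (b + c) ≡ a + b + c
    add-assoc = solve-∀

  spokes-≥ : ∀ φ c us → (∀ {u} → u ∈ us → c ≤ pair φ u) → length us * c ≤ count φ (spokes us)
  spokes-≥ φ c [] _ = z≤n
  spokes-≥ φ c (u ∷ us) le = ≤-trans (+-mono-≤ (le (here refl)) (spokes-≥ φ c us (le ∘ there)))
    (≤-reflexive (sym (add-assoc (bit (φ (s ─ u))) _ _)))

  spokes-> : ∀ φ us {w} → (∀ {u} → u ∈ us → 1 ≤ pair φ u) → w ∈ us → 2 ≤ pair φ w →
             suc (length us) ≤ count φ (spokes us)
  spokes-> φ (u ∷ us) le (here refl) two = ≤-trans
    (+-mono-≤ two (≤-trans (≤-reflexive (sym (*-identityʳ (length us)))) (spokes-≥ φ 1 us (le ∘ there))))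
    (≤-reflexive (sym (add-assoc (bit (φ (s ─ u))) _ _)))
  spokes-> φ (u ∷ us) le (there w∈) two = ≤-trans (+-mono-≤ (le (here refl)) (spokes-> φ us (le ∘ there) w∈ two))
    (≤-reflexive (sym (add-assoc (bit (φ (s ─ u))) _ _)))

  spokes-cross : ∀ σ us → σ s ≡ true → σ t ≡ false → count (cross σ) (spokes us) ≡ length us
  spokes-cross σ [] _ _ = refl
  spokes-cross σ (u ∷ us) σs σt rewrite cross-─ σ s u | cross-─ σ u t | σs | σt with σ u
  ... | true = cong suc (spokes-cross σ us σs σt)
  ... | false = cong suc (spokes-cross σ us σs σt)

  cross-true : ∀ σ {x y} u v → σ u ≡ x → σ v ≡ y → cross σ (u ─ v) ≡ x xor y
  cross-true σ u v p q = ≡.trans (cross-─ σ u v) (cong₂ _xor_ p q)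

  is-s-inner : ∀ {u} → Inner u → is-s u ≡ false
  is-s-inner {u} (s≢u , _) with u Fin.≟ s
  ... | yes u≡s = contradiction (sym u≡s) s≢u
  ... | no _ = refl

  not-t : Fin n → Bool
  not-t u = not ⌊ u Fin.≟ t ⌋

  not-t-s : not-t s ≡ true
  not-t-s with s Fin.≟ t
  ... | yes s≡t = contradiction s≡t s≢t
  ... | no _ = refl

  not-t-t : not-t t ≡ false
  not-t-t with t Fin.≟ t
  ... | yes _ = refl
  ... | no t≢t = contradiction refl t≢t

  not-t-inner : ∀ {u} → Inner u → not-t u ≡ true
  not-t-inner {u} (_ , t≢u) with u Fin.≟ t
  ... | yes u≡t = contradiction (sym u≡t) t≢u
  ... | no _ = refl

  module _ {us : List (Fin n)} {B R : List (Edge n)} (inn : All Inner us) (all-inner : ∀ {u} → Inner u → u ∈ us)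
           (inB : EndsIn us B) (simple : Simple (B ++ core us ++ R)) {r : ℕ} (conn : Connected r us B) where

    private
      L = B ++ core us ++ R
      N = length us

      in? : List (Edge n) → Edge n → Bool
      in? S e = ⌊ e ∈ᵉ? S ⌋

      in?-yes : ∀ {S e} → e ∈ S → in? S e ≡ true
      in?-yes {S} {e} e∈ with e ∈ᵉ? S
      ... | yes _ = refl
      ... | no e∉ = contradiction e∈ e∉

      in?-no : ∀ {S e} → e ∉ S → in? S e ≡ false
      in?-no {S} {e} e∉ with e ∈ᵉ? S
      ... | yes e∈ = contradiction e∈ e∉
      ... | no _ = refl

      s-end : ∀ {u v} → u Fin.< v → cross is-s (u , v) ≡ true → ∃[ x ] (x ≢ s × s ─ x ≡ (u , v))
      s-end {u} {v} u<v eq with u Fin.≟ s | v Fin.≟ s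
      ... | yes refl | no v≢s = v , v≢s , ─-proper-≡ u<v
      ... | no u≢s | yes refl = u , u≢s , ≡.trans (─-comm s u) (─-proper-≡ u<v)
      s-end u<v () | yes refl | yes refl
      s-end u<v () | no _ | no _

      t-end : ∀ {u v} → u Fin.< v → cross not-t (u , v) ≡ true → ∃[ y ] (y ≢ t × y ─ t ≡ (u , v))
      t-end {u} {v} u<v eq with u Fin.≟ t | v Fin.≟ t
      ... | yes refl | no v≢t = v , v≢t , ≡.trans (─-comm v t) (─-proper-≡ u<v)
      ... | no u≢t | yes refl = u , u≢t , ─-proper-≡ u<v
      t-end u<v () | yes refl | yes refl
      t-end u<v () | no _ | no _

      module Split {S : List (Edge n)} (uS : Unique S) (S⊆ : S ⊆ L) (¬path : ¬ ShortPath S) where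

        -- Reads a failing state as a separation: a vertex is on the side of the terminal to which
        -- it retains a spoke, and counts as removed if it lost both spokes. Retaining both would
        -- give a path.
        part : Fin n → Part
        part u = if in? S (s ─ u) then left else (if in? S (u ─ t) then right else off)

        part-left : ∀ {u} → s ─ u ∈ S → part u ≡ left
        part-left su rewrite in?-yes su = refl

        part-right : ∀ {u} → Inner u → u ─ t ∈ S → part u ≡ right
        part-right iu ut rewrite in?-no (λ su → ¬path (path₂ iu su ut)) | in?-yes ut = refl

        left⇒ : ∀ u → part u ≡ left → s ─ u ∈ S
        left⇒ u eq with s ─ u ∈ᵉ? S | u ─ t ∈ᵉ? S
        ... | yes su | _ = su
        left⇒ u () | no _ | yes _
        left⇒ u () | no _ | no _

        right⇒ : ∀ u → part u ≡ right → u ─ t ∈ S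
        right⇒ u eq with s ─ u ∈ᵉ? S | u ─ t ∈ᵉ? S
        right⇒ u () | yes _ | _
        ... | no _ | yes ut = ut
        right⇒ u () | no _ | no _

        not-both : ∀ {e} → e ∈ B → bit (in? S e) + bit (crosses part e) ≤ 1
        not-both {u , v} e∈B with (u , v) ∈ᵉ? S | part u in pu | part v in pv
        ... | no _ | left | right = ≤-refl
        ... | no _ | right | left = ≤-refl
        ... | yes e∈ | left | right = contradiction
              (path₃ iu iv u≢v (left⇒ u pu) (subst (_∈ S) (sym (─-proper-≡ u<v)) e∈) (right⇒ v pv)) ¬path
          where
          u<v = All.lookup (proj₂ simple) (∈-++⁺ˡ e∈B)
          u≢v = Fin.<⇒≢ u<v
          iu = All.lookup inn (proj₁ (All.lookup inB e∈B))
          iv = All.lookup inn (proj₂ (All.lookup inB e∈B))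
        ... | yes e∈ | right | left = contradiction
              (path₃ iv iu (u≢v ∘ sym) (left⇒ v pv)
                (subst (_∈ S) (sym (≡.trans (─-comm v u) (─-proper-≡ u<v))) e∈) (right⇒ u pu)) ¬path
          where
          u<v = All.lookup (proj₂ simple) (∈-++⁺ˡ e∈B)
          u≢v = Fin.<⇒≢ u<v
          iu = All.lookup inn (proj₁ (All.lookup inB e∈B))
          iv = All.lookup inn (proj₂ (All.lookup inB e∈B))
        ... | x | left | left = bit-≤1 x
          where
          bit-≤1 : ∀ {P : Set} (x : Dec P) → bit ⌊ x ⌋ + 0 ≤ 1
          bit-≤1 (yes _) = ≤-refl
          bit-≤1 (no _) = z≤n
        ... | yes _ | left | off = ≤-refl
        ... | no _ | left | off = z≤n
        ... | yes _ | right | right = ≤-refl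
        ... | no _ | right | right = z≤n
        ... | yes _ | right | off = ≤-refl
        ... | no _ | right | off = z≤n
        ... | yes _ | off | _ = ≤-refl
        ... | no _ | off | _ = z≤n

        spokes-kept : ∀ vs → All Inner vs → count (in? S) (spokes vs) + offs part vs ≤ length vs
        spokes-kept [] [] = z≤n
        spokes-kept (u ∷ vs) (iu ∷ is) with s ─ u ∈ᵉ? S | u ─ t ∈ᵉ? S
        ... | yes su | yes ut = contradiction (path₂ iu su ut) ¬path
        ... | yes _ | no _ = s≤s (spokes-kept vs is)
        ... | no _ | yes _ = s≤s (spokes-kept vs is)
        ... | no _ | no _ = ≤-trans (≤-reflexive (+-suc (count (in? S) (spokes vs)) _)) (s≤s (spokes-kept vs is))

        kept-≤ : length S ≤ count (in? S) L
        kept-≤ with ⊆⇒↭ uS S⊆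
        ... | Z , L↭ = begin
          length S                            ≡⟨ count-all (in? S) S in?-yes ⟨
          count (in? S) S                     ≤⟨ m≤m+n _ _ ⟩
          count (in? S) S + count (in? S) Z   ≡⟨ count-++ (in? S) S Z ⟨
          count (in? S) (S ++ Z)              ≡⟨ count-↭ (in? S) L↭ ⟨
          count (in? S) L                     ∎

        core-kept : count (in? S) (core us) ≡ count (in? S) (spokes us)
        core-kept = ≡.trans (count-++ (in? S) (spokes us) [ s ─ t ])
          (≡.trans (cong (λ z → count (in? S) (spokes us) + (bit z + 0)) (in?-no (¬path ∘ path₁))) (+-identityʳ _))

        length-L : length L ≡ length B + (1 + 2 * N + length R)
        length-L = ≡.trans (length-++ B) (cong (length B +_) (≡.trans (length-++ (core us)) (cong (_+ length R) (length-core us))))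

        -- Each of the `N` vertices lost a spoke and the removed ones lost two; st is missing, and
        -- so are all crossing edges of `B`, which would complete paths with three edges. Altogether
        -- this is `N + 1` plus the cost of the separation, which is at least `r`.
        deleted : ∀ {x y} → Inner x → s ─ x ∈ S → Inner y → y ─ t ∈ S → length S + (N + 1 + r) ≤ length L
        deleted {x} {y} ix sx iy yt = begin
          length S + (N + 1 + r)
            ≤⟨ +-monoˡ-≤ (N + 1 + r) kept-≤ ⟩
          count (in? S) L + (N + 1 + r)
            ≡⟨ cong (_+ (N + 1 + r)) (≡.trans (count-++ (in? S) B _)
                 (cong (b +_) (≡.trans (count-++ (in? S) (core us) R) (cong (_+ ρ) core-kept)))) ⟩
          b + (k + ρ) + (N + 1 + r)
            ≤⟨ +-monoʳ-≤ (b + (k + ρ)) (+-monoʳ-≤ (N + 1) (conn part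
                 (∈⇒1≤count (isLeft ∘ part) (all-inner ix) (cong isLeft (part-left sx)))
                 (∈⇒1≤count (isRight ∘ part) (all-inner iy) (cong isRight (part-right iy yt))))) ⟩
          b + (k + ρ) + (N + 1 + (o + c))
            ≡⟨ regroup b k ρ N o c ⟩
          (b + c) + ((1 + (N + (k + o))) + ρ)
            ≤⟨ +-mono-≤ (count-exclusive (in? S) (crosses part) B not-both)
                 (+-mono-≤ (+-monoʳ-≤ 1 (+-monoʳ-≤ N (spokes-kept us inn))) (count-≤-length (in? S) R)) ⟩
          length B + (1 + (N + N) + length R)
            ≡⟨ cong (λ z → length B + (1 + (N + z) + length R)) (+-identityʳ N) ⟨
          length B + (1 + 2 * N + length R)
            ≡⟨ length-L ⟨
          length L ∎
          where
          b = count (in? S) B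
          k = count (in? S) (spokes us)
          ρ = count (in? S) R
          o = offs part us
          c = count (crosses part) B
          regroup : ∀ b k ρ N o c → b + (k + ρ) + (N + 1 + (o + c)) ≡ (b + c) + ((1 + (N + (k + o))) + ρ)
          regroup = solve-∀

    -- A failing state that retains an edge at s and an edge at t separates two vertices of `us`, so
    -- by `Split.deleted` it has at most `e` edges.
    few-or-cut : ∀ {e} → e + (N + 1 + r) ≡ length L → ∀ S → Unique S → S ⊆ L →
                 fails S ≤ avoid (cross is-s) S + avoid (cross not-t) S + indicator (length S ≤? e)
    few-or-cut {e} len S uS S⊆ = fails-≤ {S} λ ¬path → by ¬path (avoid-zero (cross is-s) S) (avoid-zero (cross not-t) S)
      where
      by : ¬ ShortPath S → _ → _ → 1 ≤ avoid (cross is-s) S + avoid (cross not-t) S + indicator (length S ≤? e)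
      by ¬path (inj₁ one) _ = ≤-trans (≤-reflexive (sym one)) (≤-trans (m≤m+n _ _) (m≤m+n _ _))
      by ¬path (inj₂ _) (inj₁ one) = ≤-trans (≤-reflexive (sym one)) (≤-trans (m≤n+m _ (avoid (cross is-s) S)) (m≤m+n _ _))
      by ¬path (inj₂ (f , f∈ , fs)) (inj₂ (g , g∈ , gt))
        with s-end (All.lookup (proj₂ simple) (S⊆ f∈)) fs | t-end (All.lookup (proj₂ simple) (S⊆ g∈)) gt
      ... | x , x≢s , refl | y , y≢t , refl with x Fin.≟ t | y Fin.≟ s
      ... | yes refl | _ = contradiction (path₁ f∈) ¬path
      ... | no _ | yes refl = contradiction (path₁ g∈) ¬path
      ... | no x≢t | no y≢s = ≤-trans (≤-reflexive (sym (indicator-yes (length S ≤? e) small)))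
                                (m≤n+m _ (avoid (cross is-s) S + avoid (cross not-t) S))
        where
        small : length S ≤ e
        small = +-cancelʳ-≤ (N + 1 + r) (length S) e (≤-trans
          (Split.deleted uS S⊆ ¬path (x≢s ∘ sym , x≢t ∘ sym) f∈ (y≢s ∘ sym , y≢t ∘ sym) g∈) (≤-reflexive (sym len)))

-- Comparing small cuts as ρ tends to 0

module LowDegree {n : ℕ} (s t : Fin n) (s≢t : s ≢ t) (d : ℕ) (4≤d : 4 ≤ d)
              (𝒢 : Candidates.Candidate s t s≢t d) where
  open Spokes s t s≢t
  open Terminals s t s≢t d
  open Paths s t s≢t d 4≤d
  open Comparison s t s≢t d
  open Candidates.Candidate 𝒢
  open Structure s t s≢t d 𝒢
  open Cuts s t s≢t d 4≤d
  open ≤-Reasoning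

  module _ (full : length inners ≤ length common) where
    open Full full

    private
      m = length es
      N = length inners

      open Expectation using () renaming (𝔼 to 𝔼ʷ)

      -- `few-or-cut`, summed over all states. The cuts at s and at t have at least `N + 1` edges
      -- each and leave at most `e + r` edges free; the other failing states have at most `e` edges.
      network-upper : ∀ {us r ℓ e} a → us ↭ inners → Network r ℓ us → e + (N + 1 + r) ≡ m → ℓ + (1 + 2 * N) ≤ m →
                      𝔼ʷ (suc a) 1 es fails [] ≤ 2 * suc (suc a) ^ (e + r) + 2 ^ m * suc (suc a) ^ e
      network-upper {us} {r} {ℓ} {e} a′ us↭ net e≡ ℓ≤ = ≤-trans (optimal-fails a 1 {es} optimal sL len (s≤s z≤n)) (begin
        𝔼ʷ a 1 L fails []
          ≤⟨ 𝔼-mono a 1 L fails _ [] [] (λ S uS S⊆ →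
               subst (λ z → fails z ≤ avoid (cross is-s) z + avoid (cross not-t) z + indicator (length z ≤? e)) (sym (++-identityʳ S))
                 (few-or-cut inn-us all-inner-us (Network.ends net) sL (Network.connected net) len-e S (uS (proj₁ sL)) S⊆)) ⟩
        𝔼ʷ a 1 L (λ S → avoid (cross is-s) S + avoid (cross not-t) S + indicator (length S ≤? e)) []
          ≡⟨ ≡.trans (𝔼-+ a 1 L (λ S → avoid (cross is-s) S + avoid (cross not-t) S) (λ S → indicator (length S ≤? e)) [])
               (cong (_+ 𝔼ʷ a 1 L (λ S → indicator (length S ≤? e)) []) (𝔼-+ a 1 L (avoid (cross is-s)) (avoid (cross not-t)) [])) ⟩
        𝔼ʷ a 1 L (avoid (cross is-s)) [] + 𝔼ʷ a 1 L (avoid (cross not-t)) [] + 𝔼ʷ a 1 L (λ S → indicator (length S ≤? e)) []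
          ≤⟨ +-mono-≤ (+-mono-≤ (𝔼-avoid-upper a (cross is-s) L (cut-count is-s is-s-s is-s-t) len-j)
                                (𝔼-avoid-upper a (cross not-t) L (cut-count not-t not-t-s not-t-t) len-j)) few ⟩
        K ^ (e + r) + K ^ (e + r) + 2 ^ m * K ^ e
          ≡⟨ cong (λ z → K ^ (e + r) + z + 2 ^ m * K ^ e) (+-identityʳ (K ^ (e + r))) ⟨
        2 * K ^ (e + r) + 2 ^ m * K ^ e ∎)
        where
        open Expectation using (𝔼-mono; 𝔼-+)
        a = suc a′
        K = suc a
        B = Network.edges net
        inn-us : All Inner us
        inn-us = All.tabulate λ u∈ → ∈-inners⁻ (∈-resp-↭ us↭ u∈)
        all-inner-us : ∀ {u} → Inner u → u ∈ us
        all-inner-us i = ∈-resp-↭ (↭-sym us↭) (∈-inners⁺ i)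
        |us| : length us ≡ N
        |us| = ↭-length us↭
        base-simple : Simple (B ++ core us)
        base-simple = ++-core-simple (Network.simple net)
          (All.map (λ (p , q) → All.lookup inn-us p , All.lookup inn-us q) (Network.ends net))
          (Unique-resp-↭ (↭-sym us↭) inners-unique) inn-us
        base-length : length (B ++ core us) ≡ ℓ + (1 + 2 * N)
        base-length = ≡.trans (length-++ B) (cong₂ _+_ (Network.size net)
          (≡.trans (length-core us) (cong (λ z → 1 + 2 * z) |us|)))
        extension : ∃[ R ] (Simple ((B ++ core us) ++ R) × length ((B ++ core us) ++ R) ≡ m)
        extension = extend base-simple (≤-trans (≤-reflexive base-length) ℓ≤) (Simple-length simple)
        R = proj₁ extension
        L = B ++ core us ++ R
        sL : Simple L
        sL = subst Simple (++-assoc B (core us) R) (proj₁ (proj₂ extension))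
        len : length L ≡ m
        len = ≡.trans (cong length (sym (++-assoc B (core us) R))) (proj₂ (proj₂ extension))
        len-e : e + (length us + 1 + r) ≡ length L
        len-e = ≡.trans (cong (λ z → e + (z + 1 + r)) |us|) (≡.trans e≡ (sym len))
        len-j : N + 1 + (e + r) ≡ length L
        len-j = ≡.trans (arith N e r) (≡.trans e≡ (sym len))
          where
          arith : ∀ N e r → N + 1 + (e + r) ≡ e + (N + 1 + r)
          arith = solve-∀
        cut-count : ∀ σ → σ s ≡ true → σ t ≡ false → N + 1 ≤ count (cross σ) L
        cut-count σ σs σt = begin
          N + 1
            ≡⟨ cong₂ (λ x y → x + (bit y + 0)) (≡.trans (sym |us|) (sym (spokes-cross σ us σs σt)))
                 (sym (cross-true σ s t σs σt)) ⟩
          count (cross σ) (spokes us) + count (cross σ) [ s ─ t ]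
            ≡⟨ count-++ (cross σ) (spokes us) [ s ─ t ] ⟨
          count (cross σ) (core us)
            ≤⟨ ≤-trans (m≤m+n _ (count (cross σ) R)) (m≤n+m _ (count (cross σ) B)) ⟩
          count (cross σ) B + (count (cross σ) (core us) + count (cross σ) R)
            ≡⟨ cong (count (cross σ) B +_) (count-++ (cross σ) (core us) R) ⟨
          count (cross σ) B + count (cross σ) (core us ++ R)
            ≡⟨ count-++ (cross σ) B (core us ++ R) ⟨
          count (cross σ) L ∎
        few : 𝔼ʷ a 1 L (λ S → indicator (length S ≤? e)) [] ≤ 2 ^ m * K ^ e
        few = begin
          𝔼ʷ a 1 L (λ S → indicator (length S ≤? e)) []
            ≡⟨ *-identityʳ _ ⟨
          𝔼ʷ a 1 L (λ S → indicator (length S ≤? e)) [] * 1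
            ≤⟨ 𝔼-few a L (λ S → indicator (length S ≤? e)) [] (a ^ e) weight ⟩
          2 ^ length L * a ^ e
            ≡⟨ cong (λ z → 2 ^ z * a ^ e) len ⟩
          2 ^ m * a ^ e
            ≤⟨ *-monoʳ-≤ (2 ^ m) (^-monoˡ-≤ e (n≤1+n a)) ⟩
          2 ^ m * K ^ e ∎
          where
          weight : ∀ S → indicator (length S ≤? e) * a ^ length S ≤ a ^ e
          weight S with length S ≤? e
          ... | yes le = ≤-trans (≤-reflexive (+-identityʳ _)) (^-monoʳ-≤ a le)
          ... | no _ = z≤n

      module Lower {v : Fin n} (iv : Inner v) (a : ℕ) where
        open Expectation {Edge n} a 1

        K = suc a
        δ = degree v F
        cs = common
        L = F ++ core cs

        |cs| : length cs ≡ N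
        |cs| = ↭-length common↭inners

        with-v : Fin n → Bool
        with-v u = is-s u ∨ ⌊ v Fin.≟ u ⌋

        with-v-s : with-v s ≡ true
        with-v-s rewrite is-s-s = refl

        with-v-t : with-v t ≡ false
        with-v-t rewrite is-s-t with v Fin.≟ t
        ... | yes refl = contradiction refl (proj₂ iv)
        ... | no _ = refl

        with-v-v : with-v v ≡ true
        with-v-v rewrite is-s-inner iv with v Fin.≟ v
        ... | yes _ = refl
        ... | no v≢v = contradiction refl v≢v

        with-v-other : ∀ {u} → Inner u → v ≢ u → with-v u ≡ false
        with-v-other {u} iu v≢u rewrite is-s-inner iu with v Fin.≟ u
        ... | yes v≡u = contradiction v≡u v≢u
        ... | no _ = refl

        F-s : count (cross is-s) F ≡ 0
        F-s = count-none (cross is-s) F λ {e} e∈ → cong₂ _xor_ (is-s-inner (proj₁ (All.lookup F-inner e∈)))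
                                                               (is-s-inner (proj₂ (All.lookup F-inner e∈)))

        F-t : count (cross not-t) F ≡ 0
        F-t = count-none (cross not-t) F λ {e} e∈ → cong₂ _xor_ (not-t-inner (proj₁ (All.lookup F-inner e∈)))
                                                                (not-t-inner (proj₂ (All.lookup F-inner e∈)))

        F-v : count (cross with-v) F ≡ δ
        F-v = count-cong F same
          where
          same : ∀ {e} → e ∈ F → cross with-v e ≡ ends? v e
          same {x , y} e∈ rewrite is-s-inner (proj₁ (All.lookup F-inner e∈)) | is-s-inner (proj₂ (All.lookup F-inner e∈))
            with v Fin.≟ x | v Fin.≟ y
          ... | yes refl | yes refl = contradiction (All.lookup F-proper e∈) (<-irrefl refl)
          ... | yes _ | no _ = refl
          ... | no _ | yes _ = refl
          ... | no _ | no _ = refl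

        count-L : ∀ φ → count φ L ≡ count φ F + (count φ (spokes cs) + (bit (φ (s ─ t)) + 0))
        count-L φ = ≡.trans (count-++ φ F (core cs)) (cong (count φ F +_) (count-++ φ (spokes cs) [ s ─ t ]))

        count-cut : ∀ σ → σ s ≡ true → σ t ≡ false → count (cross σ) L ≡ count (cross σ) F + (N + 1)
        count-cut σ σs σt = ≡.trans (count-L (cross σ)) (cong (count (cross σ) F +_)
          (cong₂ (λ x y → x + (bit y + 0)) (≡.trans (spokes-cross σ cs σs σt) |cs|) (cross-true σ s t σs σt)))

        _∪_ : (Edge n → Bool) → (Edge n → Bool) → Edge n → Bool
        (φ ∪ ψ) e = φ e ∨ ψ e

        union-bound : ∀ φ ψ {f g} → φ (s ─ t) ≡ true → f ≤ count (φ ∪ ψ) F → g ≤ count (φ ∪ ψ) (spokes cs) →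
                      f + (g + 1) ≤ count (φ ∪ ψ) L
        union-bound φ ψ {f} {g} st f≤ g≤ = ≤-trans
          (+-mono-≤ f≤ (+-mono-≤ g≤ (≤-reflexive (cong (λ z → bit (z ∨ ψ (s ─ t)) + 0) (sym st)))))
          (≤-reflexive (sym (count-L (φ ∪ ψ))))

        pair-≥ˢ : ∀ φ ψ u → φ (s ─ u) ≡ true → 1 ≤ pair (φ ∪ ψ) u
        pair-≥ˢ φ ψ u eq rewrite eq = s≤s z≤n

        pair-≥ᵗ : ∀ φ ψ u → φ (u ─ t) ≡ true → 1 ≤ pair (φ ∪ ψ) u
        pair-≥ᵗ φ ψ u eq rewrite eq = m≤n+m 1 _

        pair-2ˢ : ∀ φ ψ u → φ (s ─ u) ≡ true → ψ (u ─ t) ≡ true → 2 ≤ pair (φ ∪ ψ) u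
        pair-2ˢ φ ψ u eq eq′ rewrite eq | eq′ with φ (u ─ t)
        ... | true = ≤-refl
        ... | false = ≤-refl

        pair-2ᵗ : ∀ φ ψ u → φ (u ─ t) ≡ true → ψ (s ─ u) ≡ true → 2 ≤ pair (φ ∪ ψ) u
        pair-2ᵗ φ ψ u eq eq′ rewrite eq | eq′ with φ (s ─ u)
        ... | true = ≤-refl
        ... | false = ≤-refl

        Φs = cross is-s
        Φt = cross not-t
        Φv = cross with-v

        Φs-s : ∀ {u} → Inner u → Φs (s ─ u) ≡ true
        Φs-s {u} iu = cross-true is-s s u is-s-s (is-s-inner iu)

        Φt-t : ∀ {u} → Inner u → Φt (u ─ t) ≡ true
        Φt-t {u} iu = cross-true not-t u t (not-t-inner iu) not-t-t

        inner-cs : ∀ {u} → u ∈ cs → Inner u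
        inner-cs = All.lookup common-inner

        other : 2 ≤ N → ∃[ u ] (u ∈ cs × v ≢ u)
        other 2≤N = go cs common-unique (≤-trans 2≤N (≤-reflexive (sym |cs|)))
          where
          go : ∀ us → Unique us → 2 ≤ length us → ∃[ u ] (u ∈ us × v ≢ u)
          go (_ ∷ []) _ (s≤s ())
          go (x ∷ y ∷ us) ((x≢y ∷ _) ∷ _) _ with v Fin.≟ x
          ... | yes refl = y , there (here refl) , x≢y
          ... | no v≢x = x , here refl , v≢x

        -- Bonferroni for the cuts at s, at t and around s and v, which have `N + 1`, `N + 1` and
        -- `N + 1 + δ` edges. Any two of them together have at least `N + 2 + δ`, so the corrections
        -- are of order K^e only.
        lower : ∀ {e} → 2 ≤ N → δ < N → e + (N + 1 + suc δ) ≡ m →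
                2 * K ^ (e + suc δ) + K ^ suc e ≤ 𝔼 es fails [] + 3 * K ^ e
        lower {e} 2≤N δ<N e≡ = begin
          2 * K ^ (e + suc δ) + K ^ suc e
            ≡⟨ cong (λ z → K ^ (e + suc δ) + z + K ^ suc e) (+-identityʳ (K ^ (e + suc δ))) ⟩
          K ^ (e + suc δ) + K ^ (e + suc δ) + K ^ suc e
            ≤⟨ +-mono-≤ (+-mono-≤
                 (𝔼-avoid-lower a Φs L (≤-reflexive (≡.trans (count-cut is-s is-s-s is-s-t) (cong (_+ (N + 1)) F-s))) len₁)
                 (𝔼-avoid-lower a Φt L (≤-reflexive (≡.trans (count-cut not-t not-t-s not-t-t) (cong (_+ (N + 1)) F-t))) len₁))
                 (𝔼-avoid-lower a Φv L (≤-reflexive (≡.trans (count-cut with-v with-v-s with-v-t) (cong (_+ (N + 1)) F-v))) len₂) ⟩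
          𝔼 L (avoid Φs) [] + 𝔼 L (avoid Φt) [] + 𝔼 L (avoid Φv) []
            ≡⟨ ≡.trans (𝔼-+ L (λ S → avoid Φs S + avoid Φt S) (avoid Φv) []) (cong (_+ 𝔼 L (avoid Φv) []) (𝔼-+ L (avoid Φs) (avoid Φt) [])) ⟨
          𝔼 L (λ S → avoid Φs S + avoid Φt S + avoid Φv S) []
            ≤⟨ 𝔼-mono-all L [] pointwise ⟩
          𝔼 L (λ S → fails S + (avoid (Φs ∪ Φt) S + avoid (Φs ∪ Φv) S + avoid (Φt ∪ Φv) S)) []
            ≡⟨ ≡.trans (𝔼-+ L fails _ []) (cong (𝔼 L fails [] +_)
                 (≡.trans (𝔼-+ L (λ S → avoid (Φs ∪ Φt) S + avoid (Φs ∪ Φv) S) (avoid (Φt ∪ Φv)) [])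
                          (cong (_+ 𝔼 L (avoid (Φt ∪ Φv)) []) (𝔼-+ L (avoid (Φs ∪ Φt)) (avoid (Φs ∪ Φv)) [])))) ⟩
          𝔼 L fails [] + (𝔼 L (avoid (Φs ∪ Φt)) [] + 𝔼 L (avoid (Φs ∪ Φv)) [] + 𝔼 L (avoid (Φt ∪ Φv)) [])
            ≤⟨ +-monoʳ-≤ (𝔼 L fails [])
                 (+-mono-≤ (+-mono-≤ (𝔼-avoid-upper a (Φs ∪ Φt) L st-count len₃)
                                     (𝔼-avoid-upper a (Φs ∪ Φv) L sv-count len₃))
                           (𝔼-avoid-upper a (Φt ∪ Φv) L tv-count len₃)) ⟩
          𝔼 es fails [] + (K ^ e + K ^ e + K ^ e)
            ≡⟨ cong (𝔼 es fails [] +_) (triple (K ^ e)) ⟩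
          𝔼 es fails [] + 3 * K ^ e ∎
          where
          triple : ∀ x → x + x + x ≡ 3 * x
          triple = solve-∀
          |L| : length L ≡ m
          |L| = refl
          len₁ : 0 + (N + 1) + (e + suc δ) ≡ length L
          len₁ = ≡.trans (arith N e δ) (≡.trans e≡ (sym |L|))
            where
            arith : ∀ N e δ → N + 1 + (e + (1 + δ)) ≡ e + (N + 1 + (1 + δ))
            arith = solve-∀
          len₂ : δ + (N + 1) + suc e ≡ length L
          len₂ = ≡.trans (arith N e δ) (≡.trans e≡ (sym |L|))
            where
            arith : ∀ N e δ → δ + (N + 1) + (1 + e) ≡ e + (N + 1 + (1 + δ))
            arith = solve-∀
          len₃ : N + 1 + suc δ + e ≡ length L
          len₃ = ≡.trans (+-comm (N + 1 + suc δ) e) (≡.trans e≡ (sym |L|))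
          total : ∀ N δ → N + 1 + (1 + δ) ≡ δ + ((1 + N) + 1)
          total = solve-∀
          -- These are all `2 * N + 1` terminal edges, enough because `δ < N`.
          st-count : N + 1 + suc δ ≤ count (Φs ∪ Φt) L
          st-count = begin
            N + 1 + suc δ   ≤⟨ +-monoʳ-≤ (N + 1) δ<N ⟩
            N + 1 + N       ≡⟨ arith N ⟩
            0 + (N * 2 + 1) ≤⟨ union-bound Φs Φt (cross-true is-s s t is-s-s is-s-t) z≤n
                                 (≤-trans (≤-reflexive (cong (_* 2) (sym |cs|)))
                                   (spokes-≥ (Φs ∪ Φt) 2 cs λ {u} u∈ → pair-2ˢ Φs Φt u (Φs-s (inner-cs u∈)) (Φt-t (inner-cs u∈)))) ⟩
            count (Φs ∪ Φt) L ∎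
            where
            arith : ∀ N → N + 1 + N ≡ N * 2 + 1
            arith = solve-∀
          -- Beyond the edges at s and the `δ` edges at v there is the spoke from v to t.
          sv-count : N + 1 + suc δ ≤ count (Φs ∪ Φv) L
          sv-count = ≤-trans (≤-reflexive (total N δ)) (union-bound Φs Φv (cross-true is-s s t is-s-s is-s-t)
            (≤-trans (≤-reflexive (sym F-v)) (count-∨ʳ Φs Φv F))
            (≤-trans (≤-reflexive (cong suc (sym |cs|))) (spokes-> (Φs ∪ Φv) cs
              (λ {u} u∈ → pair-≥ˢ Φs Φv u (Φs-s (inner-cs u∈))) (inners⊆common iv)
              (pair-2ˢ Φs Φv v (Φs-s iv) (cross-true with-v v t with-v-v with-v-t)))))
          -- Here the additional edge is the spoke from s to a vertex `w` other than v.
          tv-count : N + 1 + suc δ ≤ count (Φt ∪ Φv) L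
          tv-count with other 2≤N
          ... | w , w∈ , v≢w = ≤-trans (≤-reflexive (total N δ)) (union-bound Φt Φv (cross-true not-t s t not-t-s not-t-t)
            (≤-trans (≤-reflexive (sym F-v)) (count-∨ʳ Φt Φv F))
            (≤-trans (≤-reflexive (cong suc (sym |cs|))) (spokes-> (Φt ∪ Φv) cs
              (λ {u} u∈ → pair-≥ᵗ Φt Φv u (Φt-t (inner-cs u∈))) w∈
              (pair-2ᵗ Φt Φv w (Φt-t (inner-cs w∈)) (cross-true with-v s w with-v-s (with-v-other (inner-cs w∈) v≢w))))))
          pointwise : ∀ S → avoid Φs S + avoid Φt S + avoid Φv S
                          ≤ fails S + (avoid (Φs ∪ Φt) S + avoid (Φs ∪ Φv) S + avoid (Φt ∪ Φv) S)
          pointwise S = ≤-trans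
            (bonferroni (fails S) (avoid-01 Φs S) (avoid-01 Φt S) (avoid-01 Φv S)
              (fails-avoid is-s is-s-s is-s-t) (fails-avoid not-t not-t-s not-t-t) (fails-avoid with-v with-v-s with-v-t))
            (≤-reflexive (cong (fails S +_) (sym (cong₂ _+_ (cong₂ _+_ (avoid-∨ Φs Φt S) (avoid-∨ Φs Φv S)) (avoid-∨ Φt Φv S)))))

    -- For small ρ the comparison is decided by the cut around s and v, which is
    -- smaller than every cut of the network other than those at s and at t.
    low-degree : ∀ {v us ℓ} → Inner v → 2 ≤ N → degree v F < N → us ↭ inners → Network (suc (degree v F)) ℓ us →
                 ℓ + (1 + 2 * N) ≤ m → ⊥
    low-degree {v} {us} {ℓ} iv 2≤N δ<N us↭ net ℓ≤ = contradiction K≤ (<⇒≱ (n<1+n _))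
      where
      δ = degree v F
      -- Chosen so that `K = 4 + 2 ^ m` exceeds `3 + 2 ^ m`, the total coefficient of the terms in
      -- K^e.
      a′ = 2 + 2 ^ m
      K = suc (suc a′)
      e = m ∸ (N + 1 + suc δ)
      e≡ : e + (N + 1 + suc δ) ≡ m
      e≡ = m∸n+n≡m (begin
        N + 1 + suc δ ≤⟨ +-monoʳ-≤ (N + 1) δ<N ⟩
        N + 1 + N     ≡⟨ arith N ⟩
        1 + 2 * N     ≤⟨ m≤n+m (1 + 2 * N) ℓ ⟩
        ℓ + (1 + 2 * N) ≤⟨ ℓ≤ ⟩
        m ∎)
        where
        arith : ∀ N → N + 1 + N ≡ 1 + 2 * N
        arith = solve-∀
      K≤ : K ≤ 3 + 2 ^ m
      K≤ = *-cancelʳ-≤ K (3 + 2 ^ m) (K ^ e) {{m^n≢0 K e}} (+-cancelˡ-≤ (2 * K ^ (e + suc δ)) _ _ (begin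
        2 * K ^ (e + suc δ) + K * K ^ e              ≤⟨ Lower.lower iv (suc a′) {e} 2≤N δ<N e≡ ⟩
        𝔼ʷ (suc a′) 1 es fails [] + 3 * K ^ e         ≤⟨ +-monoˡ-≤ (3 * K ^ e) (network-upper {e = e} a′ us↭ net e≡ ℓ≤) ⟩
        2 * K ^ (e + suc δ) + 2 ^ m * K ^ e + 3 * K ^ e ≡⟨ regroup (2 * K ^ (e + suc δ)) (2 ^ m) (K ^ e) ⟩
        2 * K ^ (e + suc δ) + (3 + 2 ^ m) * K ^ e    ∎))
        where
        regroup : ∀ x p k → x + p * k + 3 * k ≡ x + (3 + p) * k
        regroup = solve-∀

-- Moving an edge

-- Expansion of 𝔼 at a = 1 for large b in the number of retained elements: two
-- functions of which the first is at most τ larger are compared through their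
-- values at sublists with at most one element.
module Expansion {A : Set} (b : ℕ) .{{_ : NonZero b}} (Q : A → Set) (f g : List A → ℕ) (τ : ℕ)
                 (f≤g : ∀ S → All Q S → f S ≤ g S + τ) where
  open Expectation {A} 1 b
  open ≤-Reasoning

  private
    err : ℕ → ℕ
    err k = 2 ^ k * b ^ k * τ

    1≤b : 1 ≤ b
    1≤b = >-nonZero⁻¹ b

  expand₀ : ∀ es S → All Q es → All Q S → 𝔼 es f S ≤ 𝔼 es g S + err (length es)
  expand₀ [] S _ qS = ≤-trans (f≤g S qS) (≤-reflexive (cong (g S +_) (sym (+-identityʳ τ))))
  expand₀ (e ∷ es) S (q ∷ qs) qS = begin
    1 * 𝔼 es f (e ∷ S) + b * 𝔼 es f S
      ≤⟨ +-mono-≤ (*-monoʳ-≤ 1 (expand₀ es (e ∷ S) qs (q ∷ qS))) (*-monoʳ-≤ b (expand₀ es S qs qS)) ⟩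
    1 * (𝔼 es g (e ∷ S) + err k) + b * (𝔼 es g S + err k)
      ≡⟨ regroup b (𝔼 es g (e ∷ S)) (𝔼 es g S) (err k) ⟩
    𝔼 (e ∷ es) g S + (1 + b) * err k
      ≤⟨ +-monoʳ-≤ (𝔼 (e ∷ es) g S) (*-monoˡ-≤ (err k) (+-monoˡ-≤ b 1≤b)) ⟩
    𝔼 (e ∷ es) g S + (b + b) * err k
      ≡⟨ cong (𝔼 (e ∷ es) g S +_) (power b (2 ^ k) (b ^ k) τ) ⟩
    𝔼 (e ∷ es) g S + err (suc k) ∎
    where
    k = length es
    regroup : ∀ b p q r → 1 * (p + r) + b * (q + r) ≡ 1 * p + b * q + (1 + b) * r
    regroup = solve-∀
    power : ∀ b p q τ → (b + b) * (p * q * τ) ≡ 2 * p * (b * q) * τ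
    power = solve-∀

  expand₁ : ∀ es S → All Q es → All Q S →
            b * 𝔼 es f S + b * (b ^ length es * g S) ≤ b * 𝔼 es g S + b * (b ^ length es * f S) + err (length es)
  expand₁ [] S _ qS = begin
    b * f S + b * (1 * g S)      ≡⟨ flip-sum b (f S) (g S) ⟩
    b * g S + b * (1 * f S)      ≤⟨ m≤m+n _ (err 0) ⟩
    b * g S + b * (1 * f S) + err 0 ∎
    where
    flip-sum : ∀ b p q → b * p + b * (1 * q) ≡ b * q + b * (1 * p)
    flip-sum = solve-∀
  expand₁ (e ∷ es) S (q ∷ qs) qS = begin
    b * (1 * 𝔼 es f (e ∷ S) + b * 𝔼 es f S) + b * (b * b ^ k * g S)
      ≡⟨ regroup b (𝔼 es f (e ∷ S)) (𝔼 es f S) (b ^ k) (g S) ⟩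
    b * 𝔼 es f (e ∷ S) + b * (b * 𝔼 es f S + b * (b ^ k * g S))
      ≤⟨ +-mono-≤ (*-monoʳ-≤ b (expand₀ es (e ∷ S) qs (q ∷ qS))) (*-monoʳ-≤ b (expand₁ es S qs qS)) ⟩
    b * (𝔼 es g (e ∷ S) + err k) + b * (b * 𝔼 es g S + b * (b ^ k * f S) + err k)
      ≡⟨ regroup′ b (𝔼 es g (e ∷ S)) (𝔼 es g S) (b ^ k) (f S) (2 ^ k) τ ⟩
    b * (1 * 𝔼 es g (e ∷ S) + b * 𝔼 es g S) + b * (b * b ^ k * f S) + err (suc k) ∎
    where
    k = length es
    regroup : ∀ b p q r s → b * (1 * p + b * q) + b * (b * r * s) ≡ b * p + b * (b * q + b * (r * s))
    regroup = solve-∀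
    regroup′ : ∀ b p q r s t τ → b * (p + t * r * τ) + b * (b * q + b * (r * s) + t * r * τ)
             ≡ b * (1 * p + b * q) + b * (b * r * s) + 2 * t * (b * r) * τ
    regroup′ = solve-∀

  firsts : (List A → ℕ) → List A → List A → ℕ
  firsts h es S = sum (map (λ e → h (e ∷ S)) es)

  -- Divided by b², with `k = length es`, this bounds 𝔼 f - 𝔼 g by b^k (f - g) at `S`, plus b^(k-1)
  -- times the sum of f - g at all `e ∷ S`, plus 2^k b^(k-2) τ; terms are moved across to avoid
  -- subtraction. A kept element leaves one order less to expand, hence `expand₁` and `expand₀`.
  expand₂ : ∀ es S → All Q es → All Q S →
            b * b * 𝔼 es f S + (b * b * (b ^ length es * g S) + b * (b ^ length es * firsts g es S))
          ≤ b * b * 𝔼 es g S + (b * b * (b ^ length es * f S) + b * (b ^ length es * firsts f es S)) + err (length es)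
  expand₂ [] S _ qS = begin
    b * b * f S + (b * b * (1 * g S) + b * 0)      ≡⟨ flip-sum b (f S) (g S) ⟩
    b * b * g S + (b * b * (1 * f S) + b * 0)      ≤⟨ m≤m+n _ (err 0) ⟩
    b * b * g S + (b * b * (1 * f S) + b * 0) + err 0 ∎
    where
    flip-sum : ∀ b p q → b * b * p + (b * b * (1 * q) + b * 0) ≡ b * b * q + (b * b * (1 * p) + b * 0)
    flip-sum = solve-∀
  expand₂ (e ∷ es) S (q ∷ qs) qS = begin
    b * b * (1 * 𝔼 es f (e ∷ S) + b * 𝔼 es f S)
    + (b * b * (b * b ^ k * g S) + b * (b * b ^ k * (g (e ∷ S) + firsts g es S)))
      ≡⟨ regroup b (𝔼 es f (e ∷ S)) (𝔼 es f S) (b ^ k) (g S) (g (e ∷ S)) (firsts g es S) ⟩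
    b * (b * 𝔼 es f (e ∷ S) + b * (b ^ k * g (e ∷ S)))
    + b * (b * b * 𝔼 es f S + (b * b * (b ^ k * g S) + b * (b ^ k * firsts g es S)))
      ≤⟨ +-mono-≤ (*-monoʳ-≤ b (expand₁ es (e ∷ S) qs (q ∷ qS))) (*-monoʳ-≤ b (expand₂ es S qs qS)) ⟩
    b * (b * 𝔼 es g (e ∷ S) + b * (b ^ k * f (e ∷ S)) + err k)
    + b * (b * b * 𝔼 es g S + (b * b * (b ^ k * f S) + b * (b ^ k * firsts f es S)) + err k)
      ≡⟨ regroup′ b (𝔼 es g (e ∷ S)) (𝔼 es g S) (b ^ k) (f S) (f (e ∷ S)) (firsts f es S) (2 ^ k) τ ⟩
    b * b * (1 * 𝔼 es g (e ∷ S) + b * 𝔼 es g S)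
    + (b * b * (b * b ^ k * f S) + b * (b * b ^ k * (f (e ∷ S) + firsts f es S))) + err (suc k) ∎
    where
    k = length es
    regroup : ∀ b p q r s t u → b * b * (1 * p + b * q) + (b * b * (b * r * s) + b * (b * r * (t + u)))
            ≡ b * (b * p + b * (r * t)) + b * (b * b * q + (b * b * (r * s) + b * (r * u)))
    regroup = solve-∀
    regroup′ : ∀ b p q r s t u v τ →
        b * (b * p + b * (r * t) + v * r * τ) + b * (b * b * q + (b * b * (r * s) + b * (r * u)) + v * r * τ)
      ≡ b * b * (1 * p + b * q) + (b * b * (b * r * s) + b * (b * r * (t + u))) + 2 * v * (b * r) * τ
    regroup′ = solve-∀

-- Blocks of sizes 2, 2 against 3, 1: the gain from moving an edge.
block-spread : ∀ b → block 1 b 2 * block 1 b 2 ≡ block 1 b 3 * block 1 b 1 + 2 * (b * b * b * b * b) * (1 + b)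
block-spread = identity
  where
  identity : ∀ b →
    let k = b * (1 + b)
        b₁ = 1 * (b * 1) + b * (1 * 1 + b * 1)
        b₂ = 1 * (b * (k * 1)) + b * (1 * (k * 1) + b * b₁)
        b₃ = 1 * (b * (k * (k * 1))) + b * (1 * (k * (k * 1)) + b * b₂)
    in b₂ * b₂ ≡ b₃ * b₁ + 2 * (b * b * b * b * b) * (1 + b)
  identity = solve-∀

level : ℕ → ℕ → Bool → ℕ
level p q c = if c then p else q

levels : ∀ {A : Set} {p q γ} → q ≡ p + γ → ∀ (φ : A → Bool) xs →
         sum (map (level p q ∘ φ) xs) + count φ xs * γ ≡ length xs * q
levels q≡ φ [] = refl
levels {p = p} {q} {γ} q≡ φ (x ∷ xs) with φ x
... | true = ≡.trans (exchange p (sum (map (level p q ∘ φ) xs)) γ (count φ xs * γ))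
                     (cong₂ _+_ (sym q≡) (levels q≡ φ xs))
  where
  exchange : ∀ a b c d → a + b + (c + d) ≡ a + c + (b + d)
  exchange = solve-∀
... | false = ≡.trans (+-assoc q _ _) (cong (q +_) (levels q≡ φ xs))

-- The first-order gain from moving an edge

module Swap {n : ℕ} (s t : Fin n) (s≢t : s ≢ t) (d : ℕ) (4≤d : 4 ≤ d)
              (𝒢 : Candidates.Candidate s t s≢t d) where
  open Spokes s t s≢t
  open Terminals s t s≢t d
  open Paths s t s≢t d 4≤d
  open Comparison s t s≢t d
  open Candidates.Candidate 𝒢
  open Structure s t s≢t d 𝒢

  private
    last-edge : ∀ {S : List (Edge n)} {u w : Fin n} {k} → Walk (Joins S) u w (suc k) → ∃[ z ] (z ─ w ∈ S)
    last-edge {u = u} (cons j nil) = u , j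
    last-edge (cons _ (cons j p)) = last-edge (cons j p)

    -- A path leaves s and enters t by terminal edges, which must lie in `S`. They are distinct, for
    -- st itself would make the state with `f` work as well.
    two-terminal : ∀ {S A e f} → All InnerEdge A → InnerEdge e → ShortPath ((S ++ A) ++ [ e ]) →
                   ¬ ShortPath ((S ++ A) ++ [ f ]) → 2 ≤ length S
    two-terminal inA ie (zero , _ , nil , _) _ = contradiction refl s≢t
    two-terminal {S} {A} {e} {f} inA ie (suc k , _ , p@(cons {v = y} j _) , _) ¬path with last-edge p
    ... | z , l = Unique-⊆-length {xs = s ─ y ∷ z ─ t ∷ []} ((distinct ∷ []) ∷ [] ∷ [])
      λ { (here refl) → sy∈ ; (there (here refl)) → zt∈ }
      where
      outer∈ : ∀ {g} → ¬ InnerEdge g → g ∈ (S ++ A) ++ [ e ] → g ∈ S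
      outer∈ ¬ig g∈ with ∈-++⁻ (S ++ A) g∈
      ... | inj₂ (here refl) = contradiction ie ¬ig
      ... | inj₁ g∈′ with ∈-++⁻ S g∈′
      ... | inj₁ g∈S = g∈S
      ... | inj₂ g∈A = contradiction (All.lookup inA g∈A) ¬ig
      sy∈ : s ─ y ∈ S
      sy∈ = outer∈ (s─-outer y) j
      zt∈ : z ─ t ∈ S
      zt∈ = outer∈ (─t-outer z) l
      distinct : s ─ y ≢ z ─ t
      distinct eq with ─-injective eq
      ... | inj₂ (s≡t , _) = s≢t s≡t
      ... | inj₁ (_ , refl) = ¬path (path₁ (∈-++⁺ˡ (∈-++⁺ˡ sy∈)))

  module _ (full : length inners ≤ length common) where
    open Full full

    module _ {u v x : Fin n} (iu : Inner u) (iv : Inner v) (ix : Inner x) (uv∈ : u ─ v ∈ F) (u≢x : u ≢ x) (ux∉ : u ─ x ∉ F) where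

      private
        F↭ : ∃[ F₀ ] F ↭ u ─ v ∷ F₀
        F↭ = ∈⇒↭ uv∈

        F₀ = proj₁ F↭
        F↭₀ = proj₂ F↭
        cs = common
        N = length cs
        k₀ = length F₀
        L₀ = F₀ ++ core cs
        len-core = length (core cs)

        F₀⊆F : ∀ {e} → e ∈ F₀ → e ∈ F
        F₀⊆F e∈ = ∈-resp-↭ (↭-sym F↭₀) (there e∈)

        uv∉F₀ : u ─ v ∉ F₀
        uv∉F₀ with Unique-resp-↭ F↭₀ F-unique
        ... | uv∉ ∷ _ = All¬⇒¬Any uv∉

        F₀-inner : All InnerEdge F₀
        F₀-inner = All.tabulate (All.lookup F-inner ∘ F₀⊆F)

        es↭₀ : es ↭ u ─ v ∷ L₀
        es↭₀ = (++⁺ʳ (core cs) F↭₀)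

        u≢v : u ≢ v
        u≢v refl = <-irrefl refl (subst (λ e → proj₁ e Fin.< proj₂ e) (loop u) (All.lookup F-proper uv∈))
          where
          loop : ∀ u → u ─ u ≡ (u , u)
          loop u with ─-either u u
          ... | inj₁ p = p
          ... | inj₂ p = p

        swapped : Simple (u ─ x ∷ L₀)
        swapped = (¬Any⇒All¬ L₀ fresh ∷ AllPairs.tail (proj₁ original)) , (─-proper u≢x ∷ All.tail (proj₂ original))
          where
          original : Simple (u ─ v ∷ L₀)
          original = Simple-resp-↭ es↭₀ simple
          fresh : u ─ x ∉ L₀
          fresh e∈ with ∈-++⁻ F₀ e∈
          ... | inj₁ e∈F = ux∉ (F₀⊆F e∈F)
          ... | inj₂ e∈c = core-outer {us = cs} e∈c (inner-edge iu ix)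

        K = k₀ + len-core

        module Weighted (b : ℕ) {{_ : NonZero b}} where

          open Expectation {Edge n} 1 b
          open Blocks s t s≢t d 4≤d 1 b
          open ≤-Reasoning

          value : Fin n → List (Edge n) → ℕ
          value y A = 𝔼 (core cs) (λ S → fails (S ++ [ u ─ y ])) A

          value≡ : ∀ y A → 𝔼 (core cs) fails (A ++ [ u ─ y ]) ≡ value y A
          value≡ y A = 𝔼-context (core cs) fails A [ u ─ y ]

          τ = 2 ^ len-core * b ^ (len-core ∸ 2)

          3≤len-core : 1 ≤ N → 2 ≤ len-core
          3≤len-core 1≤N = ≤-trans (≤-trans (s≤s (s≤s z≤n)) (+-monoʳ-≤ 1 (*-monoʳ-≤ 2 1≤N))) (≤-reflexive (sym (length-core cs)))

          -- By `two-terminal`, replacing uv by ux matters only in states with at least two terminal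
          -- edges, whose total weight is at most `τ`.
          value-close : 1 ≤ N → ∀ A → All InnerEdge A → value x A ≤ value v A + τ
          value-close 1≤N A inA = begin
            value x A
              ≤⟨ 𝔼-mono (core cs) _ _ A A (λ S _ _ → pointwise S) ⟩
            𝔼 (core cs) (λ S → fails (S ++ [ u ─ v ]) + large (2 + length A) S) A
              ≡⟨ 𝔼-+ (core cs) (λ S → fails (S ++ [ u ─ v ])) (large (2 + length A)) A ⟩
            value v A + 𝔼 (core cs) (large (2 + length A)) A
              ≤⟨ +-monoʳ-≤ (value v A) (*-cancelʳ-≤ _ τ (b ^ (2 + length A)) {{m^n≢0 b (2 + length A)}} (begin
                   𝔼 (core cs) (large (2 + length A)) A * b ^ (2 + length A)
                     ≤⟨ 𝔼-many b (core cs) (large (2 + length A)) A (2 + length A) (large-≤ b (2 + length A)) ⟩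
                   2 ^ len-core * b ^ (len-core + length A)
                     ≡⟨ cong (λ z → 2 ^ len-core * b ^ z) exponent ⟩
                   2 ^ len-core * b ^ (len-core ∸ 2 + (2 + length A))
                     ≡⟨ cong (2 ^ len-core *_) (^-distribˡ-+-* b (len-core ∸ 2) (2 + length A)) ⟩
                   2 ^ len-core * (b ^ (len-core ∸ 2) * b ^ (2 + length A))
                     ≡⟨ *-assoc (2 ^ len-core) _ _ ⟨
                   τ * b ^ (2 + length A) ∎)) ⟩
            value v A + τ ∎
            where
            exponent : len-core + length A ≡ len-core ∸ 2 + (2 + length A)
            exponent = ≡.trans (cong (_+ length A) (sym (m∸n+n≡m (3≤len-core 1≤N)))) (+-assoc (len-core ∸ 2) 2 (length A))
            pointwise : ∀ S → fails ((S ++ A) ++ [ u ─ x ]) ≤ fails ((S ++ A) ++ [ u ─ v ]) + large (2 + length A) (S ++ A)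
            pointwise S = fails-≤ λ ¬path → by ¬path (shortPath? ((S ++ A) ++ [ u ─ v ]))
              where
              by : ¬ ShortPath ((S ++ A) ++ [ u ─ x ]) → Dec (ShortPath ((S ++ A) ++ [ u ─ v ])) →
                   1 ≤ fails ((S ++ A) ++ [ u ─ v ]) + large (2 + length A) (S ++ A)
              by ¬path (no ¬p) = ≤-trans (≤-reflexive (sym (fails-no ¬p))) (m≤m+n _ _)
              by ¬path (yes p) = ≤-trans (≤-reflexive (sym (indicator-yes (2 + length A ≤? length (S ++ A))
                (≤-trans (+-monoˡ-≤ (length A) (two-terminal {S = S} inA (inner-edge iu iv) p ¬path)) (≤-reflexive (sym (length-++ S)))))))
                (m≤n+m _ (fails ((S ++ A) ++ [ u ─ v ])))

          -- When the moved edge is dropped the two graphs coincide, so optimality compares just the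
          -- states that retain it.
          worse : 𝔼 F₀ (value v) [] ≤ 𝔼 F₀ (value x) []
          worse = ≤-trans (≤-reflexive (sym (unfold v))) (≤-trans step (≤-reflexive (unfold x)))
            where
            unfold : ∀ y → 𝔼 L₀ fails [ u ─ y ] ≡ 𝔼 F₀ (value y) []
            unfold y = ≡.trans (𝔼-++ F₀ (core cs) fails [ u ─ y ]) (≡.trans (𝔼-context F₀ (𝔼 (core cs) fails) [] [ u ─ y ])
              (≤-antisym (𝔼-mono-all F₀ [] (λ S → ≤-reflexive (value≡ y S))) (𝔼-mono-all F₀ [] (λ S → ≤-reflexive (sym (value≡ y S))))))
            step : 𝔼 L₀ fails [ u ─ v ] ≤ 𝔼 L₀ fails [ u ─ x ]
            step = *-cancelˡ-≤ 1 (+-cancelʳ-≤ (b * 𝔼 L₀ fails []) _ _ (begin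
              1 * 𝔼 L₀ fails [ u ─ v ] + b * 𝔼 L₀ fails [] ≡⟨ 𝔼-↭ fails fails-↭ es↭₀ [] ⟨
              𝔼 es fails []                                ≤⟨ optimal-fails 1 b {es} optimal swapped (sym (↭-length es↭₀)) (s≤s z≤n) ⟩
              1 * 𝔼 L₀ fails [ u ─ x ] + b * 𝔼 L₀ fails [] ∎))

          -- Blocks that contain the edges of `X` and are tight for them: `lower-within` and
          -- `upper-tight` meet, and the weight is exactly `h`.
          record Partition (y : Fin n) (X : List (Edge n)) (h : ℕ) : Set where
            field
              bs     : List (List (Fin n))
              bs↭    : concat bs ↭ cs
              weight : blocks 1 b bs * b ≡ h
              tight  : All (Tight X) bs
              within : All (Within bs) X

          partition-≥ : ∀ {y X h} → Partition y X h → h ≤ 𝔼 (core cs) fails X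
          partition-≥ {X = X} p = ≤-trans (≤-reflexive (sym weight)) (lower-within common-unique common-inner bs X bs↭ within)
            where open Partition p

          partition-≤ : ∀ {y X h} → Partition y X h → 𝔼 (core cs) fails X ≤ h
          partition-≤ {X = X} p = ≤-trans (upper-tight bs X bs↭ tight) (≤-reflexive weight)
            where open Partition p

          N′ = N ∸ 4
          β₁ = block 1 b 1
          rest^ = β₁ ^ N′
          -- The failing weights when uy is retained alone (`h₀`), with an edge sharing one of its
          -- ends (`hα`), and with a disjoint edge (`hβ`); `γ` is the advantage of `hα` over `hβ`.
          h₀ = block 1 b 2 * (β₁ * (β₁ * rest^)) * b
          hα = block 1 b 3 * (β₁ * rest^) * b
          hβ = block 1 b 2 * (block 1 b 2 * rest^) * b
          γ = 2 * (b * b * b * b * b) * (1 + b) * rest^ * b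

          hβ≡ : hβ ≡ hα + γ
          hβ≡ = begin-equality
            block 1 b 2 * (block 1 b 2 * rest^) * b
              ≡⟨ assoc₁ (block 1 b 2) (block 1 b 2) rest^ b ⟩
            block 1 b 2 * block 1 b 2 * (rest^ * b)
              ≡⟨ cong (_* (rest^ * b)) (block-spread b) ⟩
            (block 1 b 3 * β₁ + 2 * (b * b * b * b * b) * (1 + b)) * (rest^ * b)
              ≡⟨ assoc₂ (block 1 b 3) β₁ (2 * (b * b * b * b * b) * (1 + b)) rest^ b ⟩
            hα + γ ∎
            where
            assoc₁ : ∀ p q r b → p * (q * r) * b ≡ p * q * (r * b)
            assoc₁ = solve-∀
            assoc₂ : ∀ p q w r b → (p * q + w) * (r * b) ≡ p * (q * r) * b + w * r * b
            assoc₂ = solve-∀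

          singles : ∀ (ws : List (Fin n)) → blocks 1 b (map [_] ws) ≡ β₁ ^ length ws
          singles [] = refl
          singles (_ ∷ ws) = cong (β₁ *_) (singles ws)

          single-tight : ∀ {X ws} → All Inner ws → All (Tight X) (map [_] ws)
          single-tight is = All.map⁺ (All.map tight-single is)

          inner-cs : ∀ {w} → w ∈ cs → Inner w
          inner-cs = All.lookup common-inner

          rest-inner : ∀ {ws zs} → cs ↭ ws ++ zs → All Inner zs
          rest-inner {ws} p = All.tabulate λ z∈ → inner-cs (∈-resp-↭ (↭-sym p) (∈-++⁺ʳ ws z∈))

          within-head : ∀ {ys : List (Fin n)} {bs p q} → p ∈ ys → q ∈ ys → Within (ys ∷ bs) (p ─ q)
          within-head {ys} {bs} {p} {q} p∈ q∈ = ys , here refl , ─-ends {P = _∈ ys} p∈ q∈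

          star₃ : 4 ≤ N → ∀ {c l w} y X → Inner c → Inner l → Inner w → c ≢ l → c ≢ w → l ≢ w →
                  (∀ {e} → e ∈ X → e ≡ c ─ l ⊎ e ≡ c ─ w) → c ─ l ∈ X → c ─ w ∈ X → Partition y X hα
          star₃ 4≤N {c} {l} {w} y X ic il iw c≢l c≢w l≢w X⊆ cl cw = build (proj₁ split) (proj₂ split)
            where
            ys = c ∷ l ∷ w ∷ []
            split : ∃[ zs ] cs ↭ ys ++ zs
            split = ⊆⇒↭ ((c≢l ∷ c≢w ∷ []) ∷ (l≢w ∷ []) ∷ [] ∷ []) (inners⊆common ∘ All.lookup (ic ∷ il ∷ iw ∷ []))
            attached : ∀ {z} → z ∈ ys → z ≢ c → c ─ z ∈ X
            attached (here refl) ne = contradiction refl ne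
            attached (there (here refl)) _ = cl
            attached (there (there (here refl))) _ = cw
            build : ∀ zs → cs ↭ ys ++ zs → Partition y X hα
            build zs cs↭ = record
              { bs = ys ∷ map [_] zs
              ; bs↭ = ↭-trans (↭-reflexive (cong (ys ++_) (concat-singletons zs))) (↭-sym cs↭)
              ; weight = weigh₃ zs (+-cancelˡ-≡ 3 _ _ (≡.trans (sym (↭-length cs↭)) (sym (m+[n∸m]≡n 4≤N))))
              ; tight = tight-star (here refl) (All.lookup (ic ∷ il ∷ iw ∷ [])) attached ∷ single-tight (rest-inner {ys} cs↭)
              ; within = All.tabulate λ e∈ → in-block (X⊆ e∈)
              }
              where
              weigh₃ : ∀ zs → length zs ≡ suc N′ → blocks 1 b (ys ∷ map [_] zs) * b ≡ hα
              weigh₃ zs len = cong (λ z → block 1 b 3 * z * b) (≡.trans (singles zs) (cong (β₁ ^_) len))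
              in-block : ∀ {e} → e ≡ c ─ l ⊎ e ≡ c ─ w → Within (ys ∷ map [_] zs) e
              in-block (inj₁ refl) = within-head (here refl) (there (here refl))
              in-block (inj₂ refl) = within-head (here refl) (there (there (here refl)))

          tight-pair : ∀ {X p q} → Inner p → Inner q → p ─ q ∈ X → Tight X (p ∷ q ∷ [])
          tight-pair ip iq pq = tight-star (here refl) (λ { (here refl) → ip ; (there (here refl)) → iq })
            (λ { (here refl) ne → contradiction refl ne ; (there (here refl)) _ → pq })

          pairs₂ : 4 ≤ N → ∀ {y p q} → Inner y → Inner p → Inner q → u ≢ y → u ≢ p → u ≢ q → y ≢ p → y ≢ q → p ≢ q →
                   Partition y (p ─ q ∷ u ─ y ∷ []) hβ
          pairs₂ 4≤N {y} {p} {q} iy ip iq u≢y u≢p u≢q y≢p y≢q p≢q = build (proj₁ split) (proj₂ split)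
            where
            ys = u ∷ y ∷ []
            ws = p ∷ q ∷ []
            split : ∃[ zs ] cs ↭ (ys ++ ws) ++ zs
            split = ⊆⇒↭ ((u≢y ∷ u≢p ∷ u≢q ∷ []) ∷ (y≢p ∷ y≢q ∷ []) ∷ (p≢q ∷ []) ∷ [] ∷ [])
                        (inners⊆common ∘ All.lookup (iu ∷ iy ∷ ip ∷ iq ∷ []))
            build : ∀ zs → cs ↭ (ys ++ ws) ++ zs → Partition y (p ─ q ∷ u ─ y ∷ []) hβ
            build zs cs↭ = record
              { bs = ys ∷ ws ∷ map [_] zs
              ; bs↭ = ↭-trans (↭-reflexive (cong (λ z → ys ++ ws ++ z) (concat-singletons zs))) (↭-sym cs↭)
              ; weight = weigh (+-cancelˡ-≡ 4 _ _ (≡.trans (sym (↭-length cs↭)) (sym (m+[n∸m]≡n 4≤N))))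
              ; tight = tight-pair iu iy (there (here refl)) ∷ tight-pair ip iq (here refl)
                  ∷ single-tight (rest-inner {ys ++ ws} cs↭)
              ; within = second (within-head (here refl) (there (here refl))) ∷ within-head (here refl) (there (here refl)) ∷ []
              }
              where
              weigh : length zs ≡ N′ → blocks 1 b (ys ∷ ws ∷ map [_] zs) * b ≡ hβ
              weigh len = cong (λ z → block 1 b 2 * (block 1 b 2 * z) * b) (≡.trans (singles zs) (cong (β₁ ^_) len))
              second : ∀ {ys : List (Fin n)} {bs e} → Within bs e → Within (ys ∷ bs) e
              second (ws , ws∈ , r) = ws , there ws∈ , r

          pair₀ : 4 ≤ N → ∀ {y} → Inner y → u ≢ y → Partition y [ u ─ y ] h₀
          pair₀ 4≤N {y} iy u≢y = build (proj₁ split) (proj₂ split)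
            where
            ys = u ∷ y ∷ []
            split : ∃[ zs ] cs ↭ ys ++ zs
            split = ⊆⇒↭ ((u≢y ∷ []) ∷ [] ∷ []) (inners⊆common ∘ All.lookup (iu ∷ iy ∷ []))
            build : ∀ zs → cs ↭ ys ++ zs → Partition y [ u ─ y ] h₀
            build zs cs↭ = record
              { bs = ys ∷ map [_] zs
              ; bs↭ = ↭-trans (↭-reflexive (cong (ys ++_) (concat-singletons zs))) (↭-sym cs↭)
              ; weight = weigh (+-cancelˡ-≡ 2 _ _ (≡.trans (sym (↭-length cs↭)) (sym (m+[n∸m]≡n 4≤N))))
              ; tight = tight-pair iu iy (here refl) ∷ single-tight (rest-inner {ys} cs↭)
              ; within = within-head (here refl) (there (here refl)) ∷ []
              }
              where
              weigh : length zs ≡ 2 + N′ → blocks 1 b (ys ∷ map [_] zs) * b ≡ h₀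
              weigh len = cong (λ z → block 1 b 2 * z * b) (≡.trans (singles zs) (cong (β₁ ^_) len))

          touches : Fin n → Edge n → Bool
          touches y e = ends? u e ∨ ends? y e

          partition-by : 4 ≤ N → ∀ {y p q} → Inner y → Inner p → Inner q → u ≢ y → p ≢ q → p ─ q ≢ u ─ y →
            (u≟p : Dec (u ≡ p)) (u≟q : Dec (u ≡ q)) (y≟p : Dec (y ≡ p)) (y≟q : Dec (y ≡ q)) →
            Partition y (p ─ q ∷ u ─ y ∷ []) (level hα hβ ((⌊ u≟p ⌋ ∨ ⌊ u≟q ⌋) ∨ (⌊ y≟p ⌋ ∨ ⌊ y≟q ⌋)))
          partition-by _ _ _ _ _ _ ne (yes refl) _ _ (yes refl) = contradiction refl ne
          partition-by _ _ _ _ u≢y _ _ (yes refl) _ (yes refl) _ = contradiction refl u≢y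
          partition-by 4≤N {y} iy ip iq u≢y p≢q _ (yes refl) _ (no y≢p) (no y≢q) = star₃ 4≤N y _ iu iy iq u≢y p≢q y≢q
            (λ { (here refl) → inj₂ refl ; (there (here refl)) → inj₁ refl }) (there (here refl)) (here refl)
          partition-by _ {y} _ _ _ _ _ ne (no _) (yes refl) (yes refl) _ = contradiction (─-comm y u) ne
          partition-by _ _ _ _ u≢y _ _ (no _) (yes refl) (no _) (yes refl) = contradiction refl u≢y
          partition-by 4≤N {y} {p} iy ip iq u≢y _ _ (no u≢p) (yes refl) (no y≢p) (no _) = star₃ 4≤N y _ iu iy ip u≢y u≢p y≢p
            (λ { (here refl) → inj₂ (─-comm p u) ; (there (here refl)) → inj₁ refl }) (there (here refl)) (here (─-comm u p))
          partition-by 4≤N {y} iy ip iq u≢y p≢q _ (no u≢p) (no u≢q) (yes refl) _ = star₃ 4≤N y _ iy iu iq (u≢y ∘ sym) p≢q u≢q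
            (λ { (here refl) → inj₂ refl ; (there (here refl)) → inj₁ (─-comm u y) }) (there (here (─-comm y u))) (here refl)
          partition-by 4≤N {y} {p} iy ip iq u≢y _ _ (no u≢p) (no u≢q) (no y≢p) (yes refl) = star₃ 4≤N y _ iy iu ip (u≢y ∘ sym) y≢p u≢p
            (λ { (here refl) → inj₂ (─-comm p y) ; (there (here refl)) → inj₁ (─-comm u y) }) (there (here (─-comm y u))) (here (─-comm y p))
          partition-by 4≤N iy ip iq u≢y p≢q _ (no u≢p) (no u≢q) (no y≢p) (no y≢q) = pairs₂ 4≤N iy ip iq u≢y u≢p u≢q y≢p y≢q p≢q

          partition : 4 ≤ N → ∀ {y} → Inner y → u ≢ y → ∀ e → Proper e → InnerEdge e → e ≢ u ─ y →
                      Partition y (e ∷ u ─ y ∷ []) (level hα hβ (touches y e))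
          partition 4≤N {y} iy u≢y (p , q) p<q (ip , iq) ne =
            subst (λ e → Partition y (e ∷ u ─ y ∷ []) (level hα hβ (touches y (p , q)))) (─-proper-≡ p<q)
              (partition-by 4≤N iy ip iq u≢y (Fin.<⇒≢ p<q) (ne ∘ ≡.trans (sym (─-proper-≡ p<q)))
                (u Fin.≟ p) (u Fin.≟ q) (y Fin.≟ p) (y Fin.≟ q))

          count-touches : ∀ {y} → u ≢ y → ∀ G → All Proper G → u ─ y ∉ G → count (touches y) G ≡ degree u G + degree y G
          count-touches u≢y [] _ _ = refl
          count-touches {y} u≢y (e@(p , q) ∷ G) (p<q ∷ pG) ∉ = ≡.trans
            (cong₂ _+_ exclusive (count-touches u≢y G pG (∉ ∘ there)))
            (exchange (bit (ends? u e)) (bit (ends? y e)) (degree u G) (degree y G))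
            where
            exchange : ∀ a b c d → a + b + (c + d) ≡ a + c + (b + d)
            exchange = solve-∀
            exclusive : bit (touches y e) ≡ bit (ends? u e) + bit (ends? y e)
            exclusive with u Fin.≟ p | u Fin.≟ q | y Fin.≟ p | y Fin.≟ q
            ... | yes refl | _ | yes refl | _ = contradiction refl u≢y
            ... | yes refl | _ | no _ | yes refl = contradiction (here (─-proper-≡ p<q)) ∉
            ... | yes refl | _ | no _ | no _ = refl
            ... | no _ | yes refl | yes refl | _ = contradiction (here (≡.trans (─-comm u y) (─-proper-≡ p<q))) ∉
            ... | no _ | yes refl | no _ | yes refl = contradiction refl u≢y
            ... | no _ | yes refl | no _ | no _ = refl
            ... | no _ | no _ | yes _ | _ = refl
            ... | no _ | no _ | no _ | yes _ = refl
            ... | no _ | no _ | no _ | no _ = refl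

          firsts-sum : ∀ (f g : Edge n → ℕ) G → (∀ {e} → e ∈ G → f e ≤ g e) → sum (map f G) ≤ sum (map g G)
          firsts-sum f g [] _ = z≤n
          firsts-sum f g (e ∷ G) le = +-mono-≤ (le (here refl)) (firsts-sum f g G (le ∘ there))

          F₀-proper : All Proper F₀
          F₀-proper = All.tabulate (All.lookup F-proper ∘ F₀⊆F)

          Σx Σv : ℕ
          Σx = sum (map (λ e → value x [ e ]) F₀)
          Σv = sum (map (λ e → value v [ e ]) F₀)

          -- The edges of `F₀` that share an end with uy number `degree u F₀ + degree y F₀`, and
          -- each of them saves `γ`. As x has the larger degree, ux saves at least one `γ` more than
          -- uv.
          sums : 4 ≤ N → degree v F₀ < degree x F₀ → Σx + γ ≤ Σv
          sums 4≤N deg< = begin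
            Σx + γ ≤⟨ +-monoˡ-≤ γ (firsts-sum _ (level hα hβ ∘ touches x) F₀ at-most) ⟩
            Tx + γ ≤⟨ +-cancelʳ-≤ ((degree u F₀ + degree v F₀) * γ) _ _ (begin
              Tx + γ + (degree u F₀ + degree v F₀) * γ
                ≡⟨ collect Tx γ (degree u F₀) (degree v F₀) ⟩
              Tx + (degree u F₀ + suc (degree v F₀)) * γ
                ≤⟨ +-monoʳ-≤ Tx (*-monoˡ-≤ γ (+-monoʳ-≤ (degree u F₀) deg<)) ⟩
              Tx + (degree u F₀ + degree x F₀) * γ
                ≡⟨ cong (λ z → Tx + z * γ) (count-touches u≢x F₀ F₀-proper (ux∉ ∘ F₀⊆F)) ⟨
              Tx + count (touches x) F₀ * γ
                ≡⟨ levels hβ≡ (touches x) F₀ ⟩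
              k₀ * hβ
                ≡⟨ levels hβ≡ (touches v) F₀ ⟨
              Tv + count (touches v) F₀ * γ
                ≡⟨ cong (λ z → Tv + z * γ) (count-touches u≢v F₀ F₀-proper uv∉F₀) ⟩
              Tv + (degree u F₀ + degree v F₀) * γ ∎) ⟩
            Tv ≤⟨ firsts-sum (level hα hβ ∘ touches v) _ F₀ at-least ⟩
            Σv ∎
            where
            Tx = sum (map (level hα hβ ∘ touches x) F₀)
            Tv = sum (map (level hα hβ ∘ touches v) F₀)
            collect : ∀ T γ p q → T + γ + (p + q) * γ ≡ T + (p + (1 + q)) * γ
            collect = solve-∀
            at-most : ∀ {e} → e ∈ F₀ → value x [ e ] ≤ level hα hβ (touches x e)
            at-most {e} e∈ = ≤-trans (≤-reflexive (sym (value≡ x [ e ]))) (partition-≤ (partition 4≤N ix u≢x e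
              (All.lookup F₀-proper e∈) (All.lookup F₀-inner e∈) λ { refl → ux∉ (F₀⊆F e∈) }))
            at-least : ∀ {e} → e ∈ F₀ → level hα hβ (touches v e) ≤ value v [ e ]
            at-least {e} e∈ = ≤-trans (partition-≥ (partition 4≤N iv u≢v e
              (All.lookup F₀-proper e∈) (All.lookup F₀-inner e∈) λ { refl → uv∉F₀ e∈ })) (≤-reflexive (value≡ v [ e ]))

          initial : 4 ≤ N → value x [] ≤ value v []
          initial 4≤N = ≤-trans (≤-reflexive (sym (value≡ x []))) (≤-trans (partition-≤ (pair₀ 4≤N ix u≢x))
            (≤-trans (partition-≥ (pair₀ 4≤N iv u≢v)) (≤-reflexive (value≡ v []))))

          -- In `expand₂` the zeroth order does not favour uv, and the first order favours ux by
          -- `γ`. By `worse` the sum over all orders does not favour ux, so the error term has to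
          -- make up for `γ`.
          gap : 4 ≤ N → degree v F₀ < degree x F₀ → b * γ ≤ 2 ^ k₀ * τ
          gap 4≤N deg< = *-cancelˡ-≤ (b ^ k₀) {{m^n≢0 b k₀}} (+-cancelˡ-≤ (b * b * B₁ + (b * b * (b ^ k₀ * V₁) + b * (b ^ k₀ * Σx))) _ _ (begin
            b * b * B₁ + (b * b * (b ^ k₀ * V₁) + b * (b ^ k₀ * Σx)) + b ^ k₀ * (b * γ)
              ≡⟨ regroup b B₁ (b ^ k₀) V₁ Σx γ ⟩
            b * b * B₁ + (b * b * (b ^ k₀ * V₁) + b * (b ^ k₀ * (Σx + γ)))
              ≤⟨ +-monoʳ-≤ (b * b * B₁) (+-mono-≤ (*-monoʳ-≤ (b * b) (*-monoʳ-≤ (b ^ k₀) (initial 4≤N)))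
                                                 (*-monoʳ-≤ b (*-monoʳ-≤ (b ^ k₀) (sums 4≤N deg<)))) ⟩
            b * b * B₁ + (b * b * (b ^ k₀ * value v []) + b * (b ^ k₀ * Σv))
              ≤⟨ expand₂ F₀ [] F₀-inner [] ⟩
            b * b * 𝔼 F₀ (value v) [] + (b * b * (b ^ k₀ * V₁) + b * (b ^ k₀ * Σx)) + 2 ^ k₀ * b ^ k₀ * τ
              ≤⟨ +-mono-≤ (+-monoˡ-≤ _ (*-monoʳ-≤ (b * b) worse)) (≤-reflexive (flip₃ (2 ^ k₀) (b ^ k₀) τ)) ⟩
            b * b * B₁ + (b * b * (b ^ k₀ * V₁) + b * (b ^ k₀ * Σx)) + b ^ k₀ * (2 ^ k₀ * τ) ∎))
            where
            B₁ = 𝔼 F₀ (value x) []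
            V₁ = value x []
            open Expansion b InnerEdge (value x) (value v) τ (value-close (≤-trans (s≤s z≤n) 4≤N)) using (expand₂)
            regroup : ∀ b B p V Σ γ → b * b * B + (b * b * (p * V) + b * (p * Σ)) + p * (b * γ)
                                    ≡ b * b * B + (b * b * (p * V) + b * (p * (Σ + γ)))
            regroup = solve-∀
            flip₃ : ∀ p q r → p * q * r ≡ q * (p * r)
            flip₃ = solve-∀

          -- Since `β₁ ≥ b ^ 2`, `γ` is at least b^(7 + 2 (N - 4)), and this exponent is
          -- `len-core ∸ 2`, the one in `τ`.
          γ-large : 4 ≤ N → 2 ^ K < b → 2 ^ K * b ^ (len-core ∸ 2) < b * γ
          γ-large 4≤N large-b = begin-strict
            2 ^ K * b ^ (len-core ∸ 2)   <⟨ *-monoˡ-< (b ^ (len-core ∸ 2)) {{m^n≢0 b (len-core ∸ 2)}} large-b ⟩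
            b * b ^ (len-core ∸ 2)       ≡⟨ cong (b *_) (cong (b ^_) exponent) ⟩
            b * b ^ (7 + 2 * N′)         ≡⟨ cong (b *_) (^-distribˡ-+-* b 7 (2 * N′)) ⟩
            b * (b ^ 7 * b ^ (2 * N′))   ≡⟨ cong (λ z → b * (b ^ 7 * z)) (^-*-assoc b 2 N′) ⟨
            b * (b ^ 7 * (b ^ 2) ^ N′)   ≤⟨ *-monoʳ-≤ b (*-monoʳ-≤ (b ^ 7) (^-monoˡ-≤ N′ b²≤β₁)) ⟩
            b * (b ^ 7 * rest^)          ≤⟨ m≤m+n _ (b * (b * b * b * b * b * b * rest^ * (b + 2))) ⟩
            b * (b ^ 7 * rest^) + b * (b * b * b * b * b * b * rest^ * (b + 2)) ≡⟨ expand b rest^ ⟩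
            b * γ ∎
            where
            exponent : len-core ∸ 2 ≡ 7 + 2 * N′
            exponent = ≡.trans (cong (_∸ 2) (≡.trans (length-core cs) (cong (λ z → 1 + 2 * z) (sym (m+[n∸m]≡n 4≤N)))))
                               (≡.trans (cong (_∸ 2) (arith N′)) refl)
              where
              arith : ∀ k → 1 + 2 * (4 + k) ≡ 2 + (7 + 2 * k)
              arith = solve-∀
            b²≤β₁ : b ^ 2 ≤ β₁
            b²≤β₁ = ≤-trans (m≤m+n (b ^ 2) (b + b)) (≤-reflexive (form b))
              where
              form : ∀ b → b * (b * 1) + (b + b) ≡ 1 * (b * 1) + b * (1 * 1 + b * 1)
              form = solve-∀
            expand : ∀ b r → b * (b * (b * (b * (b * (b * (b * (b * 1)))))) * r) + b * (b * b * b * b * b * b * r * (b + 2))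
                           ≡ b * (2 * (b * b * b * b * b) * (1 + b) * r * b)
            expand = solve-∀

        degree-u─v : ∀ y → degree y F ≡ bit (ends? y (u ─ v)) + degree y F₀
        degree-u─v y = count-↭ (ends? y) F↭₀

        ends-─ : ∀ y → ends? y (u ─ v) ≡ ⌊ y Fin.≟ u ⌋ ∨ ⌊ y Fin.≟ v ⌋
        ends-─ y with ─-either u v
        ... | inj₁ eq = cong (ends? y) eq
        ... | inj₂ eq = ≡.trans (cong (ends? y) eq) (Bool.∨-comm ⌊ y Fin.≟ v ⌋ ⌊ y Fin.≟ u ⌋)

        x≢v : x ≢ v
        x≢v refl = ux∉ uv∈

        ends-v : ends? v (u ─ v) ≡ true
        ends-v = ≡.trans (ends-─ v) end
          where
          end : ⌊ v Fin.≟ u ⌋ ∨ ⌊ v Fin.≟ v ⌋ ≡ true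
          end with v Fin.≟ u | v Fin.≟ v
          ... | yes _ | _ = refl
          ... | no _ | yes _ = refl
          ... | no _ | no v≢v = contradiction refl v≢v

        ends-x : ends? x (u ─ v) ≡ false
        ends-x = ≡.trans (ends-─ x) end
          where
          end : ⌊ x Fin.≟ u ⌋ ∨ ⌊ x Fin.≟ v ⌋ ≡ false
          end with x Fin.≟ u | x Fin.≟ v
          ... | yes x≡u | _ = contradiction (sym x≡u) u≢x
          ... | no _ | yes x≡v = contradiction x≡v x≢v
          ... | no _ | no _ = refl

      swap-improves : 4 ≤ length inners → degree v F ≤ degree x F → ⊥
      swap-improves 4≤ deg≤ = <-irrefl refl (<-≤-trans (γ-large 4≤N (n<1+n (2 ^ K))) (≤-trans (gap 4≤N deg<) (≤-reflexive total)))
        where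
        b = suc (2 ^ K)
        open Weighted b
        4≤N : 4 ≤ N
        4≤N = ≤-trans 4≤ (≤-reflexive (sym (↭-length common↭inners)))
        -- The edge uv counts for v but not for x, so removing it makes the inequality strict.
        deg< : degree v F₀ < degree x F₀
        deg< = ≤-trans (≤-reflexive (cong (λ z → bit z + degree v F₀) (sym ends-v)))
          (≤-trans (≤-reflexive (sym (degree-u─v v))) (≤-trans deg≤
            (≤-reflexive (≡.trans (degree-u─v x) (cong (λ z → bit z + degree x F₀) ends-x)))))
        total : 2 ^ k₀ * τ ≡ 2 ^ K * b ^ (len-core ∸ 2)
        total = ≡.trans (sym (*-assoc (2 ^ k₀) (2 ^ len-core) _)) (cong (_* b ^ (len-core ∸ 2)) (sym (^-distribˡ-+-* 2 k₀ len-core)))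

-- Dense graphs

argmin : ∀ {A : Set} (f : A → ℕ) x xs → ∃[ v ] (v ∈ x ∷ xs × (∀ {y} → y ∈ x ∷ xs → f v ≤ f y))
argmin f x [] = x , here refl , λ { (here refl) → ≤-refl }
argmin f x (y ∷ ys) with argmin f y ys
... | v , v∈ , min with f x ≤? f v
... | yes x≤v = x , here refl , λ { (here refl) → ≤-refl ; (there z∈) → ≤-trans x≤v (min z∈) }
... | no x≰v = v , there v∈ , λ { (here refl) → ≰⇒≥ x≰v ; (there z∈) → min z∈ }

count-≤ : ∀ {A : Set} (φ : A → Bool) {xs ys} → Unique xs → (∀ {x} → x ∈ xs → φ x ≡ true → x ∈ ys) → count φ xs ≤ length ys
count-≤ φ {xs} {ys} uniq sub = ≤-trans (≤-reflexive (sym (filter-length xs)))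
  (Unique-⊆-length (Unique.filter⁺ true? uniq) λ x∈ → let (p , q) = ∈-filter⁻ true? {xs = xs} x∈ in sub p q)
  where
  true? = λ x → φ x Bool.≟ true
  filter-length : ∀ xs → length (filter true? xs) ≡ count φ xs
  filter-length [] = refl
  filter-length (x ∷ xs) with φ x
  ... | true = cong suc (filter-length xs)
  ... | false = filter-length xs

suc-C-2 : ∀ k → suc k C 2 ≡ k + k C 2
suc-C-2 k = ≡.trans (sym (nCk+nC[k+1]≡[n+1]C[k+1] k 1)) (cong (_+ k C 2) (nC1≡n k))

dominated-C : ∀ δ ρ → dominated δ ρ + ρ C 2 ≡ (δ + ρ) C 2
dominated-C zero ρ = refl
dominated-C (suc δ) ρ = ≡.trans (+-assoc (δ + ρ) (dominated δ ρ) (ρ C 2))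
  (≡.trans (cong (δ + ρ +_) (dominated-C δ ρ)) (sym (suc-C-2 (δ + ρ))))

-- A dominating vertex that becomes an ordinary one loses its edges to the other `ρ`.
dominated-suc : ∀ δ ρ → dominated (suc δ) ρ ≡ dominated δ (suc ρ) + ρ
dominated-suc zero ρ = +-identityʳ ρ
dominated-suc (suc δ) ρ = ≡.trans (cong (suc δ + ρ +_) (dominated-suc δ ρ)) (arith δ ρ (dominated δ (suc ρ)))
  where
  arith : ∀ δ ρ x → 1 + δ + ρ + (x + ρ) ≡ δ + (1 + ρ) + x + ρ
  arith = solve-∀

2≤C⇒3≤ : ∀ ρ → 2 ≤ ρ C 2 → 3 ≤ ρ
2≤C⇒3≤ 0 ()
2≤C⇒3≤ 1 ()
2≤C⇒3≤ 2 (s≤s ())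
2≤C⇒3≤ (suc (suc (suc ρ))) _ = s≤s (s≤s (s≤s z≤n))

module _ {n : ℕ} where

  dominate : List (Fin n) → List (Fin n) → List (Edge n)
  dominate [] R = []
  dominate (u ∷ us) R = hub u (us ++ R) ++ dominate us R

  dominate-ends : ∀ us R → EndsIn (us ++ R) (dominate us R)
  dominate-ends [] R = []
  dominate-ends (u ∷ us) R = hub-ends id (dominate-ends us R)

  dominate-simple : ∀ us R → Unique (us ++ R) → Simple (dominate us R)
  dominate-simple [] R _ = [] , []
  dominate-simple (u ∷ us) R (u∉ ∷ uniq) =
    hub-simple (All¬⇒¬Any u∉) uniq id (dominate-simple us R uniq) (dominate-ends us R)

  dominate-⊆ : ∀ us R {L} → Unique (us ++ R) → (∀ {u x} → u ∈ us → x ∈ us ++ R → x ≢ u → u ─ x ∈ L) → dominate us R ⊆ L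
  dominate-⊆ (u ∷ us) R (u∉ ∷ uniq) joined e∈ with ∈-++⁻ (hub u (us ++ R)) e∈
  ... | inj₂ e∈′ = dominate-⊆ us R uniq (λ u∈ x∈ → joined (there u∈) (there x∈)) e∈′
  ... | inj₁ e∈′ with ∈-map⁻ (u ─_) e∈′
  ... | x , x∈ , refl = joined (here refl) (there x∈) (All.lookup u∉ x∈ ∘ sym)

  length-dominate : ∀ us R → length (dominate us R) ≡ dominated (length us) (length R)
  length-dominate [] R = refl
  length-dominate (u ∷ us) R = ≡.trans (length-hub-++ u (us ++ R) (dominate us R))
    (cong₂ _+_ (length-++ us) (length-dominate us R))

  weaken : ∀ {r r′ ℓ} {vs : List (Fin n)} → r ≤ r′ → Network r′ ℓ vs → Network r ℓ vs
  weaken r≤ net = record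
    { edges = Network.edges net ; simple = Network.simple net ; ends = Network.ends net ; size = Network.size net
    ; connected = λ p l≥ r≥ → ≤-trans r≤ (Network.connected net p l≥ r≥) }

  -- One edge more than the dominating vertices us require is enough for a cycle
  -- joined to all but one of them; without it, a split wheel or a bipyramid
  -- takes the place of the cycle.
  network : ∀ (us R : List (Fin n)) {k} → Unique (us ++ R) → 3 ≤ length R → 9 ≤ length us + length R →
            length us + length R ≤ k → dominated (length us) (length R) ≤ k →
            ∃[ vs ] ∃[ ℓ ] (vs ↭ us ++ R × ℓ ≤ k × Network (suc (length us)) ℓ vs)
  network [] R uniq 3≤ 9≤ N≤ _ = R , length R , refl , N≤ , weaken (s≤s z≤n) (cycle uniq 3≤)
  network (u ∷ us) R {k} uniq 3≤ 9≤ N≤ dom≤ with dominated (suc (length us)) (length R) ≟ k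
  -- One edge to spare: `u` gives up its `length R` edges to `R`, and a cycle through `u` and `R`
  -- takes one edge more than that.
  ... | no dom≢ = us ++ u ∷ R , dominated (length us) (suc (length R)) + suc (length R) , shift u us R
    , ≤-trans (≤-reflexive (≡.trans (+-suc _ _) (cong suc (sym (dominated-suc (length us) (length R))))))
              (≤∧≢⇒< dom≤ dom≢)
    , subst (λ r → Network r (dominated (length us) (suc (length R)) + suc (length R)) (us ++ u ∷ R)) (+-comm (length us) 2)
        (join-all us uniq′ (≤-trans 3≤ (n≤1+n _)) (cycle (Unique-++⁻ʳ us uniq′) (≤-trans 3≤ (n≤1+n _))))
    where
    uniq′ : Unique (us ++ u ∷ R)
    uniq′ = Unique-resp-↭ (↭-sym (shift u us R)) uniq
  -- A single dominating vertex meets one edge fewer than there are vertices, so equality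
  -- contradicts `N≤`.
  network (u ∷ []) R {k} uniq 3≤ 9≤ N≤ dom≤ | yes dom≡ =
    contradiction (≤-trans N≤ (≤-reflexive (≡.trans (sym dom≡) (+-identityʳ _)))) (<⇒≱ (n<1+n _))
  -- The split wheel has `1 + 2 * ρ` edges, as many as two dominating vertices meet.
  network (u ∷ v ∷ []) R {k} uniq@(_ ∷ _ ∷ uniqR) 3≤ 9≤ N≤ dom≤ | yes dom≡
    with split-at 2 R (≤-trans (n≤1+n 2) 3≤)
  ... | rs , rs′ , refl , |rs| = _ , _ , refl , ≤-reflexive (≡.trans size≡ dom≡)
    , split-wheel rs rs′ uniq (≤-reflexive (sym |rs|)) 2≤rs′ (cycle uniqR 3≤)
    where
    ρ = length (rs ++ rs′)
    7≤ : 7 ≤ ρ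
    7≤ = s≤s⁻¹ (s≤s⁻¹ 9≤)
    2≤rs′ : 2 ≤ length rs′
    2≤rs′ = +-cancelˡ-≤ 2 _ _ (≤-trans (≤-trans (m≤m+n 4 3) 7≤) (≤-reflexive (≡.trans (length-++ rs) (cong (_+ length rs′) |rs|))))
    size≡ : suc (length rs + (length rs′ + ρ)) ≡ 1 + ρ + (ρ + 0)
    size≡ = ≡.trans (cong suc (≡.trans (sym (+-assoc (length rs) _ ρ)) (cong (_+ ρ) (sym (length-++ rs)))))
                    (cong (λ z → suc (ρ + z)) (sym (+-identityʳ ρ)))
  -- A bipyramid with rim `w ∷ R` has `3 * (1 + ρ)` edges, as many as the three dominating vertices
  -- `u`, `v`, `w` meet outside `us`.
  network (u ∷ v ∷ w ∷ us) R {k} uniq 3≤ 9≤ N≤ dom≤ | yes dom≡ =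
      us ++ u ∷ v ∷ w ∷ R , _ , shifts us (u ∷ v ∷ w ∷ []) , ≤-reflexive (≡.trans size≡ dom≡)
    , subst (λ r → Network r (dominated δ (3 + ρ) + (suc ρ + (suc ρ + suc ρ))) (us ++ u ∷ v ∷ w ∷ R)) (+-comm (length us) 4)
        (join-all us uniq′ (+-monoʳ-≤ 2 (≤-trans 3≤ (n≤1+n _)))
          (bipyramid (Unique-++⁻ʳ us uniq′) (s≤s 3≤) (cycle (Unique-++⁻ʳ (u ∷ v ∷ []) (Unique-++⁻ʳ us uniq′)) (≤-trans 3≤ (n≤1+n _)))))
    where
    δ = length us
    ρ = length R
    uniq′ : Unique (us ++ u ∷ v ∷ w ∷ R)
    uniq′ = Unique-resp-↭ (shifts (u ∷ v ∷ w ∷ []) us) uniq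
    size≡ : dominated δ (3 + ρ) + (suc ρ + (suc ρ + suc ρ)) ≡ dominated (3 + δ) ρ
    size≡ = sym (≡.trans (dominated-suc (2 + δ) ρ) (≡.trans (cong (_+ ρ) (≡.trans (dominated-suc (1 + δ) (1 + ρ))
      (cong (_+ suc ρ) (dominated-suc δ (2 + ρ))))) (arith (dominated δ (3 + ρ)) ρ)))
      where
      arith : ∀ x ρ → x + (2 + ρ) + (1 + ρ) + ρ ≡ x + (1 + ρ + (1 + ρ + (1 + ρ)))
      arith = solve-∀

-- The contradiction for dense graphs

module Dense {n : ℕ} (s t : Fin n) (s≢t : s ≢ t) (d : ℕ) (4≤d : 4 ≤ d)
             (𝒢 : Candidates.Candidate s t s≢t d) where
  open Spokes s t s≢t
  open Candidates.Candidate 𝒢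
  open Structure s t s≢t d 𝒢
  open ≤-Reasoning

  private
    m = length es
    N = length inners

  dense : 9 ≤ N → 3 * N + 1 ≤ m → m + 2 ≤ n C 2 → ⊥
  dense 9≤N m≥ m≤ = finish (lowest inners refl)
    where
    -- Otherwise `saturated` leaves at most one edge in `F`, too few for `3 * N + 1` edges in all.
    full : N ≤ length common
    full with N ≤? length common
    ... | yes N≤ = N≤
    ... | no N≰ = contradiction (≤-trans m≥ (≤-trans (≤-reflexive length-es)
          (≤-trans (+-mono-≤ (saturated (≰⇒> N≰)) (≤-trans (≤-trans (≤-reflexive (arith (length common)))
            (+-monoˡ-≤ (length common) (≰⇒> N≰))) (+-monoʳ-≤ N (<⇒≤ (≰⇒> N≰))))) (≤-reflexive (arith′ N)))))
          (<⇒≱ (≤-trans (+-monoˡ-≤ (2 * N + 1) (≤-trans (s≤s z≤n) 9≤N)) (≤-reflexive (arith″ N))))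
      where
      arith : ∀ c → 1 + 2 * c ≡ 1 + c + c
      arith = solve-∀
      arith′ : ∀ N → 1 + (N + N) ≡ 2 * N + 1
      arith′ = solve-∀
      arith″ : ∀ N → N + (2 * N + 1) ≡ 3 * N + 1
      arith″ = solve-∀
    open Full full
    k = length F
    |common| : length common ≡ N
    |common| = ↭-length common↭inners
    m≡ : m ≡ k + (1 + 2 * N)
    m≡ = ≡.trans length-es (cong (λ z → k + (1 + 2 * z)) |common|)
    N≤k : N ≤ k
    N≤k = +-cancelʳ-≤ (1 + 2 * N) N k (≤-trans (≤-reflexive (arith N)) (≤-trans m≥ (≤-reflexive m≡)))
      where
      arith : ∀ N → N + (1 + 2 * N) ≡ 3 * N + 1
      arith = solve-∀
    k+2≤ : k + 2 ≤ N C 2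
    k+2≤ = +-cancelʳ-≤ (1 + 2 * N) (k + 2) (N C 2) (begin
      k + 2 + (1 + 2 * N)      ≡⟨ arith k N ⟩
      k + (1 + 2 * N) + 2      ≡⟨ cong (_+ 2) m≡ ⟨
      m + 2                    ≤⟨ m≤ ⟩
      n C 2                    ≡⟨ cong (_C 2) length-inners ⟨
      suc (suc N) C 2          ≡⟨ ≡.trans (suc-C-2 (suc N)) (cong (suc N +_) (suc-C-2 N)) ⟩
      suc N + (N + N C 2)      ≡⟨ arith′ N (N C 2) ⟩
      N C 2 + (1 + 2 * N)      ∎)
      where
      arith : ∀ k N → k + 2 + (1 + 2 * N) ≡ k + (1 + 2 * N) + 2
      arith = solve-∀
      arith′ : ∀ N c → 1 + N + (N + c) ≡ c + (1 + 2 * N)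
      arith′ = solve-∀

    lowest : ∀ us → inners ≡ us → ∃[ v ] (Inner v × (∀ {x} → Inner x → degree v F ≤ degree x F))
    lowest [] eq = contradiction (≤-trans 9≤N (≤-reflexive (cong length eq))) λ ()
    lowest (x ∷ us) eq with argmin (λ v → degree v F) x us
    ... | v , v∈ , min = v , ∈-inners⁻ (subst (v ∈_) (sym eq) v∈)
                       , λ {y} iy → min (subst (y ∈_) eq (∈-inners⁺ iy))

    module Lowest {v : Fin n} (iv : Inner v) (min : ∀ {x} → Inner x → degree v F ≤ degree x F) where

      near? : ∀ u → Dec (u ─ v ∈ F)
      near? u = u ─ v ∈ᵉ? F

      near : List (Fin n)
      near = filter near? inners

      near⇒ : ∀ {u} → u ∈ near → u ─ v ∈ F
      near⇒ u∈ = proj₂ (∈-filter⁻ near? {xs = inners} u∈)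

      degree≤ : degree v F ≤ length near
      degree≤ = ≤-trans (count-≤ (ends? v) F-unique neighbour) (≤-reflexive (length-map (_─ v) near))
        where
        listed : ∀ {u e} → Inner u → u ─ v ≡ e → e ∈ F → e ∈ map (_─ v) near
        listed iu refl e∈ = ∈-map⁺ (_─ v) (∈-filter⁺ near? (∈-inners⁺ iu) e∈)
        neighbour : ∀ {e} → e ∈ F → ends? v e ≡ true → e ∈ map (_─ v) near
        neighbour {p , q} e∈ eq with v Fin.≟ p | v Fin.≟ q
        ... | yes refl | _ = listed (proj₂ (All.lookup F-inner e∈))
                               (≡.trans (─-comm q v) (─-proper-≡ (All.lookup F-proper e∈))) e∈
        ... | no _ | yes refl = listed (proj₁ (All.lookup F-inner e∈)) (─-proper-≡ (All.lookup F-proper e∈)) e∈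
        neighbour e∈ () | no _ | no _

      module Rest (R : List (Fin n)) (inners↭ : inners ↭ near ++ R) where

        uniq : Unique (near ++ R)
        uniq = Unique-resp-↭ inners↭ inners-unique

        N≡ : N ≡ length near + length R
        N≡ = ≡.trans (↭-length inners↭) (length-++ near)

        inner : ∀ {u} → u ∈ near ++ R → Inner u
        inner u∈ = ∈-inners⁻ (∈-resp-↭ (↭-sym inners↭) u∈)

        dominating : ∀ {u x} → u ∈ near → x ∈ near ++ R → x ≢ u → u ─ x ∈ F
        dominating {u} {x} u∈ x∈ x≢u with u ─ x ∈ᵉ? F
        ... | yes ux = ux
        ... | no ux∉ = ⊥-elim (Swap.swap-improves s t s≢t d 4≤d 𝒢 full (inner (∈-++⁺ˡ u∈)) iv (inner x∈) (near⇒ u∈) (x≢u ∘ sym) ux∉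
                (≤-trans (m≤m+n 4 5) 9≤N) (min (inner x∈)))

        dominated≤ : dominated (length near) (length R) ≤ k
        dominated≤ = ≤-trans (≤-reflexive (sym (length-dominate near R)))
          (Unique-⊆-length (proj₁ (dominate-simple near R uniq)) (dominate-⊆ near R uniq dominating))

        -- All missing pairs of H lie within `R`, and there are at least two of them.
        3≤R : 3 ≤ length R
        3≤R = 2≤C⇒3≤ (length R) (+-cancelˡ-≤ (dominated (length near) (length R)) _ _ (≤-trans (+-monoˡ-≤ 2 dominated≤)
          (≤-trans k+2≤ (≤-reflexive (≡.trans (cong (_C 2) N≡) (sym (dominated-C (length near) (length R))))))))

        degree<N : degree v F < N
        degree<N = begin
          suc (degree v F)          ≤⟨ s≤s degree≤ ⟩
          1 + length near           ≡⟨ +-comm 1 (length near) ⟩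
          length near + 1           ≤⟨ +-monoʳ-≤ (length near) (≤-trans (s≤s z≤n) 3≤R) ⟩
          length near + length R    ≡⟨ N≡ ⟨
          N ∎

        conclude : ∃[ vs ] ∃[ ℓ ] (vs ↭ near ++ R × ℓ ≤ k × Network (suc (length near)) ℓ vs) → ⊥
        conclude (vs , ℓ , vs↭ , ℓ≤k , net) = LowDegree.low-degree s t s≢t d 4≤d 𝒢 full {v} {vs} {ℓ} iv (≤-trans (m≤m+n 2 7) 9≤N) degree<N
          (↭-trans vs↭ (↭-sym inners↭)) (weaken {r = suc (degree v F)} {r′ = suc (length near)} (s≤s degree≤) net)
          (≤-trans (+-monoˡ-≤ (1 + 2 * N) ℓ≤k) (≤-reflexive (sym m≡)))

        absurd : ⊥
        absurd = conclude (network near R uniq 3≤R (≤-trans 9≤N (≤-reflexive N≡)) (≤-trans (≤-reflexive (sym N≡)) N≤k) dominated≤)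

    finish : ∃[ v ] (Inner v × (∀ {x} → Inner x → degree v F ≤ degree x F)) → ⊥
    finish (v , iv , min) with ⊆⇒↭ (Unique.filter⁺ (Lowest.near? iv min) inners-unique)
                                   (λ u∈ → proj₁ (∈-filter⁻ (Lowest.near? iv min) {xs = inners} u∈))
    ... | R , inners↭ = Lowest.Rest.absurd iv min R inners↭

-- The two ranges of m

≤∸⇒+≤ : ∀ {m} c k → 1 ≤ m → m ≤ k ∸ c → m + c ≤ k
≤∸⇒+≤ {m} c k 1≤m m≤ with c ≤? k
... | yes c≤k = ≤-trans (+-monoˡ-≤ c m≤) (≤-reflexive (m∸n+n≡m c≤k))
-- The truncated difference is `0` here, which `1 ≤ m` excludes.
... | no c≰k = contradiction (≤-trans 1≤m (≤-trans m≤ (≤-reflexive (m≤n⇒m∸n≡0 (≰⇒≥ c≰k))))) λ ()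

sparse-range : ∀ {n N m} → 2 + N ≡ n → 20 ≤ m → m ≤ 3 * n ∸ 9 → m + 3 ≤ 3 * N
sparse-range {N = N} {m} refl 20≤m m≤ =
  ≤∸⇒+≤ 3 (3 * N) (≤-trans (s≤s z≤n) 20≤m) (≤-trans m≤ (≤-reflexive (cong (_∸ 9) (*-distribˡ-+ 3 2 N))))

dense-range : ∀ {n N m} → 2 + N ≡ n → 3 * n ∸ 5 ≤ m → 3 * N + 1 ≤ m
dense-range {N = N} {m} refl m≥ =
  ≤-trans (≤-reflexive (≡.trans (+-comm (3 * N) 1) (cong (_∸ 5) (sym (*-distribˡ-+ 3 2 N))))) m≥

theorem4 : (d n m : ℕ) → 4 ≤ d → 11 ≤ n →
    ((20 ≤ m × m ≤ 3 * n ∸ 9) ⊎ (3 * n ∸ 5 ≤ m × m ≤ (n C 2) ∸ 2)) →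
    ¬ (Σ[ G ∈ TTG n m ] IsUMRTTG d G)
theorem4 d n m 4≤d 11≤n range (GT@(G , refl) , umr) = cases range
  where
  open TwoTerminalGraph G
  open Spokes s t s≢t
  open Candidates s t s≢t d
  N = length inners
  9≤N : 9 ≤ N
  9≤N = s≤s⁻¹ (s≤s⁻¹ (≤-trans 11≤n (≤-reflexive (sym length-inners))))
  simple : Simple edges
  simple = edges-simple graph
  optimal : Optimal s t s≢t d edges
  optimal = UMRTTG⇒Optimal d GT umr
  cases : ((20 ≤ m × m ≤ 3 * n ∸ 9) ⊎ (3 * n ∸ 5 ≤ m × m ≤ (n C 2) ∸ 2)) → ⊥
  cases (inj₁ (20≤m , m≤)) = sparse-case (candidate 4≤d simple optimal (≤-trans (m≤m+n 3 17) 20≤m))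
    where
    sparse-case : Σ[ 𝒢 ∈ Candidate ] length (Candidate.F 𝒢 ++ core (Candidate.common 𝒢)) ≡ m → ⊥
    sparse-case (𝒢 , len) = Sparse.sparse s t s≢t d 4≤d 𝒢 (≤-trans 20≤m (≤-reflexive (sym len)))
      (≤-trans (+-monoˡ-≤ 3 (≤-reflexive len)) (sparse-range length-inners 20≤m m≤))
  cases (inj₂ (m≥ , m≤)) = dense-case (candidate 4≤d simple optimal 3≤m)
    where
    3N+1≤m : 3 * N + 1 ≤ m
    3N+1≤m = dense-range length-inners m≥
    3≤m : 3 ≤ m
    3≤m = ≤-trans (≤-trans (≤-trans (m≤m+n 3 6) 9≤N) (≤-trans (m≤m+n N (2 * N)) (m≤m+n (3 * N) 1))) 3N+1≤m
    dense-case : Σ[ 𝒢 ∈ Candidate ] length (Candidate.F 𝒢 ++ core (Candidate.common 𝒢)) ≡ m → ⊥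
    dense-case (𝒢 , len) = Dense.dense s t s≢t d 4≤d 𝒢 9≤N (≤-trans 3N+1≤m (≤-reflexive (sym len)))
      (≤-trans (+-monoˡ-≤ 2 (≤-reflexive len)) (≤∸⇒+≤ 2 (n C 2) (≤-trans (s≤s z≤n) 3≤m) m≤))
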